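{- For instances of $1||\sum_{\le k}e_j+\sum w_jC_j$ consisting of a set $J$ of $n$ jobs with $\overline{p}$ distinct processing times, an optimal solution can be computed in time $O(n\cdot(k+1)^{\overline{p}}+n\log n)$.
   Context: Problem $1||\sum_{\le k}e_j+\sum w_jC_j$ (scheduling with rejection): given an integer $k$ and a set $J$ of $n$ jobs, all released at time $0$, each job $j$ having processing time $p_j\in\mathbb{N}$, weight $w_j\in\mathbb{N}$ and rejection cost $e_j\in\mathbb{N}$, choose a set $J'\subseteq J$ of at most $k$ rejected jobs and schedule all jobs of $J\setminus J'$ non-preemptively on a single machine so as to minimize $\sum_{j\in J\setminus J'}w_jC_j+\sum_{j\in J'}e_j$, where $C_j$ is the completion time of $j$. $\overline{p}$ denotes the number of distinct values $p_j$. -}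

module Defs where

import Algebra.Properties.CommutativeMonoid.Sum
open import Data.Bool.Base using (if_then_else_; not)
open import Data.Fin.Base using (Fin; toℕ; fromℕ<)
open import Data.Fin.Subset using (Subset; ∣_∣; _∉_)
open import Data.Integer.Base using (+_)
open import Data.List.Base using (length; deduplicate; tabulate)
open import Data.Nat.Base using (ℕ; suc; _+_; _*_; _∸_; _^_; _≤_)
open import Data.Nat.Logarithm using (⌈log₂_⌉)
open import Data.Nat.Properties using (_≟_; _<?_; +-0-commutativeMonoid)
open import Data.Product.Base using (_×_)
open import Data.Rational.Base as ℚ using (ℚ; 0ℚ)
import Data.Rational.Properties as ℚ
open import Data.Sum.Base using (_⊎_)
import Data.Vec.Base as Vec
open import Relation.Binary.PropositionalEquality.Core using (_≡_; _≢_)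
open import Relation.Nullary.Decidable.Core using (does; yes; no)

open Algebra.Properties.CommutativeMonoid.Sum +-0-commutativeMonoid using () renaming (sum to sumℕ)
open Algebra.Properties.CommutativeMonoid.Sum ℚ.+-0-commutativeMonoid using () renaming (sum to sumℚ)

------------------------------------------------------------------------
-- Scheduling with rejection

record Instance : Set where
  field
    n k   : ℕ
    p w e : Fin n → ℕ

distinctTimes : Instance → ℕ
distinctTimes I = length (deduplicate _≟_ (tabulate p))
  where open Instance I

ℕ→ℚ : ℕ → ℚ
ℕ→ℚ m = + m ℚ./ 1

-- The start times of rejected jobs are meaningless and are constrained by
-- nothing below.
record Solution (I : Instance) : Set where
  open Instance I
  field
    rejected : Subset n
    start    : Fin n → ℚ

  completion : Fin n → ℚ
  completion j = start j ℚ.+ ℕ→ℚ (p j)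

  cost : ℚ
  cost = sumℚ (λ j → if Vec.lookup rejected j then 0ℚ else ℕ→ℚ (w j) ℚ.* completion j)
     ℚ.+ sumℚ (λ j → if Vec.lookup rejected j then ℕ→ℚ (e j) else 0ℚ)

record Feasible (I : Instance) (S : Solution I) : Set where
  open Instance I
  open Solution S
  field
    atMostK       : ∣ rejected ∣ ≤ k
    afterRelease  : ∀ j → j ∉ rejected → 0ℚ ℚ.≤ start j
    singleMachine : ∀ i j → i ∉ rejected → j ∉ rejected → i ≢ j →
                    (completion i ℚ.≤ start j) ⊎ (completion j ℚ.≤ start i)

Optimal : (I : Instance) → Solution I → Set
Optimal I S = Feasible I S ×
  (∀ S′ → Feasible I S′ → Solution.cost S ℚ.≤ Solution.cost S′)

------------------------------------------------------------------------
-- Model of computation: a word RAM with structured control flow.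
--
-- The memory consists of registers and of arrays, both named by numerals
-- fixed in the program text. A program mentions only finitely many names,
-- so interleaving its arrays in one linear memory gives the usual RAM with
-- indirect addressing, up to a constant factor.

infix  9 _⟦_⟧
infixl 7 _⊗_
infixl 6 _⊕_ _⊖_
infix  4 _:=_ _⟦_⟧:=_ if_then_else′_ while_loop_
infixr 3 _⨾_

data Expr : Set where
  lit         : ℕ → Expr
  reg         : ℕ → Expr
  _⟦_⟧        : ℕ → Expr → Expr
  _⊕_ _⊖_ _⊗_ : Expr → Expr → Expr

data Cmd : Set where
  skip           : Cmd
  _:=_           : ℕ → Expr → Cmd
  _⟦_⟧:=_        : ℕ → Expr → Expr → Cmd
  _⨾_            : Cmd → Cmd → Cmd
  if_then_else′_ : Expr → Cmd → Cmd → Cmd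
  while_loop_    : Expr → Cmd → Cmd

record State : Set where
  constructor ⟨_,_⟩
  field
    regs   : ℕ → ℕ
    arrays : ℕ → ℕ → ℕ
open State public

update : {A : Set} → (ℕ → A) → ℕ → A → (ℕ → A)
update f i v j = if does (i ≟ j) then v else f j

setReg : State → ℕ → ℕ → State
setReg σ x v = ⟨ update (regs σ) x v , arrays σ ⟩

setCell : State → ℕ → ℕ → ℕ → State
setCell σ a i v = ⟨ regs σ , update (arrays σ) a (update (arrays σ a) i v) ⟩

eval : State → Expr → ℕ
eval σ (lit m)   = m
eval σ (reg x)   = regs σ x
eval σ (a ⟦ i ⟧) = arrays σ a (eval σ i)
eval σ (f ⊕ g)   = eval σ f + eval σ g
eval σ (f ⊖ g)   = eval σ f ∸ eval σ g
eval σ (f ⊗ g)   = eval σ f * eval σ g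

exprTime : Expr → ℕ
exprTime (lit _)   = 1
exprTime (reg _)   = 1
exprTime (_ ⟦ i ⟧) = suc (exprTime i)
exprTime (f ⊕ g)   = suc (exprTime f + exprTime g)
exprTime (f ⊖ g)   = suc (exprTime f + exprTime g)
exprTime (f ⊗ g)   = suc (exprTime f + exprTime g)

-- B ⊢ c , σ ⇓ τ [ t ]: started in σ, the command c halts in τ after t unit-cost
-- steps, and every word it writes is at most B. Guards hold when nonzero.
-- Bounding the written words suffices: the expressions of a fixed program
-- have bounded size, so their intermediate values are polynomial in B and
-- occupy a bounded number of words.
data _⊢_,_⇓_[_] (B : ℕ) : Cmd → State → State → ℕ → Set where
  ⇓skip : ∀ {σ} → B ⊢ skip , σ ⇓ σ [ 1 ]
  ⇓reg : ∀ {σ x f} → eval σ f ≤ B →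
    B ⊢ x := f , σ ⇓ setReg σ x (eval σ f) [ suc (exprTime f) ]
  ⇓cell : ∀ {σ a i f} → eval σ f ≤ B →
    B ⊢ a ⟦ i ⟧:= f , σ ⇓ setCell σ a (eval σ i) (eval σ f) [ suc (exprTime i + exprTime f) ]
  ⇓seq : ∀ {σ τ υ c d s t} →
    B ⊢ c , σ ⇓ τ [ s ] → B ⊢ d , τ ⇓ υ [ t ] →
    B ⊢ c ⨾ d , σ ⇓ υ [ s + t ]
  ⇓then : ∀ {σ τ f c d t} → eval σ f ≢ 0 → B ⊢ c , σ ⇓ τ [ t ] →
    B ⊢ if f then c else′ d , σ ⇓ τ [ suc (exprTime f + t) ]
  ⇓else : ∀ {σ τ f c d t} → eval σ f ≡ 0 → B ⊢ d , σ ⇓ τ [ t ] →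
    B ⊢ if f then c else′ d , σ ⇓ τ [ suc (exprTime f + t) ]
  ⇓done : ∀ {σ f c} → eval σ f ≡ 0 →
    B ⊢ while f loop c , σ ⇓ σ [ suc (exprTime f) ]
  ⇓loop : ∀ {σ τ υ f c s t} → eval σ f ≢ 0 →
    B ⊢ c , σ ⇓ τ [ s ] → B ⊢ while f loop c , τ ⇓ υ [ t ] →
    B ⊢ while f loop c , σ ⇓ υ [ suc (exprTime f + (s + t)) ]

------------------------------------------------------------------------
-- Input and output conventions

padded : ∀ {n} → (Fin n → ℕ) → ℕ → ℕ
padded {n} f i with i <? n
... | yes i<n = f (fromℕ< i<n)
... | no  _   = 0

-- Registers 0 and 1 hold n and k, arrays 0, 1 and 2 hold p, w and e, and
-- everything else is 0. Neither the number of distinct processing times nor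
-- any ordering of the jobs is provided.
inputState : Instance → State
inputState I = ⟨ inRegs , inArrays ⟩
  where
  open Instance I
  inRegs : ℕ → ℕ
  inRegs 0 = n
  inRegs 1 = k
  inRegs _ = 0
  inArrays : ℕ → ℕ → ℕ
  inArrays 0 = padded p
  inArrays 1 = padded w
  inArrays 2 = padded e
  inArrays _ = λ _ → 0

-- Array 3 marks the rejected jobs by nonzero entries; array 4 holds the
-- start times.
output : (I : Instance) → State → Solution I
output I τ = record
  { rejected = Vec.tabulate (λ j → not (does (arrays τ 3 (toℕ j) ≟ 0)))
  ; start    = λ j → ℕ→ℚ (arrays τ 4 (toℕ j))
  }

------------------------------------------------------------------------
-- Resource bounds

timeBound : Instance → ℕ
timeBound I = n * (k + 1) ^ distinctTimes I + n * ⌈log₂ n ⌉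
  where open Instance I

-- Words of O(log N) bits, i.e. values up to a fixed power of N, where N
-- exceeds every input number and the permitted number of steps (so that
-- memory can be addressed).
wordBound : ℕ → Instance → ℕ
wordBound d I = (2 + n + k + sumℕ (λ j → p j + w j + e j) + timeBound I) ^ d
  where open Instance I

{-# OPTIONS --safe #-}
module Submission where

-- By Smith's rule an optimal schedule of the accepted jobs serves them by
-- non-increasing w j / p j: deleting the job that is last in this order and closing the
-- gap it leaves turns any schedule of the others into a feasible one, and the saving is
-- at least the cost of serving that job at the very end. So after an O(n log n) merge
-- sort only the set of rejected jobs remains to be chosen. A dynamic program runs
-- through the jobs in this order; the completion time of the next accepted job depends
-- only on how many jobs of each processing time were rejected so far. These numbers are
-- at most k, hence are the digits of a number below (k + 1) ^ p̄, rejecting a job adds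
-- the power of k + 1 of its processing time to this number, and no carry can occur
-- while at most k jobs are rejected in total. Each of the n (k + 1) ^ p̄ table entries
-- thus takes constant time. Finding the digit of every job by linear search costs
-- n p̄ ≤ n (k + 1) ^ p̄ for k ≥ 1, and is superfluous for k = 0.

open import Defs
open import Algebra.Bundles using (CommutativeMonoid)
import Algebra.Properties.CommutativeMonoid.Sum
open import Data.Bool.Base using (Bool; true; false; T; not; _∧_; if_then_else_)
open import Data.Bool.Properties using (T-∧)
open import Data.Fin.Base using (Fin; zero; suc; toℕ; fromℕ<)
open import Data.Fin.Properties using (toℕ<n; toℕ-fromℕ<; fromℕ<-toℕ; toℕ-injective; injective⇒≤)
open import Data.Fin.Subset using (Subset; ∣_∣; _∉_)
import Data.Integer.Base as ℤ
import Data.Integer.Properties as ℤ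
open import Data.List.Base as List using (List; []; _∷_; _++_; length; take; drop; merge; filter; foldr; deduplicate)
open import Data.List.Membership.Propositional using (_∈_)
open import Data.List.Membership.Propositional.Properties using (∈-tabulate⁺; ∈-deduplicate⁺)
open import Data.List.Properties using (length-++; ++-identityʳ; ++-assoc; take++drop≡id; length-take; length-drop; drop-drop; take-all; drop-all; take-[]; drop-[])
open import Data.List.Relation.Binary.Permutation.Propositional as ↭ using (_↭_; ↭-refl; ↭-sym; ↭-trans; ↭-reflexive)
open import Data.List.Relation.Binary.Permutation.Propositional.Properties using (merge-↭; All-resp-↭; ↭-length; ++⁺; ∷↭∷ʳ)
open import Data.List.Relation.Unary.All as All using (All; []; _∷_)
import Data.List.Relation.Unary.All.Properties as All
open import Data.List.Relation.Unary.AllPairs as AllPairs using (AllPairs; []; _∷_)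
import Data.List.Relation.Unary.AllPairs.Properties as AllPairs
open import Data.List.Relation.Unary.Any using (index)
open import Data.List.Relation.Unary.Any.Properties using (lookup-index)
open import Data.Nat.Base
open import Data.Nat.DivMod using (_%_; [m+kn]%n≡m%n; m<n⇒m%n≡m)
open import Data.Nat.Logarithm using (⌈log₂_⌉; ⌈log₂⌈n/2⌉⌉≡⌈log₂n⌉∸1)
open import Data.Nat.Properties
import Data.Nat.Solver as ℕ-Solver
open import Data.Product.Base using (_×_; _,_; proj₁; proj₂; ∃-syntax)
open import Data.Rational.Base as ℚ using (ℚ; 0ℚ; toℚᵘ)
import Data.Rational.Properties as ℚ
import Data.Rational.Solver as ℚ-Solver
import Data.Rational.Unnormalised.Base as ℚᵘ
import Data.Rational.Unnormalised.Properties as ℚᵘ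
open import Data.Sum.Base as Sum using (_⊎_; inj₁; inj₂)
open import Data.Unit.Base using (tt; ⊤)
open import Data.Vec.Base using (Vec; []; _∷_; lookup)
open import Data.Vec.Properties using (lookup∘tabulate; []=⇒lookup; lookup⇒[]=)
open import Function.Base using (id; _∘_)
open import Function.Bundles using (Equivalence)
open import Level using (0ℓ)
open import Relation.Binary.Definitions using (Decidable; Transitive; Total; Symmetric; tri<; tri≈; tri>)
open import Relation.Binary.PropositionalEquality
open import Relation.Nullary.Decidable using (Dec; yes; no; does; ¬?)
open import Relation.Nullary.Negation using (contradiction; ¬_)

open Algebra.Properties.CommutativeMonoid.Sum +-0-commutativeMonoid using () renaming (sum to sumℕ)

-- A program logic with running times

-- A cell is filled along one particular decision vector, but optimality compares it with every
-- vector of the same key. This is sound because the key fixes both the load and the number of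
-- rejections: load and rejected processing time add up to the total length of the prefix.
-- `Faithful` states exactly this and is the interface between the table and its encoding by digits.
-- The delicate case on the machine is `k = 0`, where the bound is only `n + n log n` and a search
-- among the distinct times could be quadratic. In base 1 all powers are 1 and the table has a
-- single column, so the same program runs with an empty list of registered times, and only the
-- correctness proof distinguishes the two cases. Conditions are arithmetic on naturals: a truncated
-- difference is a strict comparison, a product a conjunction, a sum a disjunction. The functional
-- model uses the same formulas as the program, so that guards of the machine and of the model agree
-- up to equal operands.

keepsReg : ℕ → Cmd → Bool
keepsReg x skip                   = true
keepsReg x (y := _)               = not (does (y ≟ x))
keepsReg x (_ ⟦ _ ⟧:= _)          = true
keepsReg x (c ⨾ d)                = keepsReg x c ∧ keepsReg x d
keepsReg x (if _ then c else′ d)  = keepsReg x c ∧ keepsReg x d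
keepsReg x (while _ loop c)       = keepsReg x c

keepsArr : ℕ → Cmd → Bool
keepsArr a skip                   = true
keepsArr a (_ := _)               = true
keepsArr a (b ⟦ _ ⟧:= _)          = not (does (b ≟ a))
keepsArr a (c ⨾ d)                = keepsArr a c ∧ keepsArr a d
keepsArr a (if _ then c else′ d)  = keepsArr a c ∧ keepsArr a d
keepsArr a (while _ loop c)       = keepsArr a c

update-keeps : {A : Set} (f : ℕ → A) (x : ℕ) (v : A) (y : ℕ) →
               T (not (does (x ≟ y))) → update f x v y ≡ f y
update-keeps f x v y h with does (x ≟ y)
... | false = refl

update-same : {A : Set} (f : ℕ → A) (i : ℕ) (v : A) → update f i v i ≡ v
update-same f i v with i ≡ᵇ i | ≡⇒≡ᵇ i i refl
... | true | _ = refl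

update-other : {A : Set} (f : ℕ → A) {i : ℕ} (v : A) {j : ℕ} → i ≢ j → update f i v j ≡ f j
update-other f {i} v {j} i≢j with i ≡ᵇ j | ≡ᵇ⇒≡ i j
... | true  | h = contradiction (h tt) i≢j
... | false | _ = refl

update-elim : {A : Set} (P : ℕ → A → Set) (f : ℕ → A) (i : ℕ) (v : A) →
              P i v → (∀ {y} → i ≢ y → P y (f y)) → ∀ y → P y (update f i v y)
update-elim P f i v new old y with i ≟ y
... | yes refl = subst (P i) (sym (update-same f i v)) new
... | no  i≢y  = subst (P y) (sym (update-other f v i≢y)) (old i≢y)

module _ {B : ℕ} where

  exec-keepsReg : ∀ x {c σ τ t} → B ⊢ c , σ ⇓ τ [ t ] → T (keepsReg x c) → regs τ x ≡ regs σ x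
  exec-keepsReg x ⇓skip             h = refl
  exec-keepsReg x (⇓reg {σ} {y} _)  h = update-keeps (regs σ) y _ x h
  exec-keepsReg x (⇓cell _)         h = refl
  exec-keepsReg x (⇓seq p q)        h = let (h₁ , h₂) = Equivalence.to T-∧ h in
    trans (exec-keepsReg x q h₂) (exec-keepsReg x p h₁)
  exec-keepsReg x (⇓then _ p)       h = exec-keepsReg x p (proj₁ (Equivalence.to T-∧ h))
  exec-keepsReg x (⇓else {c = c} _ p) h = exec-keepsReg x p (proj₂ (Equivalence.to (T-∧ {keepsReg x c}) h))
  exec-keepsReg x (⇓done _)         h = refl
  exec-keepsReg x (⇓loop _ p q)     h = trans (exec-keepsReg x q h) (exec-keepsReg x p h)

  exec-keepsArr : ∀ a {c σ τ t} → B ⊢ c , σ ⇓ τ [ t ] → T (keepsArr a c) → arrays τ a ≡ arrays σ a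
  exec-keepsArr a ⇓skip                 h = refl
  exec-keepsArr a (⇓reg _)              h = refl
  exec-keepsArr a (⇓cell {σ} {b} _)     h = update-keeps (arrays σ) b _ a h
  exec-keepsArr a (⇓seq p q)            h = let (h₁ , h₂) = Equivalence.to T-∧ h in
    trans (exec-keepsArr a q h₂) (exec-keepsArr a p h₁)
  exec-keepsArr a (⇓then _ p)           h = exec-keepsArr a p (proj₁ (Equivalence.to T-∧ h))
  exec-keepsArr a (⇓else {c = c} _ p)   h = exec-keepsArr a p (proj₂ (Equivalence.to (T-∧ {keepsArr a c}) h))
  exec-keepsArr a (⇓done _)             h = refl
  exec-keepsArr a (⇓loop _ p q)         h = trans (exec-keepsArr a q h) (exec-keepsArr a p h)

-- What a command leaves alone is decided from its text. For a concrete command and numeral the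
-- implicit premise computes to the unit type and is filled in by unification.
record Frame (c : Cmd) (σ τ : State) : Set where
  field
    keptReg : ∀ x {_ : T (keepsReg x c)} → regs τ x ≡ regs σ x
    keptArr : ∀ a {_ : T (keepsArr a c)} → arrays τ a ≡ arrays σ a
open Frame public

frame-refl : ∀ {c σ} → Frame c σ σ
frame-refl = record { keptReg = λ _ → refl ; keptArr = λ _ → refl }

frame-exec : ∀ {B c d σ τ υ t} → Frame c σ τ → B ⊢ d , τ ⇓ υ [ t ] →
             (∀ x → keepsReg x c ≡ keepsReg x d) → (∀ a → keepsArr a c ≡ keepsArr a d) → Frame c σ υ
frame-exec fr p eqR eqA = record
  { keptReg = λ x {h} → trans (exec-keepsReg x p (subst T (eqR x) h)) (keptReg fr x {h})
  ; keptArr = λ a {h} → trans (exec-keepsArr a p (subst T (eqA a) h)) (keptArr fr a {h})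
  }

-- A total-correctness triple: termination, the word bound and the postcondition come together, and
-- the time is only bounded above so that estimates can be rounded.
record Runs (B : ℕ) (c : Cmd) (σ : State) (Q : State → Set) (T : ℕ) : Set where
  constructor runs
  field
    {final} : State
    {time}  : ℕ
    exec    : B ⊢ c , σ ⇓ final [ time ]
    time≤   : time ≤ T
    post    : Q final
open Runs public

module _ {B : ℕ} where

  weaken : ∀ {c σ Q T T′} → T ≤ T′ → Runs B c σ Q T → Runs B c σ Q T′
  weaken T≤T′ (runs p t q) = runs p (≤-trans t T≤T′) q

  consequence : ∀ {c σ T} {Q Q′ : State → Set} → (∀ {τ} → Frame c σ τ → Q τ → Q′ τ) →
                Runs B c σ Q T → Runs B c σ Q′ T
  consequence f (runs p t q) = runs p t (f (frame-exec frame-refl p (λ _ → refl) (λ _ → refl)) q)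

  skipR : ∀ {σ} {Q : State → Set} → Q σ → Runs B skip σ Q 1
  skipR q = runs ⇓skip ≤-refl q

  assignR : ∀ {x f σ} {Q : State → Set} → eval σ f ≤ B → Q (setReg σ x (eval σ f)) →
            Runs B (x := f) σ Q (suc (exprTime f))
  assignR b q = runs (⇓reg b) ≤-refl q

  storeR : ∀ {a i f σ} {Q : State → Set} → eval σ f ≤ B → Q (setCell σ a (eval σ i) (eval σ f)) →
           Runs B (a ⟦ i ⟧:= f) σ Q (suc (exprTime i + exprTime f))
  storeR b q = runs (⇓cell b) ≤-refl q

  infixr 3 _⨾R_ _⨾S_ _⨾F_

  _⨾F_ : ∀ {c d σ T T′} {P Q : State → Set} → Runs B c σ P T →
         (∀ {τ} → Frame c σ τ → P τ → Runs B d τ Q T′) → Runs B (c ⨾ d) σ Q (T + T′)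
  runs p t q ⨾F f = let runs p′ t′ q′ = f (frame-exec frame-refl p (λ _ → refl) (λ _ → refl)) q
                    in runs (⇓seq p p′) (+-mono-≤ t t′) q′

  _⨾R_ : ∀ {x f d σ T′} {Q : State → Set} → eval σ f ≤ B →
         Runs B d (setReg σ x (eval σ f)) Q T′ → Runs B (x := f ⨾ d) σ Q (suc (exprTime f) + T′)
  b ⨾R runs p t q = runs (⇓seq (⇓reg b) p) (+-monoʳ-≤ _ t) q

  _⨾S_ : ∀ {a i f d σ T′} {Q : State → Set} → eval σ f ≤ B →
         Runs B d (setCell σ a (eval σ i) (eval σ f)) Q T′ →
         Runs B (a ⟦ i ⟧:= f ⨾ d) σ Q (suc (exprTime i + exprTime f) + T′)
  b ⨾S runs p t q = runs (⇓seq (⇓cell b) p) (+-monoʳ-≤ _ t) q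

  -- Both branches are charged, which costs a constant factor and keeps the bounds free of maxima.
  ifR : ∀ {f c d σ T T′} {Q : State → Set} →
        (eval σ f ≢ 0 → Runs B c σ Q T) → (eval σ f ≡ 0 → Runs B d σ Q T′) →
        Runs B (if f then c else′ d) σ Q (suc (exprTime f + (T + T′)))
  ifR {f} {σ = σ} {T} {T′} th el with eval σ f ≟ 0
  ... | yes z = let runs p t q = el z in
    runs (⇓else z p) (s≤s (+-monoʳ-≤ (exprTime f) (≤-trans t (m≤n+m T′ T)))) q
  ... | no ¬z = let runs p t q = th ¬z in
    runs (⇓then ¬z p) (s≤s (+-monoʳ-≤ (exprTime f) (≤-trans t (m≤m+n T T′)))) q

  -- The index of `Inv` bounds the iterations still possible. The loop may stop earlier, as the
  -- search for a processing time does; index 0 must force the guard to fail.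
  whileR : ∀ {f c σ T} (Inv : ℕ → State → Set) →
           (∀ {τ} → Frame c σ τ → Inv 0 τ → eval τ f ≡ 0) →
           (∀ {r τ} → Frame c σ τ → Inv (suc r) τ → eval τ f ≢ 0 → Runs B c τ (Inv r) T) →
           ∀ r → Inv r σ →
           Runs B (while f loop c) σ (λ τ → eval τ f ≡ 0 × ∃[ r′ ] Inv r′ τ)
                (r * (suc (exprTime f) + T) + suc (exprTime f))
  whileR {f} {c} {σ} {T} Inv stop step r inv = go r frame-refl inv
    where
    E = suc (exprTime f)
    go : ∀ r {τ} → Frame c σ τ → Inv r τ →
         Runs B (while f loop c) τ (λ τ → eval τ f ≡ 0 × ∃[ r′ ] Inv r′ τ) (r * (E + T) + E)
    go zero fr inv = runs (⇓done (stop fr inv)) ≤-refl (stop fr inv , 0 , inv)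
    go (suc r) {τ} fr inv with eval τ f ≟ 0
    ... | yes z = runs (⇓done z) (m≤n+m E (suc r * (E + T))) (z , suc r , inv)
    ... | no ¬z =
      let runs p t q = step fr inv ¬z
          runs p′ t′ q′ = go r (frame-exec fr p (λ _ → refl) (λ _ → refl)) q
      in runs (⇓loop ¬z p p′)
           (≤-trans (+-monoʳ-≤ E (+-mono-≤ t t′))
             (≤-reflexive (trans (sym (+-assoc E T _)) (sym (+-assoc (E + T) (r * (E + T)) E))))) q′

  -- The guard has the value `N ∸ i`, so its failure together with `i ≤ N` gives `i ≡ N`: the
  -- invariant holds at exactly `N` on exit.
  forR : ∀ {f c σ T} (N : ℕ) (Inv : ℕ → State → Set) →
         (∀ {i τ} → Frame c σ τ → Inv i τ → eval τ f ≡ N ∸ i) →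
         (∀ {i τ} → Frame c σ τ → i < N → Inv i τ → Runs B c τ (Inv (suc i)) T) →
         Inv 0 σ →
         Runs B (while f loop c) σ (Inv N) (N * (suc (exprTime f) + T) + suc (exprTime f))
  forR {f} {c} {σ} {T} N Inv guard step inv =
    consequence finish (whileR Upto stop body N (0 , refl , inv))
    where
    Upto : ℕ → State → Set
    Upto r τ = ∃[ i ] (i + r ≡ N × Inv i τ)
    stop : ∀ {τ} → Frame c σ τ → Upto 0 τ → eval τ f ≡ 0
    stop fr (i , refl , inv) = trans (guard fr inv) (trans (cong (_∸ i) (+-identityʳ i)) (n∸n≡0 i))
    body : ∀ {r τ} → Frame c σ τ → Upto (suc r) τ → eval τ f ≢ 0 → Runs B c τ (Upto r) T
    body {r} fr (i , eq , inv) _ =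
      consequence (λ _ inv′ → suc i , trans (sym (+-suc i r)) eq , inv′)
        (step fr (subst (i <_) eq (m<m+n i z<s)) inv)
    finish : ∀ {τ} → Frame (while f loop c) σ τ → (eval τ f ≡ 0 × ∃[ r ] Upto r τ) → Inv N τ
    finish {τ} fr (z , r , i , eq , inv) = subst (λ j → Inv j τ) i≡N inv
      where
      fr′ : Frame c σ τ
      fr′ = record { keptReg = λ x {h} → keptReg fr x {h} ; keptArr = λ a {h} → keptArr fr a {h} }
      i≡N : i ≡ N
      i≡N = ≤-antisym (subst (i ≤_) eq (m≤m+n i r)) (m∸n≡0⇒m≤n (trans (sym (guard fr′ inv)) z))

-- The dynamic program over numbers of rejected jobs

m*n≢0ˡ : ∀ {m n} → m * n ≢ 0 → m ≢ 0
m*n≢0ˡ h refl = h refl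

m*n≢0ʳ : ∀ {m n} → m * n ≢ 0 → n ≢ 0
m*n≢0ʳ {m} h refl = h (*-zeroʳ m)

m*n≡0⇒n≡0 : ∀ {m n} → m ≢ 0 → m * n ≡ 0 → n ≡ 0
m*n≡0⇒n≡0 {m} {n} m≢0 eq with m*n≡0⇒m≡0∨n≡0 m eq
... | inj₁ m≡0 = contradiction m≡0 m≢0
... | inj₂ n≡0 = n≡0

n<m⇒m∸n≢0 : ∀ {m n} → n < m → m ∸ n ≢ 0
n<m⇒m∸n≢0 n<m eq = <⇒≱ n<m (m∸n≡0⇒m≤n eq)

1∸m+n≢0⇒n≢0 : ∀ {m n} → m ≢ 0 → (1 ∸ m) + n ≢ 0 → n ≢ 0
1∸m+n≢0⇒n≢0 {zero}  h _  = contradiction refl h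
1∸m+n≢0⇒n≢0 {suc m} _ h refl = h (trans (+-identityʳ (0 ∸ m)) (0∸n≡0 m))

-- Uniqueness of quotient and remainder. It serves twice: for the leading digit of a numeral and for
-- row and column of a table address.
*-+-unique : ∀ {M m m′ s s′} → s < M → s′ < M → m * M + s ≡ m′ * M + s′ → m ≡ m′ × s ≡ s′
*-+-unique {suc M} {m} {m′} {s} {s′} s<M s′<M eq =
  *-cancelʳ-≡ m m′ (suc M) (+-cancelʳ-≡ s (m * suc M) (m′ * suc M) (trans eq (cong (m′ * suc M +_) (sym s≡s′)))) , s≡s′
  where
  rem : ∀ q r → r < suc M → (q * suc M + r) % suc M ≡ r
  rem q r r<M = trans (cong (_% suc M) (+-comm (q * suc M) r))
                  (trans ([m+kn]%n≡m%n r q (suc M)) (m<n⇒m%n≡m r<M))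
  s≡s′ : s ≡ s′
  s≡s′ = trans (sym (rem m s s<M)) (trans (cong (_% suc M) eq) (rem m′ s′ s′<M))

-- With the powers of `suc k` as `g` this is the numeral with digits `f`; with the constant 1 it
-- counts rejections; with the list of processing times it is the rejected length.
dot : (ℕ → ℕ) → (ℕ → ℕ) → ℕ → ℕ
dot f g zero    = 0
dot f g (suc c) = f c * g c + dot f g c

bump : ℕ → (ℕ → ℕ) → (ℕ → ℕ)
bump t f = update f t (suc (f t))

dot-zero : ∀ g c → dot (λ _ → 0) g c ≡ 0
dot-zero g zero    = refl
dot-zero g (suc c) = dot-zero g c

dot-bump-≥ : ∀ f g {t} c → c ≤ t → dot (bump t f) g c ≡ dot f g c
dot-bump-≥ f g zero    _   = refl
dot-bump-≥ f g (suc c) c<t = cong₂ (λ a b → a * g c + b)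
  (update-other f _ (>⇒≢ c<t)) (dot-bump-≥ f g c (<⇒≤ c<t))

dot-bump : ∀ f g {t} c → t < c → dot (bump t f) g c ≡ dot f g c + g t
dot-bump f g {t} (suc c) t<1+c with t ≟ c
... | yes refl = trans (cong₂ (λ a b → a * g c + b) (update-same f c _) (dot-bump-≥ f g c ≤-refl))
  (trans (+-assoc (g c) _ _) (+-comm (g c) _))
... | no t≢c = trans (cong₂ (λ a b → a * g c + b) (update-other f _ t≢c)
    (dot-bump f g c (≤∧≢⇒< (≤-pred t<1+c) t≢c)))
  (sym (+-assoc (f c * g c) _ (g t)))

dot-congˡ : ∀ {f f′} g c → (∀ {t} → t < c → f t ≡ f′ t) → dot f g c ≡ dot f′ g c
dot-congˡ g zero    h = refl
dot-congˡ g (suc c) h = cong₂ (λ a b → a * g c + b) (h ≤-refl) (dot-congˡ g c (λ t<c → h (m<n⇒m<1+n t<c)))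

numeral< : ∀ {k f} c → (∀ t → f t ≤ k) → dot f (suc k ^_) c < suc k ^ c
numeral< zero h = z<s
numeral< {k} {f} (suc c) h = <-≤-trans (+-monoʳ-< (f c * suc k ^ c) (numeral< c h))
  (≤-trans (≤-reflexive (+-comm (f c * suc k ^ c) _)) (*-monoˡ-≤ (suc k ^ c) (s≤s (h c))))

-- By `numeral<` the lower digits stay below the place value of the top one, so division splits off
-- the top digit and induction handles the rest.
numeral-unique : ∀ {k f f′} c → (∀ t → f t ≤ k) → (∀ t → f′ t ≤ k) →
                 dot f (suc k ^_) c ≡ dot f′ (suc k ^_) c → ∀ {t} → t < c → f t ≡ f′ t
numeral-unique {k} {f} {f′} (suc c) h h′ eq {t} t<1+c
  with *-+-unique {m = f c} {f′ c} (numeral< c h) (numeral< c h′) eq | t ≟ c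
... | fc≡ , _   | yes refl = fc≡
... | _ , rest≡ | no t≢c   = numeral-unique c h h′ rest≡ (≤∧≢⇒< (≤-pred t<1+c) t≢c)

select : {A : Set} → ℕ → A → A → A
select zero    a b = b
select (suc _) a b = a

select-≢0 : {A : Set} {g : ℕ} {a b : A} → g ≢ 0 → select g a b ≡ a
select-≢0 {g = zero}  h = contradiction refl h
select-≢0 {g = suc _} h = refl

select-≡0 : {A : Set} {g : ℕ} {a b : A} → g ≡ 0 → select g a b ≡ b
select-≡0 refl = refl

-- Jobs are served in the order x 0, x 1, …; a decision vector lists which of the
-- first m of them are rejected, the latest one first.
module Decisions (x p w e : ℕ → ℕ) where

  busy : ∀ {m} → Vec Bool m → ℕ
  busy []                  = 0
  busy (true ∷ d)          = busy d
  busy {suc m} (false ∷ d) = busy d + p (x m)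

  total : ∀ {m} → Vec Bool m → ℕ
  total []                  = 0
  total {suc m} (true ∷ d)  = total d + e (x m)
  total {suc m} (false ∷ d) = total d + w (x m) * (busy d + p (x m))

  rejections : ∀ {m} → Vec Bool m → ℕ
  rejections []          = 0
  rejections (true ∷ d)  = suc (rejections d)
  rejections (false ∷ d) = rejections d

  restrict : (ℕ → Bool) → ∀ m → Vec Bool m
  restrict r zero    = []
  restrict r (suc m) = r (x m) ∷ restrict r m

  module Keyed (mu : ℕ → ℕ) (k : ℕ) where

    key : ∀ {m} → Vec Bool m → ℕ
    key []                 = 0
    key {suc m} (true ∷ d) = key d + mu (x m)
    key (false ∷ d)        = key d

    -- budget is the number of rejections still allowed plus one, and 0 for
    -- unreachable states.
    record Cell : Set where
      constructor mkCell
      field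
        value load budget mark : ℕ
    open Cell public

    reject accept : ℕ → Cell → Cell
    reject j c = mkCell (value c + e j) (load c) (budget c ∸ 1) 1
    accept j c = mkCell (value c + w j * (load c + p j)) (load c + p j) (budget c) 0

    -- Nonzero exactly if `mu j ≤ s`, the predecessor `u` is reachable with a rejection to spare
    -- (budget at least 2), and accepting is either impossible (budget 0) or strictly dearer. For
    -- `mu j > s` the cell `u` is read at column 0, but the first factor vanishes.
    preferReject : ℕ → ℕ → Cell → Cell → ℕ
    preferReject j s a u = ((s + 1) ∸ mu j) * (budget u ∸ 1) *
      ((1 ∸ budget a) + ((value a + w j * (load a + p j)) ∸ (value u + e j)))

    next : ℕ → ℕ → Cell → Cell → Cell
    next j s a u = select (preferReject j s a u) (reject j u) (accept j a)

    cell : ℕ → ℕ → Cell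
    cell zero    zero    = mkCell 0 0 (suc k) 0
    cell zero    (suc _) = mkCell 0 0 0 0
    cell (suc m) s       = next (x m) s (cell m s) (cell m (s ∸ mu (x m)))

    -- Multiplication by the mark replaces a case distinction; the program steps back by the same
    -- expression.
    previous : ℕ → ℕ → ℕ
    previous m s = s ∸ mark (cell (suc m) s) * mu (x m)

    trace : ∀ m → ℕ → Vec Bool m
    trace zero    s = []
    trace (suc m) s = not (does (mark (cell (suc m) s) ≟ 0)) ∷ trace m (previous m s)

    record Sound {m} (c : Cell) (s : ℕ) (d : Vec Bool m) : Set where
      field
        key≡    : key d ≡ s
        budget≡ : rejections d + budget c ≡ suc k
        value≡  : value c ≡ total d
        load≡   : load c ≡ busy d
    open Sound public

    data Step (m s : ℕ) : Set where
      rejecting : cell (suc m) s ≡ reject (x m) (cell m (s ∸ mu (x m))) →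
                  mu (x m) ≤ s → budget (cell m (s ∸ mu (x m))) ∸ 1 ≢ 0 → Step m s
      accepting : cell (suc m) s ≡ accept (x m) (cell m s) → Step m s

    step : ∀ m s → Step m s
    step m s with preferReject (x m) s (cell m s) (cell m (s ∸ mu (x m))) ≟ 0
    ... | yes z = accepting (select-≡0 z)
    ... | no ¬z = rejecting (select-≢0 ¬z)
      (≤-pred (subst (mu (x m) <_) (+-comm s 1) (m∸n≢0⇒n<m (m*n≢0ˡ (m*n≢0ˡ ¬z)))))
      (m*n≢0ʳ {(s + 1) ∸ mu (x m)} (m*n≢0ˡ ¬z))

    previous-reachable : ∀ m s → budget (cell (suc m) s) ≢ 0 → budget (cell m (previous m s)) ≢ 0
    previous-reachable m s h with step m s
    ... | rejecting eq _ h′ rewrite eq | *-identityˡ (mu (x m)) = λ z → h′ (cong (_∸ 1) z)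
    ... | accepting eq rewrite eq = h

    -- Reachable cells never underestimate: following the marks back yields a decision vector with
    -- precisely the stored cost, load and budget.
    trace-sound : ∀ m s → budget (cell m s) ≢ 0 → Sound (cell m s) s (trace m s)
    trace-sound zero zero    h = record { key≡ = refl ; budget≡ = refl ; value≡ = refl ; load≡ = refl }
    trace-sound zero (suc s) h = contradiction refl h
    trace-sound (suc m) s h with step m s | trace-sound m (previous m s) (previous-reachable m s h)
    ... | accepting eq | ih rewrite eq = record
      { key≡    = key≡ ih
      ; budget≡ = budget≡ ih
      ; value≡  = cong₂ (λ v l → v + w (x m) * (l + p (x m))) (value≡ ih) (load≡ ih)
      ; load≡   = cong (_+ p (x m)) (load≡ ih)
      }
    ... | rejecting eq mu≤s h′ | ih rewrite eq | *-identityˡ (mu (x m)) = record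
      { key≡    = trans (cong (_+ mu (x m)) (key≡ ih)) (m∸n+n≡m mu≤s)
      ; budget≡ = trans (sym (+-suc _ _)) (trans (cong (rejections (trace m (s ∸ mu (x m))) +_) (suc-pred′ h′)) (budget≡ ih))
      ; value≡  = cong (_+ e (x m)) (value≡ ih)
      ; load≡   = load≡ ih
      }
      where
      suc-pred′ : ∀ {b} → b ∸ 1 ≢ 0 → suc (b ∸ 1) ≡ b
      suc-pred′ {zero}  h = contradiction refl h
      suc-pred′ {suc b} h = refl

    Sound⇒rejections≤k : ∀ {m c s} {d : Vec Bool m} → budget c ≢ 0 → Sound c s d → rejections d ≤ k
    Sound⇒rejections≤k {c = c} {d = d} h snd with budget c | budget≡ snd
    ... | zero  | _  = contradiction refl h
    ... | suc b | eq = subst (rejections d ≤_) (suc-injective (trans (sym (+-suc _ b)) eq)) (m≤m+n _ b)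

    -- The bound `k` on the rejections is what excludes carries, after which a key could have
    -- several readings.
    Faithful : ℕ → Set
    Faithful n = ∀ {m} → m ≤ n → (d d′ : Vec Bool m) → rejections d ≤ k → rejections d′ ≤ k →
                 key d ≡ key d′ → busy d ≡ busy d′ × rejections d ≡ rejections d′

    module _ {n : ℕ} (faithful : Faithful n) where

      -- Bellman's principle: the cell competes with every vector of its key. Extending `d` by an
      -- accepted job compares two completion times, which is why `complete-load` is proved
      -- simultaneously.
      complete : ∀ {m} → m ≤ n → (d : Vec Bool m) → rejections d ≤ k →
                 budget (cell m (key d)) ≢ 0 × value (cell m (key d)) ≤ total d

      -- The cell was perhaps filled along a vector other than `d`. Its trace has the same key as
      -- `d`, so `faithful` transfers load and number of rejections.
      complete-load : ∀ {m} → m ≤ n → (d : Vec Bool m) → rejections d ≤ k →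
                      load (cell m (key d)) ≡ busy d × rejections d + budget (cell m (key d)) ≡ suc k
      complete-load {m} m≤n d d≤k =
        let reach , _ = complete m≤n d d≤k
            snd = trace-sound m (key d) reach
            busy≡ , rej≡ = faithful m≤n (trace m (key d)) d (Sound⇒rejections≤k reach snd) d≤k (key≡ snd)
        in trans (load≡ snd) busy≡ , subst (λ r → r + budget (cell m (key d)) ≡ suc k) rej≡ (budget≡ snd)

      complete {zero} m≤n [] d≤k = (λ ()) , z≤n
      complete {suc m} m≤n (false ∷ d) d≤k with complete (<⇒≤ m≤n) d d≤k | complete-load (<⇒≤ m≤n) d d≤k
      ... | reach , val≤ | load≡ , _
        with preferReject (x m) (key d) (cell m (key d)) (cell m (key d ∸ mu (x m))) ≟ 0
      ... | yes z rewrite select-≡0 {a = reject (x m) (cell m (key d ∸ mu (x m)))} {b = accept (x m) (cell m (key d))} z =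
        reach , +-mono-≤ val≤ (*-monoʳ-≤ (w (x m)) (≤-reflexive (cong (_+ p (x m)) load≡)))
      -- Rejection was chosen although `d` accepts. As the accepting cell is reachable, it can only
      -- have lost by being strictly dearer.
      ... | no ¬z rewrite select-≢0 {a = reject (x m) (cell m (key d ∸ mu (x m)))} {b = accept (x m) (cell m (key d))} ¬z =
        m*n≢0ʳ {(key d + 1) ∸ mu (x m)} (m*n≢0ˡ ¬z) ,
        ≤-trans (<⇒≤ (m∸n≢0⇒n<m better)) (+-mono-≤ val≤ (*-monoʳ-≤ (w (x m)) (≤-reflexive (cong (_+ p (x m)) load≡))))
        where
        a = cell m (key d)
        better : value a + w (x m) * (load a + p (x m)) ∸ (value (cell m (key d ∸ mu (x m))) + e (x m)) ≢ 0
        better = 1∸m+n≢0⇒n≢0 {budget a} reach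
          (m*n≢0ʳ {((key d + 1) ∸ mu (x m)) * (budget (cell m (key d ∸ mu (x m))) ∸ 1)} ¬z)
      complete {suc m} m≤n (true ∷ d) d<k with complete (<⇒≤ m≤n) d (<⇒≤ d<k) | complete-load (<⇒≤ m≤n) d (<⇒≤ d<k)
      ... | reach , val≤ | _ , bud≡ rewrite m+n∸n≡m (key d) (mu (x m))
        with preferReject (x m) (key d + mu (x m)) (cell m (key d + mu (x m))) (cell m (key d)) ≟ 0
      ... | no ¬z rewrite select-≢0 {a = reject (x m) (cell m (key d))} {b = accept (x m) (cell m (key d + mu (x m)))} ¬z =
        m*n≢0ʳ {(key d + mu (x m) + 1) ∸ mu (x m)} (m*n≢0ˡ ¬z) , +-monoˡ-≤ (e (x m)) val≤
      ... | yes z rewrite select-≡0 {a = reject (x m) (cell m (key d))} {b = accept (x m) (cell m (key d + mu (x m)))} z =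
        (λ b≡0 → 1+n≢0 (trans (sym (cong (1 ∸_) b≡0)) (m+n≡0⇒m≡0 _ tail≡0))) ,
        ≤-trans (m∸n≡0⇒m≤n (m+n≡0⇒n≡0 (1 ∸ budget (cell m (key d + mu (x m)))) tail≡0)) (+-monoˡ-≤ (e (x m)) val≤)
        where
        -- Fewer than `k` rejections precede this one, so the first two factors of the test are
        -- nonzero. Its failure therefore says that accepting is possible and no dearer.
        two≤ : 1 < budget (cell m (key d))
        two≤ = +-cancelˡ-< (rejections d) 1 _ (subst₂ _<_ (+-comm 1 _) (sym bud≡) (s≤s d<k))
        front≢0 : ((key d + mu (x m) + 1) ∸ mu (x m)) * (budget (cell m (key d)) ∸ 1) ≢ 0
        front≢0 eq = n<m⇒m∸n≢0 two≤ (m*n≡0⇒n≡0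
          (n<m⇒m∸n≢0 (subst (mu (x m) <_) (+-comm 1 _) (s≤s (m≤n+m (mu (x m)) (key d))))) eq)
        tail≡0 : (1 ∸ budget (cell m (key d + mu (x m)))) + _ ≡ 0
        tail≡0 = m*n≡0⇒n≡0 front≢0 z

    module _ (N : ℕ) where

      record Small (n m : ℕ) (c : Cell) : Set where
        field
          load≤   : load c ≤ m * N
          value≤  : value c ≤ m * (N + N * (n * N))
          budget≤ : budget c ≤ suc k
          mark≤   : mark c ≤ 1
      open Small public

      -- Unreachable cells are included, since the program writes them too and each written word
      -- must be bounded. One job adds at most `N` by rejection or `N * (n * N)` by acceptance.
      cell-small : ∀ {n} → (∀ {i} → i < n → p (x i) ≤ N × w (x i) ≤ N × e (x i) ≤ N) →
                   ∀ m s → m ≤ n → Small n m (cell m s)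
      cell-small h zero zero    m≤n = record { load≤ = z≤n ; value≤ = z≤n ; budget≤ = ≤-refl ; mark≤ = z≤n }
      cell-small h zero (suc s) m≤n = record { load≤ = z≤n ; value≤ = z≤n ; budget≤ = z≤n ; mark≤ = z≤n }
      cell-small {n} h (suc m) s m<n with h m<n | step m s
      ... | p≤ , w≤ , e≤ | rejecting eq _ _ rewrite eq =
        let ih = cell-small h m (s ∸ mu (x m)) (<⇒≤ m<n) in record
        { load≤ = ≤-trans (load≤ ih) (m≤n+m (m * N) N)
        ; value≤ = ≤-trans (+-mono-≤ (value≤ ih) (≤-trans e≤ (m≤m+n N (N * (n * N)))))
                     (≤-reflexive (+-comm (m * (N + N * (n * N))) _))
        ; budget≤ = ≤-trans (m∸n≤m _ 1) (budget≤ ih)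
        ; mark≤ = ≤-refl }
      ... | p≤ , w≤ , e≤ | accepting eq rewrite eq =
        let ih = cell-small h m s (<⇒≤ m<n)
            ld = ≤-trans (+-mono-≤ (load≤ ih) p≤) (≤-reflexive (+-comm (m * N) N))
        in record
        { load≤ = ld
        ; value≤ = ≤-trans (+-mono-≤ (value≤ ih) (≤-trans (*-mono-≤ w≤ (≤-trans ld (*-monoˡ-≤ N m<n))) (m≤n+m (N * (n * N)) N)))
                     (≤-reflexive (+-comm (m * (N + N * (n * N))) _))
        ; budget≤ = budget≤ ih
        ; mark≤ = z≤n }

    -- With one base-(k+1) digit per processing time, the key determines how many jobs
    -- of each processing time are rejected.
    module Digits (ty dist : ℕ → ℕ) (c n : ℕ)
      (ty<c : ∀ {i} → i < n → ty (x i) < c)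
      (mu≡  : ∀ {i} → i < n → mu (x i) ≡ suc k ^ ty (x i))
      (p≡   : ∀ {i} → i < n → p (x i) ≡ dist (ty (x i))) where

      count : ∀ {m} → Vec Bool m → ℕ → ℕ
      count []                 = λ _ → 0
      count {suc m} (true ∷ d) = bump (ty (x m)) (count d)
      count (false ∷ d)        = count d

      count≤ : ∀ {m} (d : Vec Bool m) t → count d t ≤ rejections d
      count≤ []          t = z≤n
      count≤ (false ∷ d) t = count≤ d t
      count≤ {suc m} (true ∷ d) t with ty (x m) ≟ t
      ... | yes refl = ≤-trans (≤-reflexive (update-same (count d) t _)) (s≤s (count≤ d t))
      ... | no ≢t    = ≤-trans (≤-reflexive (update-other (count d) _ ≢t)) (m≤n⇒m≤1+n (count≤ d t))

      key≡dot : ∀ {m} → m ≤ n → (d : Vec Bool m) → key d ≡ dot (count d) (suc k ^_) c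
      key≡dot _   []          = sym (dot-zero _ c)
      key≡dot m<n (false ∷ d) = key≡dot (<⇒≤ m<n) d
      key≡dot m<n (true ∷ d)  = trans (cong₂ _+_ (key≡dot (<⇒≤ m<n) d) (mu≡ m<n))
                               (sym (dot-bump (count d) _ c (ty<c m<n)))

      rejections≡dot : ∀ {m} → m ≤ n → (d : Vec Bool m) → rejections d ≡ dot (count d) (λ _ → 1) c
      rejections≡dot _   []          = sym (dot-zero _ c)
      rejections≡dot m<n (false ∷ d) = rejections≡dot (<⇒≤ m<n) d
      rejections≡dot m<n (true ∷ d)  = trans (cong suc (rejections≡dot (<⇒≤ m<n) d))
        (sym (trans (dot-bump (count d) _ c (ty<c m<n)) (+-comm _ 1)))

      -- The conserved quantity: load plus rejected length is the length of the whole prefix,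
      -- independent of `d`. Equal digits thus give equal loads after cancellation.
      busy≡dot : ∀ {m} → m ≤ n → (d : Vec Bool m) →
              busy d + dot (count d) dist c ≡ busy (restrict (λ _ → false) m)
      busy≡dot _   [] = dot-zero _ c
      busy≡dot {suc m} m<n (false ∷ d) = trans (+-assoc (busy d) (p (x m)) _)
        (trans (cong (busy d +_) (+-comm (p (x m)) _))
          (trans (sym (+-assoc (busy d) _ _)) (cong (_+ p (x m)) (busy≡dot (<⇒≤ m<n) d))))
      busy≡dot {suc m} m<n (true ∷ d) = trans
        (cong (busy d +_) (trans (dot-bump (count d) dist c (ty<c m<n)) (cong (dot (count d) dist c +_) (sym (p≡ m<n)))))
        (trans (sym (+-assoc (busy d) _ (p (x m)))) (cong (_+ p (x m)) (busy≡dot (<⇒≤ m<n) d)))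

      key< : ∀ {m} → m ≤ n → (d : Vec Bool m) → rejections d ≤ k → key d < suc k ^ c
      key< m≤n d d≤k = subst (_< suc k ^ c) (sym (key≡dot m≤n d)) (numeral< c (λ t → ≤-trans (count≤ d t) d≤k))

      faithful : Faithful n
      faithful m≤n d d′ d≤k d′≤k eq =
        +-cancelʳ-≡ (dot (count d) dist c) (busy d) (busy d′) (trans (busy≡dot m≤n d)
          (trans (sym (busy≡dot m≤n d′)) (cong (busy d′ +_) (sym (dot-congˡ dist c same))))) ,
        trans (rejections≡dot m≤n d) (trans (dot-congˡ _ c same) (sym (rejections≡dot m≤n d′)))
        where
        same : ∀ {t} → t < c → count d t ≡ count d′ t
        same = numeral-unique c (λ t → ≤-trans (count≤ d t) d≤k) (λ t → ≤-trans (count≤ d′ t) d′≤k)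
          (trans (sym (key≡dot m≤n d)) (trans eq (key≡dot m≤n d′)))

-- Bottom-up merge sort on lists

seg : {A : Set} → (ℕ → A) → ℕ → ℕ → List A
seg f a zero    = []
seg f a (suc l) = f a ∷ seg f (suc a) l

module _ {A : Set} where

  length-seg : (f : ℕ → A) → ∀ a l → length (seg f a l) ≡ l
  length-seg f a zero    = refl
  length-seg f a (suc l) = cong suc (length-seg f (suc a) l)

  seg-cong : ∀ {f g : ℕ → A} a l → (∀ {i} → a ≤ i → i < a + l → f i ≡ g i) → seg f a l ≡ seg g a l
  seg-cong a zero    h = refl
  seg-cong a (suc l) h = cong₂ _∷_ (h ≤-refl (m<m+n a z<s))
    (seg-cong (suc a) l (λ {i} lo hi → h (<⇒≤ lo) (subst (i <_) (sym (+-suc a l)) hi)))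

  seg-snoc : (f : ℕ → A) → ∀ a l → seg f a (suc l) ≡ seg f a l ++ f (a + l) ∷ []
  seg-snoc f a zero    = cong (λ i → f i ∷ []) (sym (+-identityʳ a))
  seg-snoc f a (suc l) = cong (f a ∷_) (trans (seg-snoc f (suc a) l)
    (cong (λ i → seg f (suc a) l ++ f i ∷ []) (sym (+-suc a l))))

  -- `l ∸ (l ∸ w)` is the minimum of `l` and `w`, in the form in which the program computes block
  -- lengths.
  take-seg : (f : ℕ → A) → ∀ w a l → take w (seg f a l) ≡ seg f a (l ∸ (l ∸ w))
  take-seg f zero    a l       = cong (seg f a) (sym (n∸n≡0 l))
  take-seg f (suc w) a zero    = refl
  take-seg f (suc w) a (suc l) = trans (cong (f a ∷_) (take-seg f w (suc a) l))
    (cong (seg f a) (sym (+-∸-assoc 1 (m∸n≤m l w))))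

  drop-seg : (f : ℕ → A) → ∀ w a l → drop w (seg f a l) ≡ seg f (a + (l ∸ (l ∸ w))) (l ∸ w)
  drop-seg f zero    a l       = cong (λ b → seg f b l) (trans (sym (+-identityʳ a)) (cong (a +_) (sym (n∸n≡0 l))))
  drop-seg f (suc w) a zero    = refl
  drop-seg f (suc w) a (suc l) = trans (drop-seg f w (suc a) l)
    (cong (λ b → seg f b (l ∸ w)) (trans (sym (+-suc a _)) (cong (a +_) (sym (+-∸-assoc 1 (m∸n≤m l w))))))

  All-seg : ∀ {P : A → Set} (f : ℕ → A) a l → All P (seg f a l) → ∀ {j} → j < l → P (f (a + j))
  All-seg {P} f a (suc l) (h ∷ hs) {zero}  _         = subst (λ i → P (f i)) (sym (+-identityʳ a)) h
  All-seg {P} f a (suc l) (h ∷ hs) {suc j} (s≤s j<l) = subst (λ i → P (f i)) (sym (+-suc a j)) (All-seg f (suc a) l hs j<l)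

  AllPairs-seg : ∀ {R : A → A → Set} (f : ℕ → A) a l → AllPairs R (seg f a l) →
                 ∀ {i j} → i < j → j < l → R (f (a + i)) (f (a + j))
  AllPairs-seg {R} f a (suc l) (h ∷ hs) {zero} {suc j} _ (s≤s j<l) =
    subst₂ (λ u v → R (f u) (f v)) (sym (+-identityʳ a)) (sym (+-suc a j)) (All-seg f (suc a) l h j<l)
  AllPairs-seg {R} f a (suc l) (h ∷ hs) {suc i} {suc j} (s≤s i<j) (s≤s j<l) =
    subst₂ (λ u v → R (f u) (f v)) (sym (+-suc a i)) (sym (+-suc a j)) (AllPairs-seg f (suc a) l hs i<j j<l)

  length≤1⇒AllPairs : ∀ {R : A → A → Set} L → length L ≤ 1 → AllPairs R L
  length≤1⇒AllPairs []           _ = []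
  length≤1⇒AllPairs (x ∷ [])     _ = [] ∷ []
  length≤1⇒AllPairs (x ∷ y ∷ L) (s≤s ())

  take-++ˡ : ∀ (L : List A) {L′} → take (length L) (L ++ L′) ≡ L
  take-++ˡ []      = refl
  take-++ˡ (x ∷ L) = cong (x ∷_) (take-++ˡ L)

  drop-++ˡ : ∀ (L : List A) {L′} m → drop (length L + m) (L ++ L′) ≡ drop m L′
  drop-++ˡ []      m = refl
  drop-++ˡ (x ∷ L) m = drop-++ˡ L m

module MergeSort {A : Set} {_≲_ : A → A → Set} (_≲?_ : Decidable _≲_)
  (≲-trans : Transitive _≲_) (≲-total : Total _≲_) where

  Ordered : List A → Set
  Ordered = AllPairs _≲_

  merge-≲ : ∀ {x y} xs ys → x ≲ y → merge _≲?_ (x ∷ xs) (y ∷ ys) ≡ x ∷ merge _≲?_ xs (y ∷ ys)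
  merge-≲ {x} {y} xs ys x≲y with x ≲? y
  ... | yes _   = refl
  ... | no ¬x≲y = contradiction x≲y ¬x≲y

  merge-⋦ : ∀ {x y} xs ys → ¬ x ≲ y → merge _≲?_ (x ∷ xs) (y ∷ ys) ≡ y ∷ merge _≲?_ (x ∷ xs) ys
  merge-⋦ {x} {y} xs ys ¬x≲y with x ≲? y
  ... | yes x≲y = contradiction x≲y ¬x≲y
  ... | no _    = refl

  merge-[]ʳ : ∀ xs → merge _≲?_ xs [] ≡ xs
  merge-[]ʳ []      = refl
  merge-[]ʳ (_ ∷ _) = refl

  private
    All-merge : ∀ {P : A → Set} {xs ys} → All P xs → All P ys → All P (merge _≲?_ xs ys)
    All-merge {xs = xs} {ys} pxs pys = All-resp-↭ (↭-sym (merge-↭ _≲?_ xs ys)) (All.++⁺ pxs pys)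

  merge-Ordered : ∀ {xs ys} → Ordered xs → Ordered ys → Ordered (merge _≲?_ xs ys)
  merge-Ordered {[]}     {ys}     _ oy = oy
  merge-Ordered {x ∷ xs} {[]}     ox _ = ox
  merge-Ordered {x ∷ xs} {y ∷ ys} ox@(hx ∷ ox′) oy@(hy ∷ oy′)
    with x ≲? y | merge-Ordered ox′ oy | merge-Ordered ox oy′
  ... | yes x≲y | rec | _ = All-merge hx (x≲y ∷ All.map (≲-trans x≲y) hy) ∷ rec
  ... | no ¬x≲y | _ | rec = All-merge (y≲x ∷ All.map (≲-trans y≲x) hx) hy ∷ rec
    where
    y≲x : y ≲ x
    y≲x with ≲-total x y
    ... | inj₁ h = contradiction h ¬x≲y
    ... | inj₂ h = h

  length-merge : ∀ xs ys → length (merge _≲?_ xs ys) ≡ length xs + length ys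
  length-merge xs ys = trans (↭-length (merge-↭ _≲?_ xs ys)) (length-++ xs)

  -- The second argument is fuel for structural recursion; the length of the list suffices, because
  -- a round removes at least one element when `w` is positive.
  pass : ℕ → ℕ → List A → List A
  pass w zero    L = []
  pass w (suc g) L = merge _≲?_ (take w L) (take w (drop w L)) ++ pass w g (drop w (drop w L))

  Blocks : ℕ → List A → Set
  Blocks w L = ∀ i → Ordered (take w (drop (i * w) L))

  pass-[] : ∀ w g → pass w g [] ≡ []
  pass-[] w zero    = refl
  pass-[] w (suc g) rewrite drop-[] {A = A} w | drop-[] {A = A} w | take-[] {A = A} w = pass-[] w g

  pass-↭ : ∀ {w} g L → 1 ≤ w → length L ≤ g → pass w g L ↭ L
  pass-↭ zero [] _ _ = ↭-refl
  pass-↭ {w} (suc g) L 1≤w L≤ = ↭-trans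
    (++⁺ (merge-↭ _≲?_ (take w L) (take w (drop w L))) (pass-↭ g (drop w (drop w L)) 1≤w shorter))
    (↭-reflexive (trans (++-assoc (take w L) _ _)
      (trans (cong (take w L ++_) (take++drop≡id w (drop w L))) (take++drop≡id w L))))
    where
    shorter : length (drop w (drop w L)) ≤ g
    shorter = begin
      length (drop w (drop w L)) ≡⟨ length-drop w (drop w L) ⟩
      length (drop w L) ∸ w      ≤⟨ m∸n≤m _ w ⟩
      length (drop w L)          ≡⟨ length-drop w L ⟩
      length L ∸ w               ≤⟨ ∸-mono L≤ 1≤w ⟩
      g ∎
      where open ≤-Reasoning

  -- If two full blocks are available, their merge has length exactly `w + w` and later blocks of
  -- the result come from the recursive call. Otherwise the merge already is the whole list, and all
  -- further blocks are empty.
  pass-Blocks : ∀ {w} g L → Blocks w L → Blocks (w + w) (pass w g L)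
  pass-Blocks {w} zero L h i rewrite drop-[] {A = A} (i * (w + w)) | take-[] {A = A} (w + w) = []
  pass-Blocks {w} (suc g) L h i with w + w ≤? length L
  ... | yes 2w≤ = full i
    where
    M R : List A
    M = merge _≲?_ (take w L) (take w (drop w L))
    R = pass w g (drop w (drop w L))
    length-M : length M ≡ w + w
    length-M = trans (length-merge (take w L) _) (cong₂ _+_
      (trans (length-take w L) (m≤n⇒m⊓n≡m (≤-trans (m≤m+n w w) 2w≤)))
      (trans (length-take w (drop w L)) (m≤n⇒m⊓n≡m
        (subst (w ≤_) (sym (length-drop w L)) (subst (_≤ length L ∸ w) (m+n∸m≡n w w) (∸-monoˡ-≤ w 2w≤))))))
    ih : Blocks (w + w) R
    ih = pass-Blocks g (drop w (drop w L)) (λ i → subst (λ D → Ordered (take w D))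
      (sym (trans (drop-drop w (i * w) (drop w L)) (drop-drop w (w + i * w) L))) (h (suc (suc i))))
    full : Blocks (w + w) (M ++ R)
    full zero    = subst Ordered (sym (trans (cong (λ l → take l (M ++ R)) (sym length-M)) (take-++ˡ M)))
      (merge-Ordered (h 0) (subst (λ l → Ordered (take w (drop l L))) (+-identityʳ w) (h 1)))
    full (suc i) = subst (λ D → Ordered (take (w + w) D))
      (sym (trans (cong (λ l → drop (l + i * (w + w)) (M ++ R)) (sym length-M)) (drop-++ˡ M (i * (w + w))))) (ih i)
  ... | no 2w≰ = subst (λ R → Ordered (take (w + w) (drop (i * (w + w)) (M ++ R)))) (sym R≡[]) (partial i)
    where
    M : List A
    M = merge _≲?_ (take w L) (take w (drop w L))
    R≡[] : pass w g (drop w (drop w L)) ≡ []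
    R≡[] = trans (cong (pass w g) (trans (drop-drop w w L) (drop-all (w + w) L (<⇒≤ (≰⇒> 2w≰))))) (pass-[] w g)
    length-M : length M ≤ w + w
    length-M = ≤-trans (≤-reflexive (length-merge (take w L) _)) (+-mono-≤
      (≤-trans (≤-reflexive (length-take w L)) (m⊓n≤m w _))
      (≤-trans (≤-reflexive (length-take w (drop w L))) (m⊓n≤m w _)))
    partial : Blocks (w + w) (M ++ [])
    partial zero    rewrite ++-identityʳ M = subst Ordered (sym (take-all (w + w) M length-M))
      (merge-Ordered (h 0) (subst (λ l → Ordered (take w (drop l L))) (+-identityʳ w) (h 1)))
    partial (suc i) rewrite ++-identityʳ M
      | drop-all (w + w + i * (w + w)) M (≤-trans length-M (m≤m+n (w + w) _)) | take-[] {A = A} (w + w) = []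

  Blocks-1 : ∀ L → Blocks 1 L
  Blocks-1 L i = length≤1⇒AllPairs _ (≤-trans (≤-reflexive (length-take 1 (drop (i * 1) L))) (m⊓n≤m 1 _))

  Blocks-≥ : ∀ {w L} → length L ≤ w → Blocks w L → Ordered L
  Blocks-≥ {w} {L} L≤w h = subst Ordered (take-all w L L≤w) (h 0)

-- Smith's rule

module Single-Machine {J : Set} (P W : J → ℚ)
  (P≥0 : ∀ j → 0ℚ ℚ.≤ P j) (W≥0 : ∀ j → 0ℚ ℚ.≤ W j) where

  Σ : (J → ℚ) → List J → ℚ
  Σ g = foldr (λ j t → g j ℚ.+ t) 0ℚ

  Disjoint : (J → ℚ) → J → J → Set
  Disjoint s i j = (s i ℚ.+ P i ℚ.≤ s j) ⊎ (s j ℚ.+ P j ℚ.≤ s i)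

  -- Kept opaque so that the comparison stays a neutral term, which `with` can abstract in `shift`
  -- and in the filters alike.
  abstract
    after? : (s : J → ℚ) (j i : J) → Dec (s j ℚ.+ P j ℚ.≤ s i)
    after? s j i = (s j ℚ.+ P j) ℚ.≤? s i

  shift : (J → ℚ) → J → (J → ℚ)
  shift s j i = if does (after? s j i) then s i ℚ.- P j else s i

  private
    a+b-b≡a : ∀ a b → (a ℚ.+ b) ℚ.- b ≡ a
    a+b-b≡a = solve 2 (λ a b → (a :+ b) :- b ∶= a) refl where open ℚ-Solver.+-*-Solver renaming (_:=_ to _∶=_)

    a-b+c≡a+c-b : ∀ a b c → (a ℚ.- b) ℚ.+ c ≡ (a ℚ.+ c) ℚ.- b
    a-b+c≡a+c-b = solve 3 (λ a b c → (a :- b) :+ c ∶= (a :+ c) :- b) refl where open ℚ-Solver.+-*-Solver renaming (_:=_ to _∶=_)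

    sub-mono : ∀ {a b} c → a ℚ.≤ b → a ℚ.- c ℚ.≤ b ℚ.- c
    sub-mono c = ℚ.+-monoˡ-≤ (ℚ.- c)

    a+b≤c⇒a≤c-b : ∀ {a c} b → a ℚ.+ b ℚ.≤ c → a ℚ.≤ c ℚ.- b
    a+b≤c⇒a≤c-b {a} b h = subst (ℚ._≤ _) (a+b-b≡a a b) (sub-mono b h)

    a≤c-b⇒b+a≤c : ∀ {a c} b → a ℚ.≤ c ℚ.- b → b ℚ.+ a ℚ.≤ c
    a≤c-b⇒b+a≤c {a} {c} b h = subst (b ℚ.+ a ℚ.≤_) (solve 2 (λ b c → b :+ (c :- b) ∶= c) refl b c)
      (ℚ.+-monoʳ-≤ b h) where open ℚ-Solver.+-*-Solver renaming (_:=_ to _∶=_)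

    scale : ∀ {a b} c → 0ℚ ℚ.≤ c → a ℚ.≤ b → c ℚ.* a ℚ.≤ c ℚ.* b
    scale c c≥0 = ℚ.*-monoˡ-≤-nonNeg c {{ℚ.nonNegative c≥0}}

  before : ∀ {s j i} → Disjoint s j i → ¬ (s j ℚ.+ P j ℚ.≤ s i) → s i ℚ.+ P i ℚ.≤ s j
  before (inj₁ h) ¬h = contradiction h ¬h
  before (inj₂ h) _  = h

  -- A job moved forward still starts no earlier than `s j`, while a job that stays has ended by
  -- `s j`; two moved jobs keep their distance.
  Disjoint-shift : ∀ {s j x y} → Disjoint s j x → Disjoint s j y → Disjoint s x y →
                   Disjoint (shift s j) x y
  Disjoint-shift {s} {j} {x} {y} jx jy xy with after? s j x | after? s j y | xy
  ... | yes _ | yes _ | inj₁ h = inj₁ (subst (ℚ._≤ _) (sym (a-b+c≡a+c-b (s x) (P j) (P x))) (sub-mono (P j) h))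
  ... | yes _ | yes _ | inj₂ h = inj₂ (subst (ℚ._≤ _) (sym (a-b+c≡a+c-b (s y) (P j) (P y))) (sub-mono (P j) h))
  ... | yes a | no ¬b | _ = inj₂ (ℚ.≤-trans (before {s} {j} jy ¬b) (a+b≤c⇒a≤c-b (P j) a))
  ... | no ¬a | yes b | _ = inj₁ (ℚ.≤-trans (before {s} {j} jx ¬a) (a+b≤c⇒a≤c-b (P j) b))
  ... | no _  | no _  | h = h

  shift≥0 : ∀ {s j x} → 0ℚ ℚ.≤ s j → 0ℚ ℚ.≤ s x → 0ℚ ℚ.≤ shift s j x
  shift≥0 {s} {j} {x} hj hx with after? s j x
  ... | yes a = ℚ.≤-trans hj (a+b≤c⇒a≤c-b _ a)
  ... | no  _ = hx

  AllPairs-shift : ∀ {s j L} → All (Disjoint s j) L → AllPairs (Disjoint s) L →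
                   AllPairs (Disjoint (shift s j)) L
  AllPairs-shift []       []       = []
  AllPairs-shift {s} {j} (h ∷ hs) (d ∷ ds) =
    All.zipWith (λ (jy , xy) → Disjoint-shift {s} {j} h jy xy) (hs , d) ∷ AllPairs-shift hs ds

  -- Removing the head and closing its gap leaves disjoint jobs that end by `T` minus its length:
  -- those after it move forward, those before it end by its start.
  Σ-disjoint≤ : ∀ L {s T} → All (λ j → 0ℚ ℚ.≤ s j) L → AllPairs (Disjoint s) L →
                All (λ j → s j ℚ.+ P j ℚ.≤ T) L → 0ℚ ℚ.≤ T → Σ P L ℚ.≤ T
  Σ-disjoint≤ []      _ _ _ T≥0 = T≥0
  Σ-disjoint≤ (j ∷ L) {s} {T} (s≥0 ∷ ss) (d ∷ ds) (c ∷ cs) _ = a≤c-b⇒b+a≤c (P j)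
    (Σ-disjoint≤ L (All.map (shift≥0 {s} {j} s≥0) ss) (AllPairs-shift {s} {j} d ds)
       (All.zipWith ends (d , cs)) (ℚ.≤-trans s≥0 s≤T-P))
    where
    s≤T-P : s j ℚ.≤ T ℚ.- P j
    s≤T-P = a+b≤c⇒a≤c-b (P j) c
    ends : ∀ {x} → Disjoint s j x × (s x ℚ.+ P x ℚ.≤ T) → shift s j x ℚ.+ P x ℚ.≤ T ℚ.- P j
    ends {x} (jx , cx) with after? s j x
    ... | yes _ = subst (ℚ._≤ _) (sym (a-b+c≡a+c-b (s x) (P j) (P x))) (sub-mono (P j) cx)
    ... | no ¬a = ℚ.≤-trans (before {s} {j} jx ¬a) s≤T-P

  weighted : (J → ℚ) → List J → ℚ
  weighted s = Σ (λ j → W j ℚ.* (s j ℚ.+ P j))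

  -- The cost of processing the jobs of L without idle time, the head last.
  serial : List J → ℚ
  serial []      = 0ℚ
  serial (j ∷ L) = W j ℚ.* (Σ P L ℚ.+ P j) ℚ.+ serial L

  -- The exact saving of closing the gap: each later job gains `P j` per unit of its weight.
  weighted-shift : ∀ s j L →
    weighted s L ≡ P j ℚ.* Σ W (filter (after? s j) L) ℚ.+ weighted (shift s j) L
  weighted-shift s j []      = sym (trans (ℚ.+-identityʳ _) (ℚ.*-zeroʳ (P j)))
  weighted-shift s j (x ∷ L) with after? s j x
  ... | yes _ = trans (cong (W x ℚ.* (s x ℚ.+ P x) ℚ.+_) (weighted-shift s j L))
    (solve 6 (λ w s p q a b → w :* (s :+ p) :+ (q :* a :+ b)
                ∶= q :* (w :+ a) :+ (w :* ((s :- q) :+ p) :+ b)) refl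
       (W x) (s x) (P x) (P j) (Σ W (filter (after? s j) L)) (weighted (shift s j) L))
    where open ℚ-Solver.+-*-Solver renaming (_:=_ to _∶=_)
  ... | no _ = trans (cong (W x ℚ.* (s x ℚ.+ P x) ℚ.+_) (weighted-shift s j L))
    (solve 3 (λ c a b → c :+ (a :+ b) ∶= a :+ (c :+ b)) refl
       (W x ℚ.* (s x ℚ.+ P x)) (P j ℚ.* Σ W (filter (after? s j) L)) (weighted (shift s j) L))
    where open ℚ-Solver.+-*-Solver renaming (_:=_ to _∶=_)

  -- Serving i before j is at least as good as the converse.
  Smith : J → J → Set
  Smith j i = W j ℚ.* P i ℚ.≤ P j ℚ.* W i

  -- Only for the jobs served after `j` is the ratio order used; it trades `W j` times their length
  -- for `P j` times their weight.
  Smith-split : ∀ s j L → All (Smith j) L →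
    W j ℚ.* Σ P L ℚ.≤ W j ℚ.* Σ P (filter (λ x → ¬? (after? s j x)) L) ℚ.+ P j ℚ.* Σ W (filter (after? s j) L)
  Smith-split s j []      [] = ℚ.≤-reflexive
    (solve 2 (λ a b → a :* con 0ℚ ∶= a :* con 0ℚ :+ b :* con 0ℚ) refl (W j) (P j))
    where open ℚ-Solver.+-*-Solver renaming (_:=_ to _∶=_)
  Smith-split s j (x ∷ L) (h ∷ hs) with after? s j x
  ... | yes _ = ℚ.≤-trans (ℚ.≤-reflexive (ℚ.*-distribˡ-+ (W j) (P x) (Σ P L)))
    (ℚ.≤-trans (ℚ.+-mono-≤ h (Smith-split s j L hs)) (ℚ.≤-reflexive
      (solve 4 (λ q w b a → q :* w :+ (b :+ q :* a) ∶= b :+ q :* (w :+ a)) refl (P j) (W x)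
         (W j ℚ.* Σ P (filter (λ x → ¬? (after? s j x)) L)) (Σ W (filter (after? s j) L)))))
    where open ℚ-Solver.+-*-Solver renaming (_:=_ to _∶=_)
  ... | no _ = ℚ.≤-trans (ℚ.≤-reflexive (ℚ.*-distribˡ-+ (W j) (P x) (Σ P L)))
    (ℚ.≤-trans (ℚ.+-monoʳ-≤ (W j ℚ.* P x) (Smith-split s j L hs)) (ℚ.≤-reflexive
      (solve 4 (λ u q b a → u :* q :+ (u :* b :+ a) ∶= u :* (q :+ b) :+ a) refl (W j) (P x)
         (Σ P (filter (λ x → ¬? (after? s j x)) L)) (P j ℚ.* Σ W (filter (after? s j) L)))))
    where open ℚ-Solver.+-*-Solver renaming (_:=_ to _∶=_)

  -- Waiting for all of `L` costs `j` the early and the late lengths, times `W j`. The early jobs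
  -- fit before `s j`, so their share is part of the present cost of `j`; the share of the late jobs
  -- is at most the saving computed in `weighted-shift`.
  serial-optimal : ∀ L {s} → AllPairs Smith L → All (λ j → 0ℚ ℚ.≤ s j) L →
                   AllPairs (Disjoint s) L → serial L ℚ.≤ weighted s L
  serial-optimal []      _ _ _ = ℚ.≤-refl
  serial-optimal (j ∷ L) {s} (h ∷ hs) (s≥0 ∷ ss) (d ∷ ds) = begin
    W j ℚ.* (Σ P L ℚ.+ P j) ℚ.+ serial L
      ≤⟨ ℚ.+-monoʳ-≤ (W j ℚ.* (Σ P L ℚ.+ P j)) (serial-optimal L hs
           (All.map (shift≥0 {s} {j} s≥0) ss) (AllPairs-shift {s} {j} d ds)) ⟩
    W j ℚ.* (Σ P L ℚ.+ P j) ℚ.+ weighted (shift s j) L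
      ≡⟨ solve 4 (λ w a p c → w :* (a :+ p) :+ c ∶= w :* a :+ (w :* p :+ c)) refl
           (W j) (Σ P L) (P j) (weighted (shift s j) L) ⟩
    W j ℚ.* Σ P L ℚ.+ rest
      ≤⟨ ℚ.+-monoˡ-≤ rest (Smith-split s j L h) ⟩
    (W j ℚ.* Σ P early ℚ.+ P j ℚ.* Σ W late) ℚ.+ rest
      ≤⟨ ℚ.+-monoˡ-≤ rest (ℚ.+-monoˡ-≤ (P j ℚ.* Σ W late) (scale (W j) (W≥0 j) early≤s)) ⟩
    (W j ℚ.* s j ℚ.+ P j ℚ.* Σ W late) ℚ.+ rest
      ≡⟨ solve 5 (λ w t q p c → (w :* t :+ q) :+ (w :* p :+ c) ∶= w :* (t :+ p) :+ (q :+ c)) refl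
           (W j) (s j) (P j ℚ.* Σ W late) (P j) (weighted (shift s j) L) ⟩
    W j ℚ.* (s j ℚ.+ P j) ℚ.+ (P j ℚ.* Σ W late ℚ.+ weighted (shift s j) L)
      ≡⟨ cong (W j ℚ.* (s j ℚ.+ P j) ℚ.+_) (sym (weighted-shift s j L)) ⟩
    W j ℚ.* (s j ℚ.+ P j) ℚ.+ weighted s L ∎
    where
    open ℚ.≤-Reasoning
    open ℚ-Solver.+-*-Solver renaming (_:=_ to _∶=_)
    rest = W j ℚ.* P j ℚ.+ weighted (shift s j) L
    late early : List J
    late  = filter (after? s j) L
    early = filter (λ x → ¬? (after? s j x)) L
    early≤s : Σ P early ℚ.≤ s j
    early≤s = Σ-disjoint≤ early {s} (All.filter⁺ _ ss) (AllPairs.filter⁺ _ ds)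
      (All.zipWith (λ (¬a , dx) → before {s} {j} dx ¬a)
        (All.all-filter (λ x → ¬? (after? s j x)) L , All.filter⁺ _ d)) s≥0

-- Sums over reordered jobs, and the embedding of the naturals into the rationals

module ListSum (C : CommutativeMonoid 0ℓ 0ℓ) where
  open CommutativeMonoid C renaming (refl to ≈-refl; sym to ≈-sym; trans to ≈-trans)
  open Algebra.Properties.CommutativeMonoid.Sum C using (sum)

  Σ : {A : Set} → (A → Carrier) → List A → Carrier
  Σ g = foldr (λ j t → g j ∙ t) ε

  Σ-↭ : {A : Set} (g : A → Carrier) {L L′ : List A} → L ↭ L′ → Σ g L ≈ Σ g L′
  Σ-↭ g ↭.refl         = ≈-refl
  Σ-↭ g (↭.prep x h)   = ∙-congˡ (Σ-↭ g h)
  Σ-↭ g (↭.swap x y h) = ≈-trans (≈-sym (assoc (g x) (g y) _))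
    (≈-trans (∙-cong (comm (g x) (g y)) (Σ-↭ g h)) (assoc (g y) (g x) _))
  Σ-↭ g (↭.trans h h′) = ≈-trans (Σ-↭ g h) (Σ-↭ g h′)

  sum≈Σ : ∀ {n} (g : Fin n → Carrier) (G : ℕ → Carrier) b → (∀ j → g j ≈ G (b + toℕ j)) →
          sum g ≈ Σ G (seg id b n)
  sum≈Σ {zero}  g G b h = ≈-refl
  sum≈Σ {suc n} g G b h = ∙-cong (subst (λ i → g zero ≈ G i) (+-identityʳ b) (h zero))
    (sum≈Σ (g ∘ suc) G (suc b) (λ j → subst (λ i → g (suc j) ≈ G i) (+-suc b (toℕ j)) (h (suc j))))

module Σℕ = ListSum +-0-commutativeMonoid
module Σℚ = ListSum ℚ.+-0-commutativeMonoid

AllPairs-resp-↭ : {A : Set} {R : A → A → Set} → Symmetric R → {L L′ : List A} → L ↭ L′ → AllPairs R L → AllPairs R L′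
AllPairs-resp-↭ s ↭.refl         h = h
AllPairs-resp-↭ s (↭.prep x q)   (h ∷ hs) = All-resp-↭ q h ∷ AllPairs-resp-↭ s q hs
AllPairs-resp-↭ s (↭.swap x y q) ((xy ∷ hx) ∷ hy ∷ hs) = (s xy ∷ All-resp-↭ q hy) ∷ All-resp-↭ q hx ∷ AllPairs-resp-↭ s q hs
AllPairs-resp-↭ s (↭.trans q q′) h = AllPairs-resp-↭ s q′ (AllPairs-resp-↭ s q h)

private
  toℚᵘ-ℕ→ℚ : ∀ a → toℚᵘ (ℕ→ℚ a) ℚᵘ.≃ ℚᵘ.mkℚᵘ (ℤ.+ a) 0
  toℚᵘ-ℕ→ℚ a = ℚ.toℚᵘ-fromℚᵘ (ℚᵘ.mkℚᵘ (ℤ.+ a) 0)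

ℕ→ℚ-+ : ∀ a b → ℕ→ℚ (a + b) ≡ ℕ→ℚ a ℚ.+ ℕ→ℚ b
ℕ→ℚ-+ a b = ℚ.toℚᵘ-injective (ℚᵘ.≃-trans (toℚᵘ-ℕ→ℚ (a + b)) (ℚᵘ.≃-trans
  (ℚᵘ.*≡* (cong (ℤ._* ℤ.+ 1) (trans (ℤ.pos-+ a b) (sym (cong₂ ℤ._+_ (ℤ.*-identityʳ (ℤ.+ a)) (ℤ.*-identityʳ (ℤ.+ b)))))))
  (ℚᵘ.≃-sym (ℚᵘ.≃-trans (ℚ.toℚᵘ-homo-+ (ℕ→ℚ a) (ℕ→ℚ b)) (ℚᵘ.+-cong (toℚᵘ-ℕ→ℚ a) (toℚᵘ-ℕ→ℚ b))))))

ℕ→ℚ-* : ∀ a b → ℕ→ℚ (a * b) ≡ ℕ→ℚ a ℚ.* ℕ→ℚ b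
ℕ→ℚ-* a b = ℚ.toℚᵘ-injective (ℚᵘ.≃-trans (toℚᵘ-ℕ→ℚ (a * b)) (ℚᵘ.≃-trans
  (ℚᵘ.*≡* (cong (ℤ._* ℤ.+ 1) (ℤ.pos-* a b)))
  (ℚᵘ.≃-sym (ℚᵘ.≃-trans (ℚ.toℚᵘ-homo-* (ℕ→ℚ a) (ℕ→ℚ b)) (ℚᵘ.*-cong (toℚᵘ-ℕ→ℚ a) (toℚᵘ-ℕ→ℚ b))))))

ℕ→ℚ-mono : ∀ {a b} → a ≤ b → ℕ→ℚ a ℚ.≤ ℕ→ℚ b
ℕ→ℚ-mono {a} {b} a≤b = ℚ.toℚᵘ-cancel-≤ (ℚᵘ.≤-respˡ-≃ (ℚᵘ.≃-sym (toℚᵘ-ℕ→ℚ a))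
  (ℚᵘ.≤-respʳ-≃ (ℚᵘ.≃-sym (toℚᵘ-ℕ→ℚ b)) (ℚᵘ.*≤* (ℤ.*-monoʳ-≤-nonNeg (ℤ.+ 1) (ℤ.+≤+ a≤b)))))

ℕ→ℚ≥0 : ∀ a → 0ℚ ℚ.≤ ℕ→ℚ a
ℕ→ℚ≥0 a = ℕ→ℚ-mono {0} {a} z≤n

-- Decision vectors as lists of accepted jobs

module Schedules (x p w e : ℕ → ℕ) where

  open Decisions x p w e

  P W E : ℕ → ℚ
  P = ℕ→ℚ ∘ p
  W = ℕ→ℚ ∘ w
  E = ℕ→ℚ ∘ e

  open Single-Machine P W (ℕ→ℚ≥0 ∘ p) (ℕ→ℚ≥0 ∘ w) public

  -- Listed latest first, so that the head is the job served last, as `serial` and `serial-optimal`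
  -- expect.
  accepted : (ℕ → Bool) → ℕ → List ℕ
  accepted r zero    = []
  accepted r (suc m) = if r (x m) then accepted r m else x m ∷ accepted r m

  everything : ℕ → List ℕ
  everything = accepted (λ _ → false)

  accepted-All : ∀ r {Q : ℕ → Set} m → (∀ {i} → i < m → r (x i) ≡ false → Q (x i)) → All Q (accepted r m)
  accepted-All r zero    h = []
  accepted-All r (suc m) h with r (x m) in eq
  ... | true  = accepted-All r m (λ i<m → h (m<n⇒m<1+n i<m))
  ... | false = h ≤-refl eq ∷ accepted-All r m (λ i<m → h (m<n⇒m<1+n i<m))

  accepted-AllPairs : ∀ r {R : ℕ → ℕ → Set} m →
    (∀ {i j} → i < j → j < m → r (x i) ≡ false → r (x j) ≡ false → R (x j) (x i)) → AllPairs R (accepted r m)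
  accepted-AllPairs r zero    h = []
  accepted-AllPairs r (suc m) h with r (x m) in eq
  ... | true  = accepted-AllPairs r m (λ i<j j<m → h i<j (m<n⇒m<1+n j<m))
  ... | false = accepted-All r m (λ i<m ri → h i<m ≤-refl ri eq) ∷
                accepted-AllPairs r m (λ i<j j<m → h i<j (m<n⇒m<1+n j<m))

  acceptedCost : (ℕ → Bool) → (ℕ → ℚ) → ℕ → ℚ
  acceptedCost r s j = if r j then 0ℚ else W j ℚ.* (s j ℚ.+ P j)

  rejectedCost : (ℕ → Bool) → ℕ → ℚ
  rejectedCost r j = if r j then E j else 0ℚ

  weighted-accepted : ∀ r s m → Σ (acceptedCost r s) (everything m) ≡ weighted s (accepted r m)
  weighted-accepted r s zero    = refl
  weighted-accepted r s (suc m) with r (x m)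
  ... | true  = trans (ℚ.+-identityˡ _) (weighted-accepted r s m)
  ... | false = cong (W (x m) ℚ.* (s (x m) ℚ.+ P (x m)) ℚ.+_) (weighted-accepted r s m)

  busy-accepted : ∀ r m → ℕ→ℚ (busy (restrict r m)) ≡ Σ P (accepted r m)
  busy-accepted r zero    = refl
  busy-accepted r (suc m) with r (x m)
  ... | true  = busy-accepted r m
  ... | false = trans (ℕ→ℚ-+ (busy (restrict r m)) (p (x m)))
    (trans (ℚ.+-comm _ (P (x m))) (cong (P (x m) ℚ.+_) (busy-accepted r m)))

  total-accepted : ∀ r m → ℕ→ℚ (total (restrict r m)) ≡ serial (accepted r m) ℚ.+ Σ (rejectedCost r) (everything m)
  total-accepted r zero    = refl
  total-accepted r (suc m) with r (x m)
  ... | true  = trans (ℕ→ℚ-+ (total (restrict r m)) (e (x m))) (trans (cong (ℚ._+ E (x m)) (total-accepted r m))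
    (solve 3 (λ a b c → (a :+ b) :+ c ∶= a :+ (c :+ b)) refl (serial (accepted r m)) (Σ (rejectedCost r) (everything m)) (E (x m))))
    where open ℚ-Solver.+-*-Solver renaming (_:=_ to _∶=_)
  ... | false = trans (ℕ→ℚ-+ (total (restrict r m)) _) (trans (cong₂ ℚ._+_ (total-accepted r m)
      (trans (ℕ→ℚ-* (w (x m)) _) (cong (W (x m) ℚ.*_) (trans (ℕ→ℚ-+ (busy (restrict r m)) (p (x m))) (cong (ℚ._+ P (x m)) (busy-accepted r m))))))
    (solve 3 (λ a b c → (a :+ b) :+ c ∶= (c :+ a) :+ (con 0ℚ :+ b)) refl (serial (accepted r m)) (Σ (rejectedCost r) (everything m))
      (W (x m) ℚ.* (Σ P (accepted r m) ℚ.+ P (x m)))))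
    where open ℚ-Solver.+-*-Solver renaming (_:=_ to _∶=_)

  rejections-Σ : ∀ r m → rejections (restrict r m) ≡ Σℕ.Σ (λ j → if r j then 1 else 0) (everything m)
  rejections-Σ r zero    = refl
  rejections-Σ r (suc m) with r (x m)
  ... | true  = cong suc (rejections-Σ r m)
  ... | false = rejections-Σ r m

  serial-weighted : ∀ r s m → (∀ {i} → i < m → s (x i) ≡ ℕ→ℚ (busy (restrict r i))) →
                    weighted s (accepted r m) ≡ serial (accepted r m)
  serial-weighted r s zero    h = refl
  serial-weighted r s (suc m) h with r (x m)
  ... | true  = serial-weighted r s m (λ i<m → h (m<n⇒m<1+n i<m))
  ... | false = cong₂ ℚ._+_ (cong (λ t → W (x m) ℚ.* (t ℚ.+ P (x m))) (trans (h ≤-refl) (busy-accepted r m)))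
                  (serial-weighted r s m (λ i<m → h (m<n⇒m<1+n i<m)))

  busy-mono : ∀ r {i j} → i < j → r (x i) ≡ false → busy (restrict r i) + p (x i) ≤ busy (restrict r j)
  busy-mono r {i} {suc j} (s≤s i≤j) ri with i ≟ j
  ... | yes refl rewrite ri = ≤-refl
  ... | no  i≢j = ≤-trans (busy-mono r (≤∧≢⇒< i≤j i≢j) ri) (grows (r (x j)))
    where
    grows : ∀ b → busy (restrict r j) ≤ busy (b ∷ restrict r j)
    grows true  = ≤-refl
    grows false = m≤m+n _ _

-- Costs of solutions in terms of decision vectors

pad : {A : Set} → A → ∀ {n} → (Fin n → A) → ℕ → A
pad a {zero}  f i       = a
pad a {suc n} f zero    = f zero
pad a {suc n} f (suc i) = pad a (f ∘ suc) i

pad-toℕ : {A : Set} (a : A) → ∀ {n} (f : Fin n → A) j → pad a f (toℕ j) ≡ f j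
pad-toℕ a f zero    = refl
pad-toℕ a f (suc j) = pad-toℕ a (f ∘ suc) j

padded-toℕ : ∀ {n} (f : Fin n → ℕ) j → padded f (toℕ j) ≡ f j
padded-toℕ {n} f j with toℕ j <? n
... | yes h = cong f (fromℕ<-toℕ j h)
... | no ¬h = contradiction (toℕ<n j) ¬h

∣∣≡sum : ∀ {n} (R : Subset n) → ∣ R ∣ ≡ sumℕ (λ j → if lookup R j then 1 else 0)
∣∣≡sum []          = refl
∣∣≡sum (true ∷ R)  = cong suc (∣∣≡sum R)
∣∣≡sum (false ∷ R) = ∣∣≡sum R

All-seg-id< : ∀ {n} a l → a + l ≤ n → All (_< n) (seg id a l)
All-seg-id< a zero    h = []
All-seg-id< {n} a (suc l) h = <-≤-trans (m<m+n a z<s) h ∷ All-seg-id< (suc a) l (subst (_≤ n) (+-suc a l) h)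

AllPairs-seg-id : ∀ a l → AllPairs _≢_ (seg id a l)
AllPairs-seg-id a zero    = []
AllPairs-seg-id a (suc l) = All.map <⇒≢ (above (suc a) l ≤-refl) ∷ AllPairs-seg-id (suc a) l
  where
  above : ∀ b l → a < b → All (a <_) (seg id b l)
  above b zero    h = []
  above b (suc l) h = h ∷ above (suc b) l (m<n⇒m<1+n h)

-- `X` stands for the sort array and `base` for the offset of its last layer.
module Solutions (I : Instance) (X : ℕ → ℕ) (base : ℕ) where

  open Instance I

  p′ w′ e′ : ℕ → ℕ
  p′ = padded p
  w′ = padded w
  e′ = padded e

  x : ℕ → ℕ
  x m = X (base + m)

  open Decisions x p′ w′ e′
  open Schedules x p′ w′ e′

  everything-↭ : ∀ m → everything m ↭ seg X base m
  everything-↭ zero    = ↭-refl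
  everything-↭ (suc m) = ↭-trans (↭.prep (x m) (everything-↭ m))
    (↭-trans (∷↭∷ʳ (x m) (seg X base m)) (↭-reflexive (sym (seg-snoc X base m))))

  module _ (perm : seg X base n ↭ seg id 0 n) where

    x<n : ∀ {i} → i < n → x i < n
    x<n = All-seg X base n (All-resp-↭ (↭-sym perm) (All-seg-id< 0 n ≤-refl))

    x-distinct : ∀ {i j} → i < j → j < n → x i ≢ x j
    x-distinct = AllPairs-seg X base n (AllPairs-resp-↭ ≢-sym (↭-sym perm) (AllPairs-seg-id 0 n))

    x-injective : ∀ {i j} → i < n → j < n → x i ≡ x j → i ≡ j
    x-injective {i} {j} i<n j<n eq with <-cmp i j
    ... | tri< i<j _ _ = contradiction eq (x-distinct i<j j<n)
    ... | tri≈ _ i≡j _ = i≡j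
    ... | tri> _ _ j<i = contradiction (sym eq) (x-distinct j<i i<n)

    -- Indexing by naturals instead of `Fin n` lets the same lemmas apply to the output arrays and
    -- to an arbitrary competing solution extended by defaults.
    module _ (S : Solution I) (r : ℕ → Bool) (s : ℕ → ℚ)
      (r≡ : ∀ j → lookup (Solution.rejected S) j ≡ r (toℕ j))
      (s≡ : ∀ j → Solution.start S j ≡ s (toℕ j)) where

      open Solution S

      all↭ : everything n ↭ seg id 0 n
      all↭ = ↭-trans (everything-↭ n) perm

      cost≡ : cost ≡ weighted s (accepted r n) ℚ.+ Σ (rejectedCost r) (everything n)
      cost≡ = cong₂ ℚ._+_
        (trans (Σℚ.sum≈Σ _ (acceptedCost r s) 0 (λ j → cong₃ (r≡ j) (padded-toℕ w j) (s≡ j) (padded-toℕ p j)))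
          (trans (Σℚ.Σ-↭ (acceptedCost r s) (↭-sym all↭)) (weighted-accepted r s n)))
        (trans (Σℚ.sum≈Σ _ (rejectedCost r) 0 (λ j → cong₂ (λ b c → if b then ℕ→ℚ c else 0ℚ) (r≡ j) (sym (padded-toℕ e j))))
          (Σℚ.Σ-↭ (rejectedCost r) (↭-sym all↭)))
        where
        cong₃ : ∀ {b b′ c c′ t t′ q q′} → b ≡ b′ → c′ ≡ c → t ≡ t′ → q′ ≡ q →
          (if b then 0ℚ else ℕ→ℚ c ℚ.* (t ℚ.+ ℕ→ℚ q)) ≡ (if b′ then 0ℚ else ℕ→ℚ c′ ℚ.* (t′ ℚ.+ ℕ→ℚ q′))
        cong₃ refl refl refl refl = refl

      ∣rejected∣≡ : ∣ rejected ∣ ≡ rejections (restrict r n)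
      ∣rejected∣≡ = trans (∣∣≡sum rejected)
        (trans (Σℕ.sum≈Σ _ (λ j → if r j then 1 else 0) 0 (λ j → cong (if_then 1 else 0) (r≡ j)))
          (trans (Σℕ.Σ-↭ _ (↭-sym all↭)) (sym (rejections-Σ r n))))

      accepted⇒∉ : ∀ {j} → r (toℕ j) ≡ false → j ∉ rejected
      accepted⇒∉ {j} rj j∈ with trans (sym ([]=⇒lookup j∈)) (trans (r≡ j) rj)
      ... | ()

      ∉⇒accepted : ∀ {j} → j ∉ rejected → r (toℕ j) ≡ false
      ∉⇒accepted {j} j∉ with r (toℕ j) in eq
      ... | false = refl
      ... | true  = contradiction (lookup⇒[]= j rejected (trans (r≡ j) eq)) j∉

      completion≡ : ∀ j → completion j ≡ s (toℕ j) ℚ.+ P (toℕ j)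
      completion≡ j = cong₂ ℚ._+_ (s≡ j) (cong ℕ→ℚ (sym (padded-toℕ p j)))

      cost-lower : (∀ {i j} → i < j → j < n → w′ (x j) * p′ (x i) ≤ p′ (x j) * w′ (x i)) →
                   Feasible I S → ℕ→ℚ (total (restrict r n)) ℚ.≤ cost
      cost-lower smith feas = subst₂ ℚ._≤_ (sym (total-accepted r n)) (sym cost≡)
        (ℚ.+-monoˡ-≤ _ (serial-optimal (accepted r n) {s}
          (accepted-AllPairs r n (λ {i} {j} i<j j<n _ _ → subst₂ ℚ._≤_ (ℕ→ℚ-* (w′ (x j)) (p′ (x i))) (ℕ→ℚ-* (p′ (x j)) (w′ (x i))) (ℕ→ℚ-mono (smith i<j j<n))))
          (accepted-All r n (λ i<n ri → released (x<n i<n) ri))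
          (accepted-AllPairs r n (λ i<j j<n ri rj → disjoint (x<n j<n) (x<n (<-trans i<j j<n)) rj ri
            (λ eq → <⇒≢ i<j (x-injective (<-trans i<j j<n) j<n (sym eq)))))))
        where
        open Feasible feas
        released : ∀ {a} → a < n → r a ≡ false → 0ℚ ℚ.≤ s a
        released {a} a<n ra = subst (λ a → 0ℚ ℚ.≤ s a) (toℕ-fromℕ< a<n) (subst (0ℚ ℚ.≤_) (s≡ j)
          (afterRelease j (accepted⇒∉ (trans (cong r (toℕ-fromℕ< a<n)) ra))))
          where j = fromℕ< a<n
        disjoint : ∀ {a b} → a < n → b < n → r a ≡ false → r b ≡ false → a ≢ b → Disjoint s a b
        disjoint {a} {b} a<n b<n ra rb a≢b = subst₂ (Disjoint s) (toℕ-fromℕ< a<n) (toℕ-fromℕ< b<n)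
          (Sum.map (subst₂ ℚ._≤_ (completion≡ i) (s≡ j)) (subst₂ ℚ._≤_ (completion≡ j) (s≡ i))
            (singleMachine i j (accepted⇒∉ (trans (cong r (toℕ-fromℕ< a<n)) ra)) (accepted⇒∉ (trans (cong r (toℕ-fromℕ< b<n)) rb))
              (λ i≡j → a≢b (trans (sym (toℕ-fromℕ< a<n)) (trans (cong toℕ i≡j) (toℕ-fromℕ< b<n))))))
          where
          i = fromℕ< a<n
          j = fromℕ< b<n

      module _ (start≡busy : ∀ {i} → i < n → s (x i) ≡ ℕ→ℚ (busy (restrict r i))) where

        cost≡total : cost ≡ ℕ→ℚ (total (restrict r n))
        cost≡total = trans cost≡ (trans (cong (ℚ._+ _) (serial-weighted r s n start≡busy)) (sym (total-accepted r n)))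

        feasible : rejections (restrict r n) ≤ k → (∀ a → 0ℚ ℚ.≤ s a) → Feasible I S
        feasible ≤k s≥0 = record
          { atMostK       = subst (_≤ k) (sym ∣rejected∣≡) ≤k
          ; afterRelease  = λ j _ → subst (0ℚ ℚ.≤_) (sym (s≡ j)) (s≥0 (toℕ j))
          ; singleMachine = machine
          }
          where
          -- Acceptance is a premise inside the relation, so that it can be carried along the
          -- permutation of all jobs, rejected ones included.
          Apart : ℕ → ℕ → Set
          Apart a b = r a ≡ false → r b ≡ false → Disjoint s a b
          apart : ∀ {i j} → i < j → j < n → Apart (x j) (x i)
          apart {i} {j} i<j j<n _ ri = inj₂ (subst₂ ℚ._≤_
            (trans (ℕ→ℚ-+ (busy (restrict r i)) (p′ (x i))) (cong (ℚ._+ P (x i)) (sym (start≡busy (<-trans i<j j<n)))))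
            (sym (start≡busy j<n)) (ℕ→ℚ-mono (busy-mono r i<j ri)))
          allApart : ∀ {a b} → a < b → b < n → Apart a b
          allApart = AllPairs-seg id 0 n (AllPairs-resp-↭ (λ h rb ra → Sum.swap (h ra rb)) all↭
            (accepted-AllPairs (λ _ → false) n (λ i<j j<n _ _ → apart i<j j<n)))
          machine : ∀ i j → i ∉ rejected → j ∉ rejected → i ≢ j → (completion i ℚ.≤ start j) ⊎ (completion j ℚ.≤ start i)
          machine i j i∉ j∉ i≢j = Sum.map (subst₂ ℚ._≤_ (sym (completion≡ i)) (sym (s≡ j))) (subst₂ ℚ._≤_ (sym (completion≡ j)) (sym (s≡ i)))
            (disj (<-cmp (toℕ i) (toℕ j)))
            where
            disj : _ → Disjoint s (toℕ i) (toℕ j)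
            disj (tri< lt _ _) = allApart lt (toℕ<n j) (∉⇒accepted i∉) (∉⇒accepted j∉)
            disj (tri≈ _ eq _) = contradiction (toℕ-injective eq) i≢j
            disj (tri> _ _ gt) = Sum.swap (allApart gt (toℕ<n i) (∉⇒accepted j∉) (∉⇒accepted i∉))

-- The program

-- Registers and arrays, besides those of the input and the output:
--   arrays   5 layers of the merge sort, one after the other
--            6, 7 the distinct processing times and their powers of k + 1
--            8 the power belonging to each job
--            9, 10, 11, 12 the fields of the cells, row m at offset m * M
--   registers 3 width of the sorted blocks, 4 offset of the current layer
--            6, 7 and 8, 9 start and length of the two blocks being merged
--            10, 11 start and length of the unread part, 12 write position
--            13 job, 14 search position, 15 number of distinct times, 16 M
--            17 number of rows done, 18 their offset, 19 state, 20 job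
--            21 scanned state, 22 best state

priority : Expr → Expr
priority j = 1 ⟦ j ⟧ ⊕ (lit 1 ⊖ 0 ⟦ j ⟧)

identityC : Cmd
identityC = while reg 0 ⊖ reg 2 loop
  (5 ⟦ reg 2 ⟧:= reg 2 ⨾
   2 := reg 2 ⊕ lit 1)

-- The left block is nonempty and either the right one is empty or its head does not come strictly
-- earlier; the `lit 1` turns the strict comparison into a weak one.
leftFirst : Expr
leftFirst = reg 7 ⊗ ((lit 1 ⊖ reg 9) ⊕
  ((lit 1 ⊕ priority (5 ⟦ reg 6 ⟧) ⊗ 0 ⟦ 5 ⟦ reg 8 ⟧ ⟧) ⊖ priority (5 ⟦ reg 8 ⟧) ⊗ 0 ⟦ 5 ⟦ reg 6 ⟧ ⟧))

-- Each round of `passC` writes one element and loads a new pair of blocks only when both are used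
-- up, so a pass is one loop of `n` rounds. It writes `n` places further on and never overwrites
-- what it reads.
loadC mergeC passC sortC : Cmd
loadC =
  6 := reg 10 ⨾
  7 := reg 11 ⊖ (reg 11 ⊖ reg 3) ⨾
  10 := reg 10 ⊕ reg 7 ⨾
  11 := reg 11 ⊖ reg 3 ⨾
  8 := reg 10 ⨾
  9 := reg 11 ⊖ (reg 11 ⊖ reg 3) ⨾
  10 := reg 10 ⊕ reg 9 ⨾
  11 := reg 11 ⊖ reg 3
mergeC =
  (if leftFirst
   then (5 ⟦ reg 12 ⟧:= 5 ⟦ reg 6 ⟧ ⨾ 6 := reg 6 ⊕ lit 1 ⨾ 7 := reg 7 ⊖ lit 1)
   else′ (5 ⟦ reg 12 ⟧:= 5 ⟦ reg 8 ⟧ ⨾ 8 := reg 8 ⊕ lit 1 ⨾ 9 := reg 9 ⊖ lit 1)) ⨾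
  12 := reg 12 ⊕ lit 1
passC = (if reg 7 ⊕ reg 9 then skip else′ loadC) ⨾ mergeC
sortC =
  3 := lit 1 ⨾
  while reg 0 ⊖ reg 3 loop
    (6 := lit 0 ⨾
     7 := lit 0 ⨾
     8 := lit 0 ⨾
     9 := lit 0 ⨾
     10 := reg 4 ⨾
     11 := reg 0 ⨾
     12 := reg 4 ⊕ reg 0 ⨾
     (while reg 7 ⊕ reg 9 ⊕ reg 11 loop passC) ⨾
     4 := reg 4 ⊕ reg 0 ⨾
     3 := reg 3 ⊕ reg 3)

-- This bounds the number of passes, since the width starts at 1 and doubles. The bound `b` makes
-- the recursion on halves structural.
n≤2^⌈log₂n⌉ : ∀ m → m ≤ 2 ^ ⌈log₂ m ⌉
n≤2^⌈log₂n⌉ m = go m m ≤-refl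
  where
  go : ∀ b m → m ≤ b → m ≤ 2 ^ ⌈log₂ m ⌉
  go b       0             _ = z≤n
  go b       1             _ = ≤-refl
  go (suc b) (suc (suc m)) (s≤s m<b) = begin
    suc (suc m)                                 ≡⟨ sym (⌊n/2⌋+⌈n/2⌉≡n (suc (suc m))) ⟩
    suc ⌊ m /2⌋ + suc ⌈ m /2⌉                   ≤⟨ +-monoˡ-≤ (suc ⌈ m /2⌉) (s≤s (⌊n/2⌋≤⌈n/2⌉ m)) ⟩
    suc ⌈ m /2⌉ + suc ⌈ m /2⌉                   ≤⟨ +-mono-≤ ih (≤-trans ih (m≤m+n _ 0)) ⟩
    2 * 2 ^ ⌈log₂ suc ⌈ m /2⌉ ⌉                 ≡⟨ cong (2 ^_) (cong suc (⌈log₂⌈n/2⌉⌉≡⌈log₂n⌉∸1 (suc (suc m)))) ⟩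
    2 ^ ⌈log₂ suc (suc m) ⌉                     ∎
    where
    open ≤-Reasoning
    ih : suc ⌈ m /2⌉ ≤ 2 ^ ⌈log₂ suc ⌈ m /2⌉ ⌉
    ih = go b (suc ⌈ m /2⌉) (≤-trans (s≤s (⌈n/2⌉≤n m)) m<b)

-- The sum of the two truncated differences vanishes exactly when the values agree, so the search
-- stops at a hit or at the end of the list.
searchC registerC typesBodyC typesC : Cmd
searchC = while (reg 15 ⊖ reg 14) ⊗ ((6 ⟦ reg 14 ⟧ ⊖ 0 ⟦ reg 13 ⟧) ⊕ (0 ⟦ reg 13 ⟧ ⊖ 6 ⟦ reg 14 ⟧)) loop
  (14 := reg 14 ⊕ lit 1)
registerC = if reg 15 ⊖ reg 14 then skip else′
  (6 ⟦ reg 14 ⟧:= 0 ⟦ reg 13 ⟧ ⨾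
   7 ⟦ reg 14 ⟧:= reg 16 ⨾
   16 := reg 16 ⊗ (reg 1 ⊕ lit 1) ⨾
   -- The increment is 1 for positive `k` and 0 for `k = 0`, which keeps the list empty in the
   -- latter case.
   15 := reg 15 ⊕ (lit 1 ⊖ (lit 1 ⊖ reg 1)))
typesBodyC =
  14 := lit 0 ⨾
  searchC ⨾
  registerC ⨾
  8 ⟦ reg 13 ⟧:= 7 ⟦ reg 14 ⟧ ⨾
  13 := reg 13 ⊕ lit 1
typesC =
  16 := lit 1 ⨾
  while reg 0 ⊖ reg 13 loop typesBodyC

m≤K^m : ∀ {k} m → k ≢ 0 → m ≤ suc k ^ m
m≤K^m {zero}  m       k≢0 = contradiction refl k≢0
m≤K^m {suc k} zero    _   = z≤n
m≤K^m {suc k} (suc m) k≢0 =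
  +-mono-≤ {1} (m^n>0 (2 + k) m) (≤-trans (m≤K^m m k≢0) (m≤m+n _ (k * (2 + k) ^ m)))

thisCell rejectCell nextCell : Expr
thisCell   = reg 18 ⊕ reg 19
rejectCell   = reg 18 ⊕ (reg 19 ⊖ 8 ⟦ reg 20 ⟧)
nextCell = reg 18 ⊕ reg 16 ⊕ reg 19

acceptValue rejectValue rejectFirst : Expr
acceptValue = 9 ⟦ thisCell ⟧ ⊕ 1 ⟦ reg 20 ⟧ ⊗ (10 ⟦ thisCell ⟧ ⊕ 0 ⟦ reg 20 ⟧)
rejectValue = 9 ⟦ rejectCell ⟧ ⊕ 2 ⟦ reg 20 ⟧
rejectFirst = ((reg 19 ⊕ lit 1) ⊖ 8 ⟦ reg 20 ⟧) ⊗ (11 ⟦ rejectCell ⟧ ⊖ lit 1) ⊗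
  ((lit 1 ⊖ 11 ⟦ thisCell ⟧) ⊕ (acceptValue ⊖ rejectValue))

cellC layerC dpC scanBodyC scanC backBodyC backC : Cmd
cellC =
  (if rejectFirst
   then (9 ⟦ nextCell ⟧:= rejectValue ⨾
         10 ⟦ nextCell ⟧:= 10 ⟦ rejectCell ⟧ ⨾
         11 ⟦ nextCell ⟧:= 11 ⟦ rejectCell ⟧ ⊖ lit 1 ⨾
         12 ⟦ nextCell ⟧:= lit 1)
   else′ (9 ⟦ nextCell ⟧:= acceptValue ⨾
         10 ⟦ nextCell ⟧:= 10 ⟦ thisCell ⟧ ⊕ 0 ⟦ reg 20 ⟧ ⨾
         11 ⟦ nextCell ⟧:= 11 ⟦ thisCell ⟧ ⨾
         12 ⟦ nextCell ⟧:= lit 0)) ⨾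
  19 := reg 19 ⊕ lit 1
layerC =
  20 := 5 ⟦ reg 4 ⊕ reg 17 ⟧ ⨾
  19 := lit 0 ⨾
  (while reg 16 ⊖ reg 19 loop cellC) ⨾
  18 := reg 18 ⊕ reg 16 ⨾
  17 := reg 17 ⊕ lit 1
dpC =
  -- The rest of row 0 is unreachable with all fields 0, which is what the initial memory contains.
  11 ⟦ lit 0 ⟧:= reg 1 ⊕ lit 1 ⨾
  while reg 0 ⊖ reg 17 loop layerC
scanBodyC =
  (if 11 ⟦ reg 18 ⊕ reg 21 ⟧ ⊗ (9 ⟦ reg 18 ⊕ reg 22 ⟧ ⊖ 9 ⟦ reg 18 ⊕ reg 21 ⟧)
   then 22 := reg 21
   else′ skip) ⨾
  21 := reg 21 ⊕ lit 1
scanC = while reg 16 ⊖ reg 21 loop scanBodyC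
backBodyC =
  17 := reg 17 ⊖ lit 1 ⨾
  18 := reg 18 ⊖ reg 16 ⨾
  20 := 5 ⟦ reg 4 ⊕ reg 17 ⟧ ⨾
  3 ⟦ reg 20 ⟧:= 12 ⟦ reg 18 ⊕ reg 16 ⊕ reg 22 ⟧ ⨾
  22 := reg 22 ⊖ 12 ⟦ reg 18 ⊕ reg 16 ⊕ reg 22 ⟧ ⊗ 8 ⟦ reg 20 ⟧ ⨾
  -- The load of the predecessor cell is the busy time before this job, hence its start time.
  4 ⟦ reg 20 ⟧:= 10 ⟦ reg 18 ⊕ reg 22 ⟧
backC = while reg 17 loop backBodyC

program : Cmd
program = identityC ⨾ sortC ⨾ typesC ⨾ dpC ⨾ scanC ⨾ backC

-- Correctness of the phases

keepsInput : Cmd → Bool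
keepsInput c = keepsReg 0 c ∧ keepsReg 1 c ∧ keepsArr 0 c ∧ keepsArr 1 c ∧ keepsArr 2 c

module Phases (n k : ℕ) (p w e : ℕ → ℕ) (B : ℕ) where

  record Input (σ : State) : Set where
    field
      n≡ : regs σ 0 ≡ n
      k≡ : regs σ 1 ≡ k
      p≡ : arrays σ 0 ≡ p
      w≡ : arrays σ 1 ≡ w
      e≡ : arrays σ 2 ≡ e
  open Input public

  frame-input : ∀ {c σ τ} → Frame c σ τ → {_ : T (keepsInput c)} → Input σ → Input τ
  frame-input {c} fr {h} inp =
    let h₀ , h′   = Equivalence.to (T-∧ {keepsReg 0 c}) h
        h₁ , h″   = Equivalence.to (T-∧ {keepsReg 1 c}) h′
        h₂ , h‴   = Equivalence.to (T-∧ {keepsArr 0 c}) h″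
        h₃ , h₄   = Equivalence.to (T-∧ {keepsArr 1 c}) h‴
    in record
    { n≡ = trans (keptReg fr 0 {h₀}) (n≡ inp)
    ; k≡ = trans (keptReg fr 1 {h₁}) (k≡ inp)
    ; p≡ = trans (keptArr fr 0 {h₂}) (p≡ inp)
    ; w≡ = trans (keptArr fr 1 {h₃}) (w≡ inp)
    ; e≡ = trans (keptArr fr 2 {h₄}) (e≡ inp)
    }

  identity-runs : ∀ {σ} → Input σ → regs σ 2 ≡ 0 → (∀ y → arrays σ 5 y ≤ B) → n ≤ B →
    Runs B identityC σ (λ τ → (∀ {y} → y < n → arrays τ 5 y ≡ y) × (∀ y → arrays τ 5 y ≤ B)) (n * 11 + 4)
  identity-runs {σ} inp i≡0 bnd n≤B =
    consequence (λ _ (_ , h , b) → h , b) (forR n Inv guard body (i≡0 , (λ ()) , bnd))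
    where
    Inv : ℕ → State → Set
    Inv i τ = regs τ 2 ≡ i × (∀ {y} → y < i → arrays τ 5 y ≡ y) × (∀ y → arrays τ 5 y ≤ B)
    C = 5 ⟦ reg 2 ⟧:= reg 2 ⨾ 2 := reg 2 ⊕ lit 1
    guard : ∀ {i τ} → Frame C σ τ → Inv i τ → eval τ (reg 0 ⊖ reg 2) ≡ n ∸ i
    guard fr (i≡ , _) = cong₂ _∸_ (n≡ (frame-input fr inp)) i≡
    body : ∀ {i τ} → Frame C σ τ → i < n → Inv i τ → Runs B C τ (Inv (suc i)) 7
    body {i} {τ} fr i<n (i≡ , h , b) =
      subst (_≤ B) (sym i≡) (≤-trans (<⇒≤ i<n) n≤B) ⨾S
      assignR (subst (λ j → j + 1 ≤ B) (sym i≡) (subst (_≤ B) (+-comm 1 i) (≤-trans i<n n≤B)))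
        (trans (cong (_+ 1) i≡) (+-comm i 1) , new , update-elim (λ _ v → v ≤ B) (arrays τ 5) (regs τ 2) _ (subst (_≤ B) (sym i≡) (≤-trans (<⇒≤ i<n) n≤B)) (λ {y} _ → b y))
      where
      new : ∀ {y} → y < suc i → update (arrays τ 5) (regs τ 2) (regs τ 2) y ≡ y
      new {y} = update-elim (λ y v → y < suc i → v ≡ y) (arrays τ 5) (regs τ 2) _ (λ _ → refl)
        (λ i≢y y<1+i → h (≤∧≢⇒< (≤-pred y<1+i) (λ y≡i → i≢y (trans i≡ (sym y≡i))))) y

  prio : ℕ → ℕ
  prio j = w j + (1 ∸ p j)

  -- Jobs by non-increasing ratio w j / p j; the summand 1 ∸ p j makes the ratio of jobs
  -- of length 0 infinite also when their weight is 0, which transitivity needs.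
  _≲_ : ℕ → ℕ → Set
  i ≲ j = prio j * p i ≤ prio i * p j

  _≲?_ : Decidable _≲_
  i ≲? j = prio j * p i ≤? prio i * p j

  ≲-total : Total _≲_
  ≲-total i j = ≤-total (prio j * p i) (prio i * p j)

  ≲-trans : Transitive _≲_
  ≲-trans {i} {j} {l} i≲j j≲l with p j in pj≡
  -- A middle job of length 0 has positive priority, so the first hypothesis forces `p i` to be 0
  -- and the claim is trivial. In the other case `p j` can be cancelled.
  ... | zero = subst (λ q → prio l * q ≤ prio i * p l) (sym pi≡0) (≤-trans (≤-reflexive (*-zeroʳ (prio l))) z≤n)
    where
    pi≡0 : p i ≡ 0
    pi≡0 = m*n≡0⇒n≡0 {w j + 1} (λ eq → 1+n≢0 (trans (+-comm 1 (w j)) eq)) (n≤0⇒n≡0 (≤-trans i≲j (≤-reflexive (*-zeroʳ (prio i)))))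
  ... | suc q = *-cancelʳ-≤ (prio l * p i) (prio i * p l) (suc q) (begin
      prio l * p i * suc q        ≡⟨ xyz (prio l) (p i) (suc q) ⟩
      prio l * suc q * p i        ≤⟨ *-monoˡ-≤ (p i) j≲l ⟩
      (w j + (0 ∸ q)) * p l * p i ≡⟨ xyz (w j + (0 ∸ q)) (p l) (p i) ⟩
      (w j + (0 ∸ q)) * p i * p l ≤⟨ *-monoˡ-≤ (p l) i≲j ⟩
      prio i * suc q * p l        ≡⟨ xyz (prio i) (suc q) (p l) ⟩
      prio i * p l * suc q        ∎)
    where
    open ≤-Reasoning
    xyz : ∀ a b c → a * b * c ≡ a * c * b
    xyz = solve 3 (λ a b c → a :* b :* c ∶= a :* c :* b) refl where open ℕ-Solver.+-*-Solver renaming (_:=_ to _∶=_)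

  -- The extra summand does no harm: for `p i` positive it vanishes on the larger side, and for
  -- `p i` zero the left side is 0.
  ≲⇒exchange : ∀ {i j} → i ≲ j → w j * p i ≤ p j * w i
  ≲⇒exchange {i} {j} i≲j with p i
  ... | zero  = ≤-trans (≤-reflexive (*-zeroʳ (w j))) z≤n
  ... | suc q = begin
    w j * suc q               ≤⟨ *-monoˡ-≤ (suc q) (m≤m+n (w j) (1 ∸ p j)) ⟩
    prio j * suc q            ≤⟨ i≲j ⟩
    (w i + (0 ∸ q)) * p j     ≡⟨ cong (λ z → (w i + z) * p j) (0∸n≡0 q) ⟩
    (w i + 0) * p j           ≡⟨ cong (_* p j) (+-identityʳ (w i)) ⟩
    w i * p j                 ≡⟨ *-comm (w i) (p j) ⟩
    p j * w i                 ∎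
    where open ≤-Reasoning

  open MergeSort _≲?_ (λ {i} {j} {l} → ≲-trans {i} {j} {l}) ≲-total public

  merge-seg-left : ∀ X i li j lj → lj ≡ 0 ⊎ X i ≲ X j →
    merge _≲?_ (seg X i (suc li)) (seg X j lj) ≡ X i ∷ merge _≲?_ (seg X (suc i) li) (seg X j lj)
  merge-seg-left X i li j zero     _        = cong (X i ∷_) (sym (merge-[]ʳ _))
  merge-seg-left X i li j (suc lj) (inj₂ h) = merge-≲ (seg X (suc i) li) (seg X (suc j) lj) h

  merge-seg-right : ∀ X i li j lj → li ≡ 0 ⊎ ¬ X i ≲ X j →
    merge _≲?_ (seg X i li) (seg X j (suc lj)) ≡ X j ∷ merge _≲?_ (seg X i li) (seg X (suc j) lj)
  merge-seg-right X i zero     j lj _        = refl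
  merge-seg-right X i (suc li) j lj (inj₂ h) = merge-⋦ (seg X (suc i) li) (seg X (suc j) lj) h

  -- `X₀` is the array at the start of the pass. What has been written, the merge of the two open
  -- blocks and the pass over the unread part always concatenate to the same list `T`; `remaining`
  -- makes the number of rounds exactly `n`.
  record Merging (width base : ℕ) (T : List ℕ) (X₀ X : ℕ → ℕ) (i li j lj q lr u : ℕ) : Set where
    field
      fuel      : ℕ
      lr≤fuel   : lr ≤ fuel
      remaining : li + lj + lr ≡ n ∸ u
      i-inside  : i + li ≤ base + n
      j-inside  : j + lj ≤ base + n
      q-inside  : q + lr ≤ base + n
      kept      : ∀ {y} → y < base + n → X y ≡ X₀ y
      target    : seg X (base + n) u ++
                  (merge _≲?_ (seg X₀ i li) (seg X₀ j lj) ++ pass width fuel (seg X₀ q lr)) ≡ T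
  open Merging public

  module _ {width base : ℕ} {T : List ℕ} {X₀ X : ℕ → ℕ} where

    load-blocks : ∀ {i li j lj q lr u v} → v ≡ width → 1 ≤ width → li + lj ≡ 0 → lr ≢ 0 →
      Merging width base T X₀ X i li j lj q lr u →
      let a = lr ∸ (lr ∸ v) ; lr′ = lr ∸ v ; b = lr′ ∸ (lr′ ∸ v) in
      Merging width base T X₀ X q a (q + a) b (q + a + b) (lr′ ∸ v) u
    load-blocks {li = zero} {lj = zero} {lr = zero} refl 1≤w z lr≢0 M = contradiction refl lr≢0
    load-blocks {li = zero} {lj = zero} {lr = suc lr} refl 1≤w z lr≢0 M with fuel M in fuel≡ | lr≤fuel M | target M
    load-blocks {i} {zero} {j} {zero} {q} {suc l} {u} refl 1≤w z lr≢0 M | suc g | s≤s lr≤g | tgt = record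
      { fuel      = g
      ; lr≤fuel   = ≤-trans (m∸n≤m lr′ width) (≤-trans (∸-monoʳ-≤ lr 1≤w) lr≤g)
      ; remaining = trans (+-assoc a b _) (trans (cong (a +_) b+) (trans a+ (remaining M)))
      ; i-inside  = ≤-trans (+-monoʳ-≤ q (m∸n≤m lr (lr ∸ width))) (q-inside M)
      ; j-inside  = ≤-trans (≤-reflexive (+-assoc q a b)) (≤-trans (+-monoʳ-≤ q (≤-trans (+-monoʳ-≤ a (m∸n≤m lr′ (lr′ ∸ width))) (≤-reflexive a+))) (q-inside M))
      ; q-inside  = ≤-trans (≤-reflexive (trans (+-assoc (q + a) b _) (trans (cong (q + a +_) b+) (trans (+-assoc q a lr′) (cong (q +_) a+))))) (q-inside M)
      ; kept      = kept M
      ; target    = trans (cong (seg X (base + n) u ++_) (cong₂ _++_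
          (cong₂ (merge _≲?_) (sym (take-seg X₀ width q lr)) (sym (trans (cong (take width) (drop-seg X₀ width q lr)) (take-seg X₀ width (q + a) lr′))))
          (cong (pass width g) (sym (trans (cong (drop width) (drop-seg X₀ width q lr)) (drop-seg X₀ width (q + a) lr′)))))) tgt
      }
      where
      lr = suc l
      lr′ = lr ∸ width
      a = lr ∸ lr′
      b = lr′ ∸ (lr′ ∸ width)
      a+ : a + lr′ ≡ lr
      a+ = m∸n+n≡m (m∸n≤m lr width)
      b+ : b + (lr′ ∸ width) ≡ lr′
      b+ = m∸n+n≡m (m∸n≤m lr′ width)

    Merging-done : ∀ {i li j lj q lr} → Merging width base T X₀ X i li j lj q lr n → seg X (base + n) n ≡ T
    Merging-done {li = li} {lj = lj} {lr = lr} M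
      with m+n≡0⇒m≡0 li li+lj≡0 | m+n≡0⇒n≡0 li li+lj≡0 | m+n≡0⇒n≡0 (li + lj) all≡0
      where
      all≡0 : li + lj + lr ≡ 0
      all≡0 = trans (remaining M) (n∸n≡0 n)
      li+lj≡0 : li + lj ≡ 0
      li+lj≡0 = m+n≡0⇒m≡0 (li + lj) all≡0
    ... | refl | refl | refl = trans (sym (trans (cong (seg X (base + n) n ++_) (pass-[] width (fuel M))) (++-identityʳ _))) (target M)

    private
      pred-remaining : ∀ {a u} → suc a ≡ n ∸ u → a ≡ n ∸ suc u
      pred-remaining {a} {u} eq = trans (cong pred eq) (pred[m∸n]≡m∸[1+n] n u)

      kept-update : ∀ {u v} → (∀ {y} → y < base + n → X y ≡ X₀ y) →
                    ∀ {y} → y < base + n → update X (base + n + u) v y ≡ X₀ y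
      kept-update {u} h {y} y< = trans (update-other X _ (>⇒≢ (<-≤-trans y< (m≤m+n (base + n) u)))) (h y<)

      emit : ∀ {u v rest} → seg X (base + n) u ++ (v ∷ rest) ≡ T →
             seg (update X (base + n + u) v) (base + n) (suc u) ++ rest ≡ T
      emit {u} {v} {rest} eq = trans (cong (_++ rest) (trans (seg-snoc _ (base + n) u)
        (cong₂ (λ l z → l ++ z ∷ []) (seg-cong (base + n) u (λ _ y< → update-other X v (>⇒≢ y<))) (update-same X _ v))))
        (trans (++-assoc (seg X (base + n) u) _ rest) eq)

    take-left : ∀ {i li j lj q lr u o} → o ≡ base + n + u → li ≢ 0 → (lj ≡ 0 ⊎ X i ≲ X j) →
      Merging width base T X₀ X i li j lj q lr u →
      Merging width base T X₀ (update X o (X i)) (i + 1) (li ∸ 1) j lj q lr (suc u)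
    take-left {li = zero} _ li≢0 _ _ = contradiction refl li≢0
    take-left {i} {suc li} {j} {lj} {q} {lr} {u} refl _ h M = record
      { fuel      = fuel M
      ; lr≤fuel   = lr≤fuel M
      ; remaining = pred-remaining (remaining M)
      ; i-inside  = subst (_≤ base + n) (trans (+-suc i li) (cong (_+ li) (+-comm 1 i))) (i-inside M)
      ; j-inside  = j-inside M
      ; q-inside  = q-inside M
      ; kept      = kept-update (kept M)
      ; target    = emit (trans (cong (λ l → seg X (base + n) u ++ (l ++ pass width (fuel M) (seg X₀ q lr))) (sym front)) (target M))
      }
      where
      Xi≡ : X i ≡ X₀ i
      Xi≡ = kept M (<-≤-trans (m<m+n i z<s) (i-inside M))
      same-order : lj ≡ 0 ⊎ X i ≲ X j → lj ≡ 0 ⊎ X₀ i ≲ X₀ j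
      same-order (inj₁ z) = inj₁ z
      same-order (inj₂ h) with lj ≟ 0
      ... | yes z = inj₁ z
      ... | no ¬z = inj₂ (subst₂ _≲_ Xi≡ (kept M (<-≤-trans (m<m+n j (n≢0⇒n>0 ¬z)) (j-inside M))) h)
      front : merge _≲?_ (seg X₀ i (suc li)) (seg X₀ j lj) ≡ X i ∷ merge _≲?_ (seg X₀ (i + 1) li) (seg X₀ j lj)
      front = trans (merge-seg-left X₀ i li j lj (same-order h))
        (cong₂ (λ v i′ → v ∷ merge _≲?_ (seg X₀ i′ li) (seg X₀ j lj)) (sym Xi≡) (+-comm 1 i))

    take-right : ∀ {i li j lj q lr u o} → o ≡ base + n + u → lj ≢ 0 → (li ≡ 0 ⊎ ¬ X i ≲ X j) →
      Merging width base T X₀ X i li j lj q lr u →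
      Merging width base T X₀ (update X o (X j)) i li (j + 1) (lj ∸ 1) q lr (suc u)
    take-right {lj = zero} _ lj≢0 _ _ = contradiction refl lj≢0
    take-right {i} {li} {j} {suc lj} {q} {lr} {u} refl _ h M = record
      { fuel      = fuel M
      ; lr≤fuel   = lr≤fuel M
      ; remaining = pred-remaining (trans (cong (_+ lr) (sym (+-suc li lj))) (remaining M))
      ; i-inside  = i-inside M
      ; j-inside  = subst (_≤ base + n) (trans (+-suc j lj) (cong (_+ lj) (+-comm 1 j))) (j-inside M)
      ; q-inside  = q-inside M
      ; kept      = kept-update (kept M)
      ; target    = emit (trans (cong (λ l → seg X (base + n) u ++ (l ++ pass width (fuel M) (seg X₀ q lr))) (sym front)) (target M))
      }
      where
      Xj≡ : X j ≡ X₀ j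
      Xj≡ = kept M (<-≤-trans (m<m+n j z<s) (j-inside M))
      same-order : li ≡ 0 ⊎ ¬ X i ≲ X j → li ≡ 0 ⊎ ¬ X₀ i ≲ X₀ j
      same-order (inj₁ z) = inj₁ z
      same-order (inj₂ h) with li ≟ 0
      ... | yes z = inj₁ z
      ... | no ¬z = inj₂ (subst₂ (λ a b → ¬ a ≲ b) (kept M (<-≤-trans (m<m+n i (n≢0⇒n>0 ¬z)) (i-inside M))) Xj≡ h)
      front : merge _≲?_ (seg X₀ i li) (seg X₀ j (suc lj)) ≡ X j ∷ merge _≲?_ (seg X₀ i li) (seg X₀ (j + 1) lj)
      front = trans (merge-seg-right X₀ i li j lj (same-order h))
        (cong₂ (λ v j′ → v ∷ merge _≲?_ (seg X₀ i li) (seg X₀ j′ lj)) (sym Xj≡) (+-comm 1 j))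

  leftFirst≡ : ∀ {τ} → Input τ →
    let X = arrays τ 5 ; a = X (regs τ 6) ; b = X (regs τ 8) in
    eval τ leftFirst ≡ regs τ 7 * ((1 ∸ regs τ 9) + ((1 + prio a * p b) ∸ prio b * p a))
  leftFirst≡ {τ} inp = let X = arrays τ 5 ; a = X (regs τ 6) ; b = X (regs τ 8) in
    cong₂ (λ P W → regs τ 7 * ((1 ∸ regs τ 9) + ((1 + (W a + (1 ∸ P a)) * P b) ∸ (W b + (1 ∸ P b)) * P a)))
      (p≡ inp) (w≡ inp)

  leftFirst-≢0 : ∀ {li lj a b} → li * ((1 ∸ lj) + ((1 + prio a * p b) ∸ prio b * p a)) ≢ 0 →
                 li ≢ 0 × (lj ≡ 0 ⊎ a ≲ b)
  leftFirst-≢0 {li} {lj} {a} {b} h with lj ≟ 0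
  ... | yes z = m*n≢0ˡ h , inj₁ z
  ... | no ¬z = m*n≢0ˡ h , inj₂ (≤-pred (m∸n≢0⇒n<m (1∸m+n≢0⇒n≢0 ¬z (m*n≢0ʳ {li} h))))

  leftFirst-≡0 : ∀ {li lj a b} → li + lj ≢ 0 → li * ((1 ∸ lj) + ((1 + prio a * p b) ∸ prio b * p a)) ≡ 0 →
                 lj ≢ 0 × (li ≡ 0 ⊎ ¬ a ≲ b)
  leftFirst-≡0 {li} {lj} {a} {b} li+lj≢0 h with li ≟ 0
  ... | yes refl = li+lj≢0 , inj₁ refl
  ... | no ¬z =
    let sum≡0 = m*n≡0⇒n≡0 ¬z h in
    (λ lj≡0 → 1+n≢0 (trans (cong (1 ∸_) (sym lj≡0)) (m+n≡0⇒m≡0 (1 ∸ lj) sum≡0))) ,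
    inj₂ (<⇒≱ (m∸n≡0⇒m≤n (m+n≡0⇒n≡0 (1 ∸ lj) sum≡0)))

  module Pass {width base : ℕ} {T : List ℕ} {X₀ : ℕ → ℕ} (1≤width : 1 ≤ width) (room : base + n + n ≤ B) where

    Inv : ℕ → State → Set
    Inv u τ = regs τ 12 ≡ base + n + u ×
      Merging width base T X₀ (arrays τ 5) (regs τ 6) (regs τ 7) (regs τ 8) (regs τ 9) (regs τ 10) (regs τ 11) u ×
      (∀ y → arrays τ 5 y ≤ B)

    inside : ∀ {y} → y ≤ base + n → y ≤ B
    inside h = ≤-trans h (≤-trans (m≤m+n (base + n) n) room)

    load-runs : ∀ {u τ} → u < n → regs τ 3 ≡ width → Inv u τ →
      Runs B (if reg 7 ⊕ reg 9 then skip else′ loadC) τ (λ τ′ → Inv u τ′ × regs τ′ 7 + regs τ′ 9 ≢ 0) 42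
    load-runs {u} {τ} u<n v≡ (o≡ , M , b) = weaken (≤ᵇ⇒≤ _ 42 tt) (ifR
      (λ ≢0 → skipR ((o≡ , M , b) , ≢0))
      (λ ≡0 →
        let lr≢0 : regs τ 11 ≢ 0
            lr≢0 z = n<m⇒m∸n≢0 u<n (trans (sym (remaining M)) (trans (cong₂ _+_ ≡0 z) refl))
            M′ = load-blocks v≡ 1≤width ≡0 lr≢0 M
            lr≤ : regs τ 11 ≤ B
            lr≤ = inside (≤-trans (m≤n+m _ (regs τ 10)) (q-inside M))
            lr = regs τ 11
            lr′ = lr ∸ regs τ 3
            lr′≤ : lr′ ≤ B
            lr′≤ = ≤-trans (m∸n≤m lr (regs τ 3)) lr≤
            -- A positive width and a nonempty unread part make the new left block nonempty, so the
            -- following merge step has something to write.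
            a≢0 : regs τ 11 ∸ (regs τ 11 ∸ regs τ 3) ≢ 0
            a≢0 = n<m⇒m∸n≢0 (≤-<-trans (∸-monoʳ-≤ (regs τ 11) (subst (1 ≤_) (sym v≡) 1≤width)) (∸-monoʳ-< {regs τ 11} {1} {0} z<s (n≢0⇒n>0 lr≢0)))
        in
        inside (≤-trans (m≤m+n _ (regs τ 11)) (q-inside M)) ⨾R
        ≤-trans (m∸n≤m lr lr′) lr≤ ⨾R
        inside (i-inside M′) ⨾R
        lr′≤ ⨾R
        inside (i-inside M′) ⨾R
        ≤-trans (m∸n≤m lr′ (lr′ ∸ regs τ 3)) lr′≤ ⨾R
        inside (j-inside M′) ⨾R
        assignR (≤-trans (m∸n≤m lr′ (regs τ 3)) lr′≤)
          ((o≡ , M′ , b) , (λ z → a≢0 (m+n≡0⇒m≡0 _ z)))))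

    merge-runs : ∀ {u τ} → Input τ → u < n → Inv u τ → regs τ 7 + regs τ 9 ≢ 0 → Runs B mergeC τ (Inv (suc u)) 70
    merge-runs {u} {τ} inp u<n (o≡ , M , b) ≢0 = weaken (≤ᵇ⇒≤ _ 70 tt) (
      ifR {Q = λ τ′ → regs τ′ 12 ≡ base + n + u ×
             Merging width base T X₀ (arrays τ′ 5) (regs τ′ 6) (regs τ′ 7) (regs τ′ 8) (regs τ′ 9) (regs τ′ 10) (regs τ′ 11) (suc u) ×
             (∀ y → arrays τ′ 5 y ≤ B)}
        (λ g → let li≢0 , ord = leftFirst-≢0 (subst (_≢ 0) (leftFirst≡ inp) g)
                   M′ = take-left o≡ li≢0 ord M in
          b _ ⨾S
          inside (≤-trans (m≤m+n _ (regs τ 7 ∸ 1)) (i-inside M′)) ⨾R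
          assignR (inside (≤-trans (m≤n+m _ (regs τ 6 + 1)) (i-inside M′)))
            (o≡ , M′ , update-elim (λ _ v → v ≤ B) (arrays τ 5) (regs τ 12) _ (b _) (λ {y} _ → b y)))
        (λ g → let lj≢0 , ord = leftFirst-≡0 ≢0 (trans (sym (leftFirst≡ inp)) g)
                   M′ = take-right o≡ lj≢0 ord M in
          b _ ⨾S
          inside (≤-trans (m≤m+n _ (regs τ 9 ∸ 1)) (j-inside M′)) ⨾R
          assignR (inside (≤-trans (m≤n+m _ (regs τ 8 + 1)) (j-inside M′)))
            (o≡ , M′ , update-elim (λ _ v → v ≤ B) (arrays τ 5) (regs τ 12) _ (b _) (λ {y} _ → b y)))
      ⨾F λ _ (o≡′ , M′ , b′) →
        let next : _ + 1 ≡ base + n + suc u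
            next = trans (cong (_+ 1) o≡′) (trans (+-assoc (base + n) u 1) (cong (base + n +_) (+-comm u 1)))
        in assignR (≤-trans (≤-reflexive next) (≤-trans (+-monoʳ-≤ (base + n) u<n) room)) (next , M′ , b′))

    pass-runs : ∀ {σ} → Input σ → regs σ 3 ≡ width → Inv 0 σ →
      Runs B (while reg 7 ⊕ reg 9 ⊕ reg 11 loop passC) σ (Inv n) (n * 118 + 6)
    pass-runs {σ} inp v≡ inv = forR n Inv (λ _ (_ , M , _) → remaining M)
      (λ fr u<n inv′ → load-runs u<n (trans (keptReg fr 3) v≡) inv′
        ⨾F λ fr′ (inv″ , ≢0) → merge-runs (frame-input fr′ (frame-input fr inp)) u<n inv″ ≢0) inv

  -- `r` is the number of passes still allowed: `enough` stops the loop at `r = 0`, and `room` keeps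
  -- the layers within `n * ⌈log₂ n ⌉` addresses before the last one.
  record SortedUpTo (width base : ℕ) (X : ℕ → ℕ) (r : ℕ) : Set where
    field
      width≥1 : 1 ≤ width
      enough  : n ≤ width * 2 ^ r
      room    : base + r * n ≤ n * ⌈log₂ n ⌉
      perm    : seg X base n ↭ seg id 0 n
      blocks  : Blocks width (seg X base n)
      bound   : ∀ y → X y ≤ B
  open SortedUpTo

  Sorting : ℕ → State → Set
  Sorting r τ = SortedUpTo (regs τ 3) (regs τ 4) (arrays τ 5) r

  sort-runs : ∀ {σ} → Input σ → regs σ 4 ≡ 0 → (∀ {y} → y < n → arrays σ 5 y ≡ y) → (∀ y → arrays σ 5 y ≤ B) →
    n * ⌈log₂ n ⌉ + n + n ≤ B → 1 ≤ B →
    Runs B sortC σ (λ τ → (seg (arrays τ 5) (regs τ 4) n ↭ seg id 0 n) ×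
                          Ordered (seg (arrays τ 5) (regs τ 4) n))
      (2 + (⌈log₂ n ⌉ * (4 + (24 + (n * 118 + 6))) + 4))
  sort-runs {σ} inp base≡0 h b B≥ 1≤B = 1≤B ⨾R
    (consequence finish (whileR Sorting stop body ⌈log₂ n ⌉ start))
    where
    σ₁ = setReg σ 3 1
    C = 6 := lit 0 ⨾ 7 := lit 0 ⨾ 8 := lit 0 ⨾ 9 := lit 0 ⨾ 10 := reg 4 ⨾ 11 := reg 0 ⨾ 12 := reg 4 ⊕ reg 0 ⨾
        (while reg 7 ⊕ reg 9 ⊕ reg 11 loop passC) ⨾ 4 := reg 4 ⊕ reg 0 ⨾ 3 := reg 3 ⊕ reg 3
    start : Sorting ⌈log₂ n ⌉ σ₁
    start = record
      { width≥1 = ≤-refl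
      ; enough  = ≤-trans (n≤2^⌈log₂n⌉ n) (≤-reflexive (sym (*-identityˡ _)))
      ; room    = ≤-reflexive (trans (cong (_+ ⌈log₂ n ⌉ * n) base≡0) (*-comm ⌈log₂ n ⌉ n))
      ; perm    = ↭-reflexive (trans (cong (λ a → seg (arrays σ 5) a n) base≡0) (seg-cong 0 n (λ _ y< → h y<)))
      ; blocks  = Blocks-1 _
      ; bound   = b
      }
    inp₁ : Input σ₁
    inp₁ = record { n≡ = n≡ inp ; k≡ = k≡ inp ; p≡ = p≡ inp ; w≡ = w≡ inp ; e≡ = e≡ inp }
    stop : ∀ {τ} → Frame C σ₁ τ → Sorting 0 τ → regs τ 0 ∸ regs τ 3 ≡ 0
    stop {τ} fr S = m≤n⇒m∸n≡0 (≤-trans (≤-reflexive (n≡ (frame-input fr inp₁)))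
      (≤-trans (enough S) (≤-reflexive (*-identityʳ (regs τ 3)))))
    finish : ∀ {τ} → Frame (while reg 0 ⊖ reg 3 loop C) σ₁ τ → (regs τ 0 ∸ regs τ 3 ≡ 0 × ∃[ r ] Sorting r τ) → _
    finish {τ} fr (z , r , S) = perm S ,
      Blocks-≥ (≤-trans (≤-reflexive (trans (length-seg (arrays τ 5) (regs τ 4) n) (sym (n≡ (frame-input fr inp₁))))) (m∸n≡0⇒m≤n z)) (blocks S)
    body : ∀ {r τ} → Frame C σ₁ τ → Sorting (suc r) τ → regs τ 0 ∸ regs τ 3 ≢ 0 → Runs B C τ (Sorting r) (24 + (n * 118 + 6))
    body {r} {τ} fr S ≢0 = weaken (≤-reflexive (cong (16 +_) (+-comm (n * 118 + 6) 8)))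
      (z≤n ⨾R z≤n ⨾R z≤n ⨾R z≤n ⨾R inside (m≤m+n base n) ⨾R ≤-trans (≤-reflexive (n≡ inp′)) (inside (m≤n+m n base)) ⨾R
       ≤-trans (≤-reflexive (cong (base +_) (n≡ inp′))) (inside ≤-refl) ⨾R
       (pass-runs inp₂ refl inv₀ ⨾F λ {τ′} fr′ (o≡ , M , b′) →
         let base≡ = cong₂ _+_ (keptReg fr′ 4) (n≡ (frame-input fr′ inp₂))
             width≡ = cong₂ _+_ (keptReg fr′ 3) (keptReg fr′ 3)
         in
         ≤-trans (≤-reflexive base≡) (inside ≤-refl) ⨾R
         assignR (≤-trans (≤-reflexive width≡) width+width≤B)
           (subst₂ (λ v a → SortedUpTo v a (arrays τ′ 5) r) (sym width≡) (sym base≡) (doubled b′ (Merging-done M)))))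
      where
      width = regs τ 3
      base = regs τ 4
      X₀ = arrays τ 5
      L = seg X₀ base n
      inp′ : Input τ
      inp′ = frame-input fr inp₁
      base+n+n≤B : base + n + n ≤ B
      base+n+n≤B = ≤-trans (+-monoˡ-≤ n (+-monoˡ-≤ n (≤-trans (m≤m+n base (suc r * n)) (room S)))) B≥
      width<n : width < n
      width<n = subst (width <_) (n≡ inp′) (m∸n≢0⇒n<m ≢0)
      width+width≤B : width + width ≤ B
      width+width≤B = ≤-trans (+-mono-≤ (≤-trans (<⇒≤ width<n) (m≤n+m n base)) (<⇒≤ width<n)) base+n+n≤B
      open Pass {width} {base} {pass width n L} {X₀} (width≥1 S) base+n+n≤B
      τ₂ = setReg (setReg (setReg (setReg (setReg (setReg (setReg τ 6 0) 7 0) 8 0) 9 0) 10 base) 11 (regs τ 0)) 12 (base + regs τ 0)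
      inp₂ : Input τ₂
      inp₂ = record { n≡ = n≡ inp′ ; k≡ = k≡ inp′ ; p≡ = p≡ inp′ ; w≡ = w≡ inp′ ; e≡ = e≡ inp′ }
      inv₀ : Inv 0 τ₂
      inv₀ = trans (cong (base +_) (n≡ inp′)) (sym (+-identityʳ (base + n))) , record
        { fuel      = n
        ; lr≤fuel   = ≤-reflexive (n≡ inp′)
        ; remaining = n≡ inp′
        ; i-inside  = z≤n
        ; j-inside  = z≤n
        ; q-inside  = ≤-reflexive (cong (base +_) (n≡ inp′))
        ; kept      = λ _ → refl
        ; target    = cong (λ l → pass width n (seg X₀ base l)) (n≡ inp′)
        } , bound S
      doubled : ∀ {X} → (∀ y → X y ≤ B) → seg X (base + n) n ≡ pass width n L →
                SortedUpTo (width + width) (base + n) X r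
      doubled b′ eq = record
        { width≥1 = ≤-trans (width≥1 S) (m≤m+n width width)
        ; enough  = ≤-trans (enough S) (≤-reflexive (trans (cong (λ q → width * (2 ^ r + q)) (+-identityʳ (2 ^ r)))
                      (trans (*-distribˡ-+ width (2 ^ r) (2 ^ r)) (sym (*-distribʳ-+ (2 ^ r) width width)))))
        ; room    = ≤-trans (≤-reflexive (+-assoc base n (r * n))) (room S)
        ; perm    = ↭-trans (↭-reflexive eq) (↭-trans (pass-↭ n L (width≥1 S) (≤-reflexive (length-seg X₀ base n))) (perm S))
        ; blocks  = subst (Blocks (width + width)) (sym eq) (pass-Blocks n L (blocks S))
        ; bound   = b′
        }

-- Registering the distinct processing times and their powers

module Types (n k : ℕ) (p w e : ℕ → ℕ) (B D : ℕ)
  (distinct≤D : ∀ {c} (f : ℕ → ℕ) → (∀ {t} → t < c → ∃[ b ] (b < n × f t ≡ p b)) →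
                (∀ {t t′} → t < t′ → t′ < c → f t ≢ f t′) → c ≤ D)
  (K^D≤B : suc k ^ D ≤ B) (n≤B : n ≤ B) (p≤B : ∀ {b} → b < n → p b ≤ B) where

  open Phases n k p w e B

  -- For k = 0 no processing time is ever registered, so that scanning the list of
  -- registered values costs nothing.
  record Typing (a : ℕ) (dist pow mult : ℕ → ℕ) (c M : ℕ) : Set where
    field
      M≡       : M ≡ suc k ^ c
      pow≡     : ∀ {t} → t < c → pow t ≡ suc k ^ t
      value    : ∀ {t} → t < c → ∃[ b ] (b < n × dist t ≡ p b)
      distinct : ∀ {t t′} → t < t′ → t′ < c → dist t ≢ dist t′
      covered  : ∀ {b} → b < a → ∃[ t ] (mult b ≡ suc k ^ t × (k ≡ 0 ⊎ (t < c × p b ≡ dist t)))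
      trivial  : k ≡ 0 → c ≡ 0
  open Typing public

  module _ {a dist pow mult c M} (Ty : Typing a dist pow mult c M) where

    c≤D : c ≤ D
    c≤D = distinct≤D dist (value Ty) (distinct Ty)

    M≤K^D : M ≤ suc k ^ D
    M≤K^D = ≤-trans (≤-reflexive (M≡ Ty)) (^-monoʳ-≤ (suc k) c≤D)

    -- This pays for the linear search: exponential growth covers the list length if the base is at
    -- least 2, and for `k = 0` the list is empty.
    c≤K^D : c ≤ suc k ^ D
    c≤K^D with k ≟ 0
    ... | yes k≡0 = ≤-trans (≤-reflexive (trivial Ty k≡0)) z≤n
    ... | no  k≢0 = ≤-trans c≤D (m≤K^m D k≢0)

    power≤B : ∀ {t} {A : Set} → k ≡ 0 ⊎ (t < c × A) → suc k ^ t ≤ B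
    power≤B {t} (inj₁ k≡0)       = ≤-trans (≤-reflexive (trans (cong (λ j → suc j ^ t) k≡0) (^-zeroˡ t))) (≤-trans (m^n>0 (suc k) D) K^D≤B)
    power≤B {t} (inj₂ (t<c , _)) = ≤-trans (^-monoʳ-≤ (suc k) (<⇒≤ (<-≤-trans t<c c≤D))) K^D≤B

    assign-power : ∀ {t a′} → a′ ≡ a → pow t ≡ suc k ^ t → (k ≡ 0 ⊎ (t < c × p a ≡ dist t)) →
                   Typing (suc a) dist pow (update mult a′ (pow t)) c M
    assign-power {t} refl pow≡K h = record
      { M≡ = M≡ Ty ; pow≡ = pow≡ Ty ; value = value Ty ; distinct = distinct Ty ; trivial = trivial Ty
      ; covered = λ {b} → update-elim (λ b v → b < suc a → ∃[ t ] (v ≡ suc k ^ t × (k ≡ 0 ⊎ (t < c × p b ≡ dist t))))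
          mult a (pow t) (λ _ → t , pow≡K , h)
          (λ a≢b b<1+a → covered Ty (≤∧≢⇒< (≤-pred b<1+a) (≢-sym a≢b))) b
      }

    -- One statement for all `k`, as `1 ∸ (1 ∸ k)` is the sign of `k`. For `k = 0` both `c` and `M`
    -- stay unchanged and position 0 is merely overwritten.
    register : ∀ {t} → t ≡ c → a < n → (∀ {t} → t < c → dist t ≢ p a) →
      Typing a (update dist t (p a)) (update pow t M) mult (c + (1 ∸ (1 ∸ k))) (M * (k + 1))
    register {t} refl a<n new = record
      { M≡ = M′≡
      ; pow≡ = λ {t} → update-elim (λ t v → t < c′ → v ≡ suc k ^ t) pow c M (λ _ → M≡ Ty)
          (λ c≢t t<c′ → pow≡ Ty (old c≢t t<c′)) t
      ; value = λ {t} → update-elim (λ t v → t < c′ → ∃[ b ] (b < n × v ≡ p b)) dist c (p a) (λ _ → a , a<n , refl)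
          (λ c≢t t<c′ → value Ty (old c≢t t<c′)) t
      ; distinct = λ {t} {t′} t<t′ t′<c′ eq →
          let t<c = <-≤-trans t<t′ (≤c t′<c′)
              eq′ = trans (sym (update-other dist (p a) (>⇒≢ t<c))) eq in
          update-elim (λ t′ v → t < t′ → t′ < c′ → dist t ≢ v) dist c (p a) (λ _ _ → new t<c)
            (λ c≢t′ t<t′ t′<c′ → distinct Ty t<t′ (old c≢t′ t′<c′)) t′ t<t′ t′<c′ eq′
      ; covered = λ b<a → lift (covered Ty b<a)
      ; trivial = λ k≡0 → cong₂ (λ c k → c + (1 ∸ (1 ∸ k))) (trivial Ty k≡0) k≡0
      }
      where
      c′ = c + (1 ∸ (1 ∸ k))
      ≤c : ∀ {t} → t < c′ → t ≤ c
      ≤c t<c′ = ≤-pred (<-≤-trans t<c′ (≤-trans (+-monoʳ-≤ c (m∸n≤m 1 (1 ∸ k))) (≤-reflexive (+-comm c 1))))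
      old : ∀ {t} → c ≢ t → t < c′ → t < c
      old c≢t t<c′ = ≤∧≢⇒< (≤c t<c′) (≢-sym c≢t)
      M′≡ : M * (k + 1) ≡ suc k ^ c′
      M′≡ = power k (M≡ Ty)
        where
        power : ∀ k → M ≡ suc k ^ c → M * (k + 1) ≡ suc k ^ (c + (1 ∸ (1 ∸ k)))
        power zero    eq = trans (*-identityʳ M) (trans eq (cong (1 ^_) (sym (+-identityʳ c))))
        power (suc k) eq rewrite 0∸n≡0 k = trans (cong₂ _*_ eq (+-comm (suc k) 1))
          (trans (*-comm (suc (suc k) ^ c) (suc (suc k))) (cong (suc (suc k) ^_) (+-comm 1 c)))
      lift : ∀ {b v} → ∃[ t ] (v ≡ suc k ^ t × (k ≡ 0 ⊎ (t < c × p b ≡ dist t))) →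
             ∃[ t ] (v ≡ suc k ^ t × (k ≡ 0 ⊎ (t < c′ × p b ≡ update dist c (p a) t)))
      lift (t , v≡ , inj₁ z) = t , v≡ , inj₁ z
      lift (t , v≡ , inj₂ (t<c , eq)) = t , v≡ ,
        inj₂ (<-≤-trans t<c (m≤m+n c _) , trans eq (sym (update-other dist (p a) (>⇒≢ t<c))))

    registered : ∀ {t} → t ≡ c → k ≡ 0 ⊎ (t < c + (1 ∸ (1 ∸ k)) × p a ≡ update dist t (p a) t)
    registered {t} refl = go k
      where
      go : ∀ k → k ≡ 0 ⊎ (c < c + (1 ∸ (1 ∸ k)) × p a ≡ update dist c (p a) c)
      go zero    = inj₁ refl
      go (suc k) rewrite 0∸n≡0 k = inj₂ (m<m+n c z<s , sym (update-same dist c (p a)))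

  Inv : ℕ → State → Set
  Inv a τ = regs τ 13 ≡ a × Typing a (arrays τ 6) (arrays τ 7) (arrays τ 8) (regs τ 15) (regs τ 16)

  Searched : ℕ → State → ℕ → State → Set
  Searched a σ r τ = regs τ 14 + r ≡ regs σ 15 × (∀ {t} → t < regs τ 14 → arrays σ 6 t ≢ p a)

  search-runs : ∀ {a σ} → Input σ → a < n → Inv a σ → regs σ 14 ≡ 0 →
    Runs B searchC σ (λ τ → ∃[ r ] Searched a σ r τ × (r ≡ 0 ⊎ arrays σ 6 (regs τ 14) ≡ p a)) (suc k ^ D * 20 + 20)
  search-runs {a} {σ} inp a<n (a≡ , Ty) t≡0 = weaken
    (+-mono-≤ (*-mono-≤ (c≤K^D Ty) (≤ᵇ⇒≤ _ 20 tt)) (≤ᵇ⇒≤ _ 20 tt))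
    (consequence finish (whileR (Searched a σ) stop body (regs σ 15)
      (cong (_+ regs σ 15) t≡0 , λ t< → contradiction (subst (_ <_) t≡0 t<) n≮0)))
    where
    C = 14 := reg 14 ⊕ lit 1
    G = (reg 15 ⊖ reg 14) ⊗ ((6 ⟦ reg 14 ⟧ ⊖ 0 ⟦ reg 13 ⟧) ⊕ (0 ⟦ reg 13 ⟧ ⊖ 6 ⟦ reg 14 ⟧))
    guard : ∀ {τ} → Frame C σ τ → eval τ G ≡
      (regs σ 15 ∸ regs τ 14) * ((arrays σ 6 (regs τ 14) ∸ p a) + (p a ∸ arrays σ 6 (regs τ 14)))
    guard {τ} fr = cong₂ _*_ (cong (_∸ regs τ 14) (keptReg fr 15))
      (cong₂ (λ u v → (u ∸ v) + (v ∸ u)) (cong (λ f → f (regs τ 14)) (keptArr fr 6))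
        (cong₂ (λ f i → f i) (p≡ (frame-input fr inp)) (trans (keptReg fr 13) a≡)))
    stop : ∀ {τ} → Frame C σ τ → Searched a σ 0 τ → eval τ G ≡ 0
    stop {τ} fr (eq , _) = trans (guard fr) (cong (_* ((arrays σ 6 (regs τ 14) ∸ p a) + (p a ∸ arrays σ 6 (regs τ 14)))) (m≤n⇒m∸n≡0 (≤-reflexive (trans (sym eq) (+-identityʳ (regs τ 14))))))
    body : ∀ {r τ} → Frame C σ τ → Searched a σ (suc r) τ → eval τ G ≢ 0 → Runs B C τ (Searched a σ r) 4
    body {r} {τ} fr (eq , h) ≢0 = assignR
      (≤-trans (≤-reflexive (+-comm (regs τ 14) 1))
        (≤-trans (≤-trans (subst (regs τ 14 <_) eq (m<m+n _ z<s)) (c≤K^D Ty)) K^D≤B))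
      (trans (+-assoc (regs τ 14) 1 r) eq ,
       λ {t} t< → h′ (≤-pred (subst (t <_) (+-comm (regs τ 14) 1) t<)))
      where
      differs : arrays σ 6 (regs τ 14) ≢ p a
      differs eq = m*n≢0ʳ {regs σ 15 ∸ regs τ 14} (subst (_≢ 0) (guard fr) ≢0)
        (trans (cong (λ u → (u ∸ p a) + (p a ∸ u)) eq) (cong₂ _+_ (n∸n≡0 (p a)) (n∸n≡0 (p a))))
      h′ : ∀ {t} → t ≤ regs τ 14 → arrays σ 6 t ≢ p a
      h′ {t} t≤ with t ≟ regs τ 14
      ... | yes refl = differs
      ... | no  t≢   = h (≤∧≢⇒< t≤ t≢)
    finish : ∀ {τ} → Frame searchC σ τ → (eval τ G ≡ 0 × ∃[ r ] Searched a σ r τ) →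
             ∃[ r ] Searched a σ r τ × (r ≡ 0 ⊎ arrays σ 6 (regs τ 14) ≡ p a)
    finish fr (_ , zero , S) = 0 , S , inj₁ refl
    finish {τ} fr (z , suc r , S) = suc r , S , inj₂ (≤-antisym
        (m∸n≡0⇒m≤n (m+n≡0⇒m≡0 _ both≡0)) (m∸n≡0⇒m≤n (m+n≡0⇒n≡0 (arrays σ 6 (regs τ 14) ∸ p a) both≡0)))
      where
      fr′ : Frame C σ τ
      fr′ = record { keptReg = λ x {h} → keptReg fr x {h} ; keptArr = λ a {h} → keptArr fr a {h} }
      both≡0 : (arrays σ 6 (regs τ 14) ∸ p a) + (p a ∸ arrays σ 6 (regs τ 14)) ≡ 0
      both≡0 = m*n≡0⇒n≡0 (n<m⇒m∸n≢0 (subst (regs τ 14 <_) (proj₁ S) (m<m+n _ z<s))) (trans (sym (guard fr′)) z)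

  register-runs : ∀ {a σ r} → Input σ → a < n → Inv a σ →
    regs σ 14 + r ≡ regs σ 15 → (∀ {t} → t < regs σ 14 → arrays σ 6 t ≢ p a) → (r ≡ 0 ⊎ arrays σ 6 (regs σ 14) ≡ p a) →
    Runs B registerC σ (λ τ → Inv a τ × arrays τ 7 (regs τ 14) ≡ suc k ^ regs τ 14 ×
      (k ≡ 0 ⊎ (regs τ 14 < regs τ 15 × p a ≡ arrays τ 6 (regs τ 14)))) 40
  register-runs {a} {σ} {r} inp a<n (a≡ , Ty) t+r≡ new found = weaken (≤ᵇ⇒≤ _ 40 tt) (ifR
    (λ ≢0 → let t<c = m∸n≢0⇒n<m ≢0 in skipR ((a≡ , Ty) , pow≡ Ty t<c , inj₂ (t<c , sym (hit t<c found))))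
    (λ ≡0 →
      let t≡c = ≤-antisym (subst (regs σ 14 ≤_) t+r≡ (m≤m+n _ r)) (m∸n≡0⇒m≤n ≡0)
          Ty′ = register Ty t≡c a<n (λ {t} t<c → new (subst (t <_) (sym t≡c) t<c))
          pa≡ : arrays σ 0 (regs σ 13) ≡ p a
          pa≡ = cong₂ (λ f i → f i) (p≡ inp) a≡
          k≡′ = k≡ inp
      in
      subst (_≤ B) (sym pa≡) (p≤B a<n) ⨾S
      ≤-trans (M≤K^D Ty) K^D≤B ⨾S
      subst (λ k → regs σ 16 * (k + 1) ≤ B) (sym k≡′) (≤-trans (M≤K^D Ty′) K^D≤B) ⨾R
      assignR (subst (λ k → regs σ 15 + (1 ∸ (1 ∸ k)) ≤ B) (sym k≡′) (≤-trans (c≤K^D Ty′) K^D≤B))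
        ((a≡ , subst₂ (λ v k′ → Typing a (update (arrays σ 6) (regs σ 14) v) (update (arrays σ 7) (regs σ 14) (regs σ 16)) (arrays σ 8)
                                  (regs σ 15 + (1 ∸ (1 ∸ k′))) (regs σ 16 * (k′ + 1))) (sym pa≡) (sym k≡′) Ty′) ,
         trans (update-same (arrays σ 7) (regs σ 14) (regs σ 16)) (trans (M≡ Ty) (cong (suc k ^_) (sym t≡c))) ,
         subst₂ (λ v k′ → k ≡ 0 ⊎ (regs σ 14 < regs σ 15 + (1 ∸ (1 ∸ k′)) × p a ≡ update (arrays σ 6) (regs σ 14) v (regs σ 14)))
           (sym pa≡) (sym k≡′) (registered Ty t≡c))))
    where
    hit : regs σ 14 < regs σ 15 → r ≡ 0 ⊎ arrays σ 6 (regs σ 14) ≡ p a → arrays σ 6 (regs σ 14) ≡ p a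
    hit t<c (inj₁ refl) = contradiction (trans (sym (+-identityʳ _)) t+r≡) (<⇒≢ t<c)
    hit t<c (inj₂ eq)   = eq

  types-runs : ∀ {σ} → Input σ → regs σ 13 ≡ 0 → regs σ 15 ≡ 0 → 1 ≤ B →
    Runs B typesC σ (Inv n) (2 + (n * (4 + (2 + ((suc k ^ D * 20 + 20) + (40 + 8)))) + 4))
  types-runs {σ} inp a≡0 c≡0 1≤B = 1≤B ⨾R forR n Inv
    (λ fr (a≡ , _) → cong₂ _∸_ (n≡ (frame-input fr inp₁)) a≡) body start
    where
    σ₁ = setReg σ 16 1
    inp₁ : Input σ₁
    inp₁ = record { n≡ = n≡ inp ; k≡ = k≡ inp ; p≡ = p≡ inp ; w≡ = w≡ inp ; e≡ = e≡ inp }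
    none : ∀ {t} {A : Set} → t < regs σ 15 → A
    none t<c = contradiction (subst (_ <_) c≡0 t<c) n≮0
    start : Inv 0 σ₁
    start = a≡0 , record
      { M≡ = cong (suc k ^_) (sym c≡0) ; pow≡ = none ; value = none
      ; distinct = λ _ → none ; covered = λ () ; trivial = λ _ → c≡0 }
    body : ∀ {a τ} → Frame typesBodyC σ₁ τ → a < n → Inv a τ →
           Runs B typesBodyC τ (Inv (suc a)) (2 + ((suc k ^ D * 20 + 20) + (40 + 8)))
    body {a} {τ} fr a<n (a≡ , Ty) = z≤n ⨾R
      (search-runs inp₂ a<n (a≡ , Ty) refl ⨾F λ {τ₁} fr₁ (r , (t+r≡ , new) , hit) →
      register-runs {a} {τ₁} {r} (frame-input fr₁ inp₂) a<n
        (trans (keptReg fr₁ 13) a≡ , subst (λ (f , g , h , c , M) → Typing a f g h c M) (sym (same fr₁)) Ty)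
        (trans t+r≡ (sym (keptReg fr₁ 15)))
        (λ {t} t< → subst (λ f → f t ≢ p a) (sym (keptArr fr₁ 6)) (new t<))
        (subst (λ f → r ≡ 0 ⊎ f (regs τ₁ 14) ≡ p a) (sym (keptArr fr₁ 6)) hit)
      ⨾F λ {τ₂} fr₂ ((a≡₂ , Ty₂) , pow≡K , cov) →
      subst (_≤ B) (sym pow≡K) (power≤B Ty₂ cov) ⨾S
      assignR (≤-trans (≤-reflexive (trans (cong (_+ 1) a≡₂) (+-comm a 1))) (≤-trans a<n n≤B))
        (trans (cong (_+ 1) a≡₂) (+-comm a 1) , assign-power Ty₂ a≡₂ pow≡K cov))
      where
      τ₀ = setReg τ 14 0
      inp₂ : Input τ₀
      inp₂ = let i = frame-input fr inp₁ in record { n≡ = n≡ i ; k≡ = k≡ i ; p≡ = p≡ i ; w≡ = w≡ i ; e≡ = e≡ i }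
      same : ∀ {τ₁} → Frame searchC τ₀ τ₁ →
        (arrays τ₁ 6 , arrays τ₁ 7 , arrays τ₁ 8 , regs τ₁ 15 , regs τ₁ 16) ≡
        (arrays τ 6 , arrays τ 7 , arrays τ 8 , regs τ 15 , regs τ 16)
      same fr = cong₂ _,_ (keptArr fr 6) (cong₂ _,_ (keptArr fr 7) (cong₂ _,_ (keptArr fr 8)
        (cong₂ _,_ (keptReg fr 15) (keptReg fr 16))))

-- Filling the table, choosing a final state and tracing it back

keepsReady : Cmd → Bool
keepsReady c = keepsInput c ∧ keepsReg 4 c ∧ keepsReg 16 c ∧ keepsArr 5 c ∧ keepsArr 8 c

module Tabulation (n k : ℕ) (p w e : ℕ → ℕ) (B : ℕ) (X : ℕ → ℕ) (base : ℕ) (mu : ℕ → ℕ) (M N : ℕ) where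

  open Phases n k p w e B using (Input; frame-input; n≡; k≡; p≡; w≡; e≡)

  x : ℕ → ℕ
  x m = X (base + m)

  open Decisions x p w e public
  open Keyed mu k public

  record Ready (σ : State) : Set where
    field
      input : Input σ
      base≡ : regs σ 4 ≡ base
      M≡    : regs σ 16 ≡ M
      X≡    : arrays σ 5 ≡ X
      mu≡   : arrays σ 8 ≡ mu
  open Ready public

  frame-ready : ∀ {c σ τ} → Frame c σ τ → {_ : T (keepsReady c)} → Ready σ → Ready τ
  frame-ready {c} fr {h} rdy =
    let h₀ , h′   = Equivalence.to (T-∧ {keepsInput c}) h
        h₁ , h″   = Equivalence.to (T-∧ {keepsReg 4 c}) h′
        h₂ , h‴   = Equivalence.to (T-∧ {keepsReg 16 c}) h″
        h₃ , h₄   = Equivalence.to (T-∧ {keepsArr 5 c}) h‴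
    in record
    { input = frame-input fr {h₀} (input rdy)
    ; base≡ = trans (keptReg fr 4 {h₁}) (base≡ rdy)
    ; M≡    = trans (keptReg fr 16 {h₂}) (M≡ rdy)
    ; X≡    = trans (keptArr fr 5 {h₃}) (X≡ rdy)
    ; mu≡   = trans (keptArr fr 8 {h₄}) (mu≡ rdy)
    }

  -- Progress is measured by the linear address in row-major order, so the loops over rows and over
  -- columns share one invariant.
  Tabulated : (ℕ → ℕ) → (Cell → ℕ) → ℕ → Set
  Tabulated a f pos = ∀ m s → s < M → m * M + s < pos → a (m * M + s) ≡ f (cell m s)

  record Tables (value′ load′ budget′ mark′ : ℕ → ℕ) (pos : ℕ) : Set where
    field
      values  : Tabulated value′ value pos
      loads   : Tabulated load′ load pos
      budgets : Tabulated budget′ budget pos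
      marks   : Tabulated mark′ mark pos
  open Tables public

  tables : State → ℕ → Set
  tables τ = Tables (arrays τ 9) (arrays τ 10) (arrays τ 11) (arrays τ 12)

  Tabulated-extend : ∀ {a f v i m s} → s < M → i ≡ m * M + s → v ≡ f (cell m s) →
    Tabulated a f (m * M + s) → Tabulated (update a i v) f (suc (m * M + s))
  Tabulated-extend {a} {f} {v} {i} {m} {s} s<M refl v≡ tab m′ s′ s′<M lt with (m * M + s) ≟ (m′ * M + s′)
  ... | no  ≢ = trans (update-other a v ≢) (tab m′ s′ s′<M (≤∧≢⇒< (≤-pred lt) (≢-sym ≢)))
  ... | yes eq with *-+-unique {m = m} {m′} s<M s′<M eq
  ... | refl , refl = trans (update-same a (m * M + s) v) v≡

  Tables-extend : ∀ {a b c d i m s va vb vc vd} → s < M → i ≡ m * M + s →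
    va ≡ value (cell m s) → vb ≡ load (cell m s) → vc ≡ budget (cell m s) → vd ≡ mark (cell m s) →
    Tables a b c d (m * M + s) →
    Tables (update a i va) (update b i vb) (update c i vc) (update d i vd) (suc (m * M + s))
  Tables-extend {a} {b} {c} {d} {m = m} {s} s<M i≡ ea eb ec ed t = record
    { values  = Tabulated-extend {a} {value} {m = m} {s} s<M i≡ ea (values t)
    ; loads   = Tabulated-extend {b} {load} {m = m} {s} s<M i≡ eb (loads t)
    ; budgets = Tabulated-extend {c} {budget} {m = m} {s} s<M i≡ ec (budgets t)
    ; marks   = Tabulated-extend {d} {mark} {m = m} {s} s<M i≡ ed (marks t)
    }

  Tabulated-at : ∀ a f {pos i j s} m → Tabulated a f pos → i ≡ m * M → j ≡ s → s < M → m * M + s < pos →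
                 a (i + j) ≡ f (cell m s)
  Tabulated-at a f m tab refl refl s<M lt = tab m _ s<M lt

  module Run (1≤M : 1 ≤ M) (n≤B : n ≤ B) (nM≤B : n * M ≤ B) (M≤B : M ≤ B) (k<B : k < B)
    (x<n : ∀ {i} → i < n → x i < n)
    (small : ∀ {i} → i < n → p (x i) ≤ N × w (x i) ≤ N × e (x i) ≤ N)
    (load≤B : n * N ≤ B) (value≤B : n * (N + N * (n * N)) ≤ B) where

    1≤B : 1 ≤ B
    1≤B = ≤-trans 1≤M M≤B

    cell≤B : ∀ m s → m ≤ n → value (cell m s) ≤ B × load (cell m s) ≤ B × budget (cell m s) ≤ B × mark (cell m s) ≤ B
    cell≤B m s m≤n = let c = cell-small N small m s m≤n in
      ≤-trans (value≤ c) (≤-trans (*-monoˡ-≤ _ m≤n) value≤B) ,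
      ≤-trans (load≤ c) (≤-trans (*-monoˡ-≤ N m≤n) load≤B) ,
      ≤-trans (budget≤ c) k<B , ≤-trans (mark≤ c) 1≤B

    formula : (S MU Qu Qa Fa W A P Fu E : ℕ) → ℕ
    formula S MU Qu Qa Fa W A P Fu E = ((S + 1) ∸ MU) * (Qu ∸ 1) * ((1 ∸ Qa) + ((Fa + W * (A + P)) ∸ (Fu + E)))

    -- All ten operands of the test are replaced at once, each being equal to its memory content
    -- only by a proof.
    formula-cong : ∀ {S MU Qu Qa Fa W A P Fu E S′ MU′ Qu′ Qa′ Fa′ W′ A′ P′ Fu′ E′} →
      S ≡ S′ → MU ≡ MU′ → Qu ≡ Qu′ → Qa ≡ Qa′ → Fa ≡ Fa′ → W ≡ W′ → A ≡ A′ → P ≡ P′ → Fu ≡ Fu′ → E ≡ E′ →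
      formula S MU Qu Qa Fa W A P Fu E ≡ formula S′ MU′ Qu′ Qa′ Fa′ W′ A′ P′ Fu′ E′
    formula-cong refl refl refl refl refl refl refl refl refl refl = refl

    CellInv : ℕ → ℕ → State → Set
    CellInv m s τ = regs τ 19 ≡ s × tables τ (suc m * M + s)

    cell-runs : ∀ {m s τ} → Ready τ → m < n → s < M → regs τ 18 ≡ m * M → regs τ 20 ≡ x m →
      CellInv m s τ → Runs B cellC τ (CellInv m (suc s)) 170
    cell-runs {m} {s} {τ} rdy m<n s<M row job (s≡ , tab) = weaken (≤ᵇ⇒≤ _ 170 tt)
      (ifR {Q = λ τ′ → regs τ′ 19 ≡ s × tables τ′ (suc (suc m * M + s))}
        (λ g → let eq = select-≢0 {a = reject (x m) u} {b = accept (x m) a} (subst (_≢ 0) guard≡ g)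
                   F≡ = trans (cong₂ _+_ Fu e′) (cong value (sym eq))
                   A≡ = trans Au (cong load (sym eq))
                   Q≡ = trans (cong (_∸ 1) Qu) (cong budget (sym eq))
               in
          subst (_≤ B) (sym F≡) F≤ ⨾S subst (_≤ B) (sym A≡) A≤ ⨾S subst (_≤ B) (sym Q≡) Q≤ ⨾S
          storeR 1≤B (s≡ , Tables-extend {m = suc m} {s} s<M pos≡ F≡ A≡ Q≡ (cong mark (sym eq)) tab))
        (λ g → let eq = select-≡0 {a = reject (x m) u} {b = accept (x m) a} (trans (sym guard≡) g)
                   A≡ = trans (cong₂ _+_ Aa p′) (cong load (sym eq))
                   F≡ = trans (cong₂ _+_ Fa (cong₂ _*_ w′ (cong₂ _+_ Aa p′))) (cong value (sym eq))
                   Q≡ = trans Qa (cong budget (sym eq))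
               in
          subst (_≤ B) (sym F≡) F≤ ⨾S subst (_≤ B) (sym A≡) A≤ ⨾S subst (_≤ B) (sym Q≡) Q≤ ⨾S
          storeR z≤n (s≡ , Tables-extend {m = suc m} {s} s<M pos≡ F≡ A≡ Q≡ (cong mark (sym eq)) tab))
      ⨾F λ {τ′} _ (s≡′ , tab′) →
        let next = trans (cong (_+ 1) s≡′) (+-comm s 1) in
        assignR (≤-trans (≤-reflexive next) (≤-trans s<M M≤B))
          (next , subst (tables τ′) (sym (+-suc (suc m * M) s)) tab′))
      where
      inp = input rdy
      a u : Cell
      a = cell m s
      u = cell m (s ∸ mu (x m))
      μ : arrays τ 8 (regs τ 20) ≡ mu (x m)
      μ = cong₂ (λ f i → f i) (mu≡ rdy) job
      p′ : arrays τ 0 (regs τ 20) ≡ p (x m)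
      p′ = cong₂ (λ f i → f i) (p≡ inp) job
      w′ : arrays τ 1 (regs τ 20) ≡ w (x m)
      w′ = cong₂ (λ f i → f i) (w≡ inp) job
      e′ : arrays τ 2 (regs τ 20) ≡ e (x m)
      e′ = cong₂ (λ f i → f i) (e≡ inp) job
      -- Every address of row `m` precedes the cell being written in row `suc m`, so both
      -- predecessors are already tabulated.
      before : ∀ {s′} → s′ < M → m * M + s′ < suc m * M + s
      before {s′} s′<M = <-≤-trans (subst (m * M + s′ <_) (+-comm (m * M) M) (+-monoʳ-< (m * M) s′<M)) (m≤m+n _ s)
      u<M : s ∸ mu (x m) < M
      u<M = ≤-<-trans (m∸n≤m s (mu (x m))) s<M
      u≡ : regs τ 19 ∸ arrays τ 8 (regs τ 20) ≡ s ∸ mu (x m)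
      u≡ = cong₂ _∸_ s≡ μ
      Fa = Tabulated-at (arrays τ 9) value m (values tab) row s≡ s<M (before s<M)
      Aa = Tabulated-at (arrays τ 10) load m (loads tab) row s≡ s<M (before s<M)
      Qa = Tabulated-at (arrays τ 11) budget m (budgets tab) row s≡ s<M (before s<M)
      Fu = Tabulated-at (arrays τ 9) value m (values tab) row u≡ u<M (before u<M)
      Au = Tabulated-at (arrays τ 10) load m (loads tab) row u≡ u<M (before u<M)
      Qu = Tabulated-at (arrays τ 11) budget m (budgets tab) row u≡ u<M (before u<M)
      guard≡ : eval τ rejectFirst ≡ preferReject (x m) s a u
      guard≡ = formula-cong s≡ μ Qu Qa Fa w′ Aa p′ Fu e′
      pos≡ : regs τ 18 + regs τ 16 + regs τ 19 ≡ suc m * M + s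
      pos≡ = cong₂ _+_ (trans (cong₂ _+_ row (M≡ rdy)) (+-comm (m * M) M)) s≡
      bounds = cell≤B (suc m) s m<n
      F≤ = proj₁ bounds
      A≤ = proj₁ (proj₂ bounds)
      Q≤ = proj₁ (proj₂ (proj₂ bounds))

    LayerInv : ℕ → State → Set
    LayerInv m τ = regs τ 17 ≡ m × regs τ 18 ≡ m * M × tables τ (suc m * M)

    layer-runs : ∀ {m τ} → Ready τ → m < n → LayerInv m τ →
      Runs B layerC τ (LayerInv (suc m)) (5 + (2 + ((M * 174 + 4) + 8)))
    layer-runs {m} {τ} rdy m<n (m≡ , row , tab) =
      subst (_≤ B) (sym job) (≤-trans (<⇒≤ (x<n m<n)) n≤B) ⨾R
      z≤n ⨾R
      (forR M (CellInv m) (λ fr (s≡ , _) → cong₂ _∸_ (M≡ (frame-ready fr rdy₁)) s≡)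
        (λ fr s<M inv → cell-runs (frame-ready fr rdy₁) m<n s<M (trans (keptReg fr 18) row) (trans (keptReg fr 20) job) inv)
        (refl , subst (tables τ) (sym (+-identityʳ (suc m * M))) tab)
      ⨾F λ {τ′} fr (_ , tab′) →
        let row′ = trans (cong₂ _+_ (trans (keptReg fr 18) row) (M≡ (frame-ready fr rdy₁))) (+-comm (m * M) M)
            m≡′ = trans (cong (_+ 1) (trans (keptReg fr 17) m≡)) (+-comm m 1)
        in
        ≤-trans (≤-reflexive row′) (≤-trans (*-monoˡ-≤ M m<n) nM≤B) ⨾R
        assignR (≤-trans (≤-reflexive m≡′) (≤-trans m<n n≤B))
          (m≡′ , row′ , subst (tables τ′) (+-comm (suc m * M) M) tab′))
      where
      job : arrays τ 5 (regs τ 4 + regs τ 17) ≡ x m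
      job = cong₂ (λ f i → f i) (X≡ rdy) (cong₂ _+_ (base≡ rdy) m≡)
      rdy₁ : Ready (setReg (setReg τ 20 (arrays τ 5 (regs τ 4 + regs τ 17))) 19 0)
      rdy₁ = record
        { input = record { n≡ = n≡ (input rdy) ; k≡ = k≡ (input rdy) ; p≡ = p≡ (input rdy) ; w≡ = w≡ (input rdy) ; e≡ = e≡ (input rdy) }
        ; base≡ = base≡ rdy ; M≡ = M≡ rdy ; X≡ = X≡ rdy ; mu≡ = mu≡ rdy }

    dp-runs : ∀ {σ} → Ready σ → regs σ 17 ≡ 0 → regs σ 18 ≡ 0 →
      (∀ i → arrays σ 9 i ≡ 0) → (∀ i → arrays σ 10 i ≡ 0) → (∀ i → arrays σ 11 i ≡ 0) → (∀ i → arrays σ 12 i ≡ 0) →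
      Runs B dpC σ (LayerInv n) (5 + (n * (4 + (5 + (2 + ((M * 174 + 4) + 8)))) + 4))
    dp-runs {σ} rdy m≡0 row≡0 z₉ z₁₀ z₁₁ z₁₂ =
      subst (_≤ B) (trans (+-comm 1 k) (cong (_+ 1) (sym (k≡ (input rdy))))) k<B ⨾S
      forR n LayerInv (λ fr (m≡ , _) → cong₂ _∸_ (n≡ (input (frame-ready fr rdy₁))) m≡)
        (λ fr m<n inv → layer-runs (frame-ready fr rdy₁) m<n inv)
        (m≡0 , row≡0 , record
          { values  = base-layer value (λ { zero → refl ; (suc _) → refl }) z₉
          ; loads   = base-layer load (λ { zero → refl ; (suc _) → refl }) z₁₀
          ; budgets = λ m s s<M lt → update-elim (λ i v → m * M + s ≡ i → v ≡ budget (cell m s)) (arrays σ 11) 0 _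
              (λ eq → first m s eq) (λ 0≢i eq → trans (z₁₁ _) (sym (later m s s<M lt (λ z → 0≢i (trans (sym z) eq))))) (m * M + s) refl
          ; marks   = base-layer mark (λ { zero → refl ; (suc _) → refl }) z₁₂
          })
      where
      rdy₁ : Ready (setCell σ 11 0 (regs σ 1 + 1))
      rdy₁ = record
        { input = record { n≡ = n≡ (input rdy) ; k≡ = k≡ (input rdy) ; p≡ = p≡ (input rdy) ; w≡ = w≡ (input rdy) ; e≡ = e≡ (input rdy) }
        ; base≡ = base≡ rdy ; M≡ = M≡ rdy ; X≡ = X≡ rdy ; mu≡ = mu≡ rdy }
      layer≡0 : ∀ {m s} → m * M + s < 1 * M → m ≡ 0
      layer≡0 {zero}      lt = refl
      layer≡0 {suc m} {s} lt = contradiction lt (≤⇒≯ (≤-trans (+-monoʳ-≤ M z≤n) (m≤m+n (M + m * M) s)))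
      base-layer : ∀ {a} f → (∀ s → f (cell 0 s) ≡ 0) → (∀ i → a i ≡ 0) → Tabulated a f (1 * M)
      base-layer f f≡0 z m s s<M lt with layer≡0 {m} lt
      ... | refl = trans (z s) (sym (f≡0 s))
      first : ∀ m s → m * M + s ≡ 0 → regs σ 1 + 1 ≡ budget (cell m s)
      first m s eq with m+n≡0⇒n≡0 (m * M) eq | m*n≡0⇒m≡0∨n≡0 m (m+n≡0⇒m≡0 (m * M) eq)
      ... | refl | inj₁ refl = trans (cong (_+ 1) (k≡ (input rdy))) (+-comm k 1)
      ... | refl | inj₂ refl = contradiction 1≤M n≮0
      later : ∀ m s → s < M → m * M + s < 1 * M → m * M + s ≢ 0 → budget (cell m s) ≡ 0
      later m s s<M lt ≢0 with layer≡0 {m} lt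
      later .0 zero    s<M lt ≢0 | refl = contradiction refl ≢0
      later .0 (suc s) s<M lt ≢0 | refl = refl

    inTable : ∀ {m s} → m ≤ n → s < M → m * M + s < suc n * M
    inTable {m} {s} m≤n s<M = <-≤-trans (subst (m * M + s <_) (+-comm (m * M) M) (+-monoʳ-< (m * M) s<M)) (*-monoˡ-≤ M (s≤s m≤n))

    ScanInv : ℕ → State → Set
    ScanInv s τ = regs τ 21 ≡ s × regs τ 22 < M × budget (cell n (regs τ 22)) ≢ 0 ×
      (∀ {s′} → s′ < s → budget (cell n s′) ≢ 0 → value (cell n (regs τ 22)) ≤ value (cell n s′))

    scan-runs : ∀ {σ} → Ready σ → regs σ 18 ≡ n * M → tables σ (suc n * M) → regs σ 21 ≡ 0 → regs σ 22 ≡ 0 →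
      budget (cell n 0) ≢ 0 → Runs B scanC σ (ScanInv M) (M * 40 + 4)
    scan-runs {σ} rdy row tab s≡0 best≡0 reach = forR M ScanInv
      (λ fr (s≡ , _) → cong₂ _∸_ (M≡ (frame-ready fr rdy)) s≡) body
      (s≡0 , subst (_< M) (sym best≡0) 1≤M , subst (λ b → budget (cell n b) ≢ 0) (sym best≡0) reach , λ ())
      where
      body : ∀ {s τ} → Frame scanBodyC σ τ → s < M → ScanInv s τ → Runs B scanBodyC τ (ScanInv (suc s)) 36
      body {s} {τ} fr s<M (s≡ , b<M , b≢0 , best) = weaken (≤ᵇ⇒≤ _ 36 tt)
        (ifR {Q = λ τ′ → regs τ′ 21 ≡ s × regs τ′ 22 < M × budget (cell n (regs τ′ 22)) ≢ 0 ×
               (∀ {s′} → s′ < suc s → budget (cell n s′) ≢ 0 → value (cell n (regs τ′ 22)) ≤ value (cell n s′))}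
          (λ g → let g′ = subst (_≢ 0) guard≡ g
                     better = m∸n≢0⇒n<m (m*n≢0ʳ {budget (cell n s)} g′)
                     at-s : ∀ {P : ℕ → Set} → P s → P (regs τ 21)
                     at-s {P} = subst P (sym s≡)
                 in
            assignR (subst (_≤ B) (sym s≡) (≤-trans (<⇒≤ s<M) M≤B))
              (s≡ , at-s {_< M} s<M , at-s {λ b → budget (cell n b) ≢ 0} (m*n≢0ˡ g′) ,
               at-s {λ b → ∀ {s′} → s′ < suc s → budget (cell n s′) ≢ 0 → value (cell n b) ≤ value (cell n s′)}
                 (extend (λ s′<s ≢0 → ≤-trans (<⇒≤ better) (best s′<s ≢0)) (λ _ → ≤-refl))))
          (λ g → skipR (s≡ , b<M , b≢0 , extend best
            (λ ≢0 → m∸n≡0⇒m≤n (m*n≡0⇒n≡0 ≢0 (trans (sym guard≡) g)))))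
        ⨾F λ _ (s≡′ , inv) →
          let next = trans (cong (_+ 1) s≡′) (+-comm s 1) in
          assignR (≤-trans (≤-reflexive next) (≤-trans s<M M≤B)) (next , inv))
        where
        row′ : regs τ 18 ≡ n * M
        row′ = trans (keptReg fr 18) row
        guard≡ : arrays τ 11 (regs τ 18 + regs τ 21) * (arrays τ 9 (regs τ 18 + regs τ 22) ∸ arrays τ 9 (regs τ 18 + regs τ 21))
               ≡ budget (cell n s) * (value (cell n (regs τ 22)) ∸ value (cell n s))
        guard≡ rewrite keptArr fr 11 {tt} | keptArr fr 9 {tt} = cong₂ _*_
          (Tabulated-at (arrays σ 11) budget n (budgets tab) row′ s≡ s<M (inTable ≤-refl s<M))
          (cong₂ _∸_ (Tabulated-at (arrays σ 9) value n (values tab) row′ refl b<M (inTable ≤-refl b<M))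
                     (Tabulated-at (arrays σ 9) value n (values tab) row′ s≡ s<M (inTable ≤-refl s<M)))
        extend : ∀ {v} → (∀ {s′} → s′ < s → budget (cell n s′) ≢ 0 → v ≤ value (cell n s′)) →
                 (budget (cell n s) ≢ 0 → v ≤ value (cell n s)) →
                 ∀ {s′} → s′ < suc s → budget (cell n s′) ≢ 0 → v ≤ value (cell n s′)
        extend old new {s′} s′<1+s ≢0 with s′ ≟ s
        ... | yes refl = new ≢0
        ... | no  s′≢s = old (≤∧≢⇒< (≤-pred s′<1+s) s′≢s) ≢0

    Emitted : (rej start : ℕ → ℕ) → ℕ → ℕ → Set
    Emitted rej start zero    s = ⊤
    Emitted rej start (suc m) s = rej (x m) ≡ mark (cell (suc m) s) ×
      start (x m) ≡ load (cell m (previous m s)) × Emitted rej start m (previous m s)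

    marked : (ℕ → ℕ) → ℕ → Bool
    marked rej j = not (does (rej j ≟ 0))

    Emitted⇒trace : ∀ {rej start} m s → Emitted rej start m s → trace m s ≡ restrict (marked rej) m
    Emitted⇒trace zero    s _            = refl
    Emitted⇒trace (suc m) s (r≡ , _ , h) = cong₂ _∷_ (cong (λ v → not (does (v ≟ 0))) (sym r≡)) (Emitted⇒trace m (previous m s) h)

    Emitted⇒start : ∀ {rej start} m s → budget (cell m s) ≢ 0 → Emitted rej start m s →
                    ∀ {i} → i < m → start (x i) ≡ busy (restrict (marked rej) i)
    Emitted⇒start {rej} (suc m) s reach (_ , s≡ , h) {i} i<1+m with i ≟ m
    ... | yes refl = trans s≡ (trans (load≡ (trace-sound m _ (previous-reachable m s reach)))
                       (cong busy (Emitted⇒trace {rej} m (previous m s) h)))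
    ... | no  i≢m  = Emitted⇒start m (previous m s) (previous-reachable m s reach) h (≤∧≢⇒< (≤-pred i<1+m) i≢m)

    module _ (x-injective : ∀ {i j} → i < n → j < n → x i ≡ x j → i ≡ j) (s₀ : ℕ) where

      Agrees : (rej start : ℕ → ℕ) → ℕ → State → Set
      Agrees rej start m τ = ∀ {j} → m ≤ j → j < n → rej (x j) ≡ arrays τ 3 (x j) × start (x j) ≡ arrays τ 4 (x j)

      -- The output arrays are unfinished, so the invariant quantifies over what they may become:
      -- arrays that keep the entries written so far and fulfil the rest of the trace fulfil all of
      -- it. Injectivity of the order protects earlier entries.
      BackInv : ℕ → State → Set
      BackInv i τ = regs τ 17 ≡ n ∸ i × regs τ 18 ≡ (n ∸ i) * M × regs τ 22 < M ×
        (∀ {rej start} → Agrees rej start (n ∸ i) τ → Emitted rej start (n ∸ i) (regs τ 22) → Emitted rej start n s₀)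

      back-runs : ∀ {σ} → Ready σ → regs σ 17 ≡ n → regs σ 18 ≡ n * M → tables σ (suc n * M) → regs σ 22 ≡ s₀ → s₀ < M →
        Runs B backC σ (λ τ → Emitted (arrays τ 3) (arrays τ 4) n s₀) (n * 50 + 2)
      back-runs {σ} rdy m≡ row tab s≡ s₀<M = consequence
        -- After the last round the final arrays themselves are inserted, and nothing of the trace
        -- is left.
        (λ {τ} _ (_ , _ , _ , h) → h (λ _ _ → refl , refl)
          (subst (λ m → Emitted (arrays τ 3) (arrays τ 4) m (regs τ 22)) (sym (n∸n≡0 n)) tt))
        (forR n BackInv (λ _ (m≡ , _) → m≡) body
          (m≡ , row , subst (_< M) (sym s≡) s₀<M , λ {rej} {start} _ h → subst (Emitted rej start n) s≡ h))
        where
        body : ∀ {i τ} → Frame backBodyC σ τ → i < n → BackInv i τ → Runs B backBodyC τ (BackInv (suc i)) 48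
        body {i} {τ} fr i<n (m≡ , row , s<M , h) = weaken (≤ᵇ⇒≤ _ 48 tt)
          (≤-trans (≤-reflexive m≡′) (≤-trans (<⇒≤ m<n) n≤B) ⨾R
           ≤-trans (≤-reflexive row′) (≤-trans (*-monoˡ-≤ M (<⇒≤ m<n)) nM≤B) ⨾R
           ≤-trans (≤-reflexive job) (≤-trans (<⇒≤ (x<n m<n)) n≤B) ⨾R
           ≤-trans (≤-reflexive mark≡) (proj₂ (proj₂ (proj₂ (cell≤B (suc m) s m<n)))) ⨾S
           ≤-trans (≤-reflexive s′≡) (≤-trans (<⇒≤ s′<M) M≤B) ⨾R
           storeR (≤-trans (≤-reflexive load≡′) (proj₁ (proj₂ (cell≤B m s′ (<⇒≤ m<n)))))
             (m≡′ , row′ , subst (_< M) (sym s′≡) s′<M , emit))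
          where
          rdy′ = frame-ready fr rdy
          m = n ∸ suc i
          s = regs τ 22
          s′ = previous m s
          n∸i≡ : n ∸ i ≡ suc m
          n∸i≡ = +-∸-assoc 1 i<n
          m<n : m < n
          m<n = ∸-monoʳ-< z<s i<n
          m≡′ : regs τ 17 ∸ 1 ≡ m
          m≡′ = cong (_∸ 1) (trans m≡ n∸i≡)
          row′ : regs τ 18 ∸ regs τ 16 ≡ m * M
          row′ = trans (cong₂ _∸_ (trans row (cong (_* M) n∸i≡)) (M≡ rdy′)) (m+n∸m≡n M (m * M))
          j₀ = arrays τ 5 (regs τ 4 + (regs τ 17 ∸ 1))
          job : j₀ ≡ x m
          job = cong₂ (λ f i → f i) (X≡ rdy′) (cong₂ _+_ (base≡ rdy′) m≡′)
          R = arrays τ 12 (regs τ 18 ∸ regs τ 16 + regs τ 16 + regs τ 22)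
          mark≡ : R ≡ mark (cell (suc m) s)
          mark≡ rewrite keptArr fr 12 {tt} = Tabulated-at (arrays σ 12) mark (suc m) (marks tab)
            (trans (cong₂ _+_ row′ (M≡ rdy′)) (+-comm (m * M) M)) refl s<M (inTable m<n s<M)
          s′≡ : regs τ 22 ∸ R * arrays τ 8 j₀ ≡ s′
          s′≡ = cong (regs τ 22 ∸_) (cong₂ _*_ mark≡ (cong₂ (λ f i → f i) (mu≡ rdy′) job))
          s′<M : s′ < M
          s′<M = ≤-<-trans (m∸n≤m s (mark (cell (suc m) s) * mu (x m))) s<M
          A = arrays τ 10 (regs τ 18 ∸ regs τ 16 + (regs τ 22 ∸ R * arrays τ 8 j₀))
          load≡′ : A ≡ load (cell m s′)
          load≡′ rewrite keptArr fr 10 {tt} = Tabulated-at (arrays σ 10) load m (loads tab) row′ s′≡ s′<M (inTable (<⇒≤ m<n) s′<M)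
          emit : ∀ {rej start} →
            (∀ {j} → m ≤ j → j < n → rej (x j) ≡ update (arrays τ 3) j₀ R (x j) × start (x j) ≡ update (arrays τ 4) j₀ A (x j)) →
            Emitted rej start m (regs τ 22 ∸ R * arrays τ 8 j₀) → Emitted rej start n s₀
          emit {rej} {start} agr em = h agr′ (subst (λ l → Emitted rej start l s) (sym n∸i≡)
            (trans (proj₁ atm) (trans (cong (λ y → update (arrays τ 3) y R (x m)) job) (trans (update-same (arrays τ 3) (x m) R) mark≡)) ,
             trans (proj₂ atm) (trans (cong (λ y → update (arrays τ 4) y A (x m)) job) (trans (update-same (arrays τ 4) (x m) A) load≡′)) ,
             subst (Emitted rej start m) s′≡ em))
            where
            atm = agr ≤-refl m<n
            agr′ : ∀ {j} → n ∸ i ≤ j → j < n → rej (x j) ≡ arrays τ 3 (x j) × start (x j) ≡ arrays τ 4 (x j)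
            agr′ {j} ≤j j<n =
              let m<j = subst (_≤ j) n∸i≡ ≤j
                  j₀≢ : j₀ ≢ x j
                  j₀≢ eq = <⇒≢ m<j (x-injective m<n j<n (trans (sym job) eq))
                  r , st = agr (<⇒≤ m<j) j<n
              in trans r (update-other (arrays τ 3) R j₀≢) , trans st (update-other (arrays τ 4) A j₀≢)

-- The theorem

term≤sum : ∀ {n} (f : Fin n → ℕ) j → f j ≤ sumℕ f
term≤sum f zero    = m≤m+n _ _
term≤sum f (suc j) = ≤-trans (term≤sum (f ∘ suc) j) (m≤n+m _ _)

padded≤ : ∀ {n} (f : Fin n → ℕ) {b} → (∀ j → f j ≤ b) → ∀ i → padded f i ≤ b
padded≤ {n} f h i with i <? n
... | yes _ = h _
... | no  _ = z≤n

choice : ∀ {n} {Q : ℕ → ℕ → Set} → (∀ {b} → b < n → ∃[ t ] Q b t) → ∃[ f ] (∀ {b} → b < n → Q b (f b))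
choice {n} {Q} h = f , spec
  where
  f : ℕ → ℕ
  f b with b <? n
  ... | yes b<n = proj₁ (h b<n)
  ... | no  _   = 0
  spec : ∀ {b} → b < n → Q b (f b)
  spec {b} b<n with b <? n
  ... | yes b<n = proj₂ (h b<n)
  ... | no  b≮n = contradiction b<n b≮n

padded-< : ∀ {n} (f : Fin n → ℕ) {i} (i<n : i < n) → padded f i ≡ f (fromℕ< i<n)
padded-< f i<n = trans (cong (padded f) (sym (toℕ-fromℕ< i<n))) (padded-toℕ f (fromℕ< i<n))

module _ (I : Instance) where

  open Instance I

  -- Pigeonhole: each value has a position in the deduplicated list, and looking up that position
  -- returns the value, so distinct values have distinct positions.
  distinct≤distinctTimes : ∀ {c} (f : ℕ → ℕ) → (∀ {t} → t < c → ∃[ b ] (b < n × f t ≡ padded p b)) →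
    (∀ {t t′} → t < t′ → t′ < c → f t ≢ f t′) → c ≤ distinctTimes I
  distinct≤distinctTimes {c} f value distinct = injective⇒≤ {f = position} position-injective
    where
    times = deduplicate _≟_ (List.tabulate p)
    occurs : (t : Fin c) → f (toℕ t) ∈ times
    occurs t = let b , b<n , eq = value (toℕ<n t) in
      ∈-deduplicate⁺ _≟_ (subst (_∈ List.tabulate p) (sym (trans eq (padded-< p b<n))) (∈-tabulate⁺ (fromℕ< b<n)))
    position : Fin c → Fin (length times)
    position t = index (occurs t)
    same-value : ∀ {t t′} → position t ≡ position t′ → f (toℕ t) ≡ f (toℕ t′)
    same-value {t} {t′} eq = trans (lookup-index (occurs t))
      (trans (cong (List.lookup times) eq) (sym (lookup-index (occurs t′))))
    position-injective : ∀ {t t′} → position t ≡ position t′ → t ≡ t′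
    position-injective {t} {t′} eq with <-cmp (toℕ t) (toℕ t′)
    ... | tri< t<t′ _ _ = contradiction (same-value eq) (distinct t<t′ (toℕ<n t′))
    ... | tri≈ _ t≡t′ _ = toℕ-injective t≡t′
    ... | tri> _ _ t>t′ = contradiction (sym (same-value eq)) (distinct t>t′ (toℕ<n t))

-- The summand 1 is for the instance without jobs, where the time bound is 0 but the table still has
-- one column.
powers≤timeBound : ∀ I → suc (Instance.k I) ^ distinctTimes I ≤ 1 + timeBound I
powers≤timeBound record { n = zero } = ≤-refl
powers≤timeBound I@(record { n = suc n ; k = k }) = begin
  suc k ^ distinctTimes I               ≡⟨ cong (_^ distinctTimes I) (+-comm 1 k) ⟩
  (k + 1) ^ distinctTimes I             ≤⟨ m≤m+n _ _ ⟩
  suc n * (k + 1) ^ distinctTimes I     ≤⟨ m≤m+n _ _ ⟩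
  timeBound I                           ≤⟨ n≤1+n _ ⟩
  1 + timeBound I                       ∎
  where open ≤-Reasoning

log≤timeBound : ∀ I → ⌈log₂ Instance.n I ⌉ ≤ 1 + timeBound I
log≤timeBound record { n = zero } = z≤n
log≤timeBound I@(record { n = suc n ; k = k }) = ≤-trans (m≤m+n _ _)
  (≤-trans (m≤n+m (suc n * ⌈log₂ suc n ⌉) (suc n * (k + 1) ^ distinctTimes I)) (n≤1+n _))

-- Word size, optimality and running time

record Bounds (I : Instance) (N B : ℕ) : Set where
  open Instance I
  field
    p≤N        : ∀ i → padded p i ≤ N
    w≤N        : ∀ i → padded w i ≤ N
    e≤N        : ∀ i → padded e i ≤ N
    N≤B        : N ≤ B
    1≤B        : 1 ≤ B
    n≤B        : n ≤ B
    k<B        : k < B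
    steps≤B    : 1 + timeBound I ≤ B
    sortRoom   : n * ⌈log₂ n ⌉ + n + n ≤ B
    load≤B     : n * N ≤ B
    value≤B    : n * (N + N * (n * N)) ≤ B

module _ (I : Instance) where

  open Instance I

  private
    size N B : ℕ
    size = sumℕ (λ j → p j + w j + e j)
    N = 2 + n + k + size + timeBound I
    -- The largest words are costs, at most `n * (N + N * (n * N))`. This is below twice `N ^ 4`,
    -- hence below `N ^ 5` because `N` is at least 2.
    B = wordBound 5 I

    timeBound+n≤N : timeBound I + n ≤ N
    timeBound+n≤N = ≤-trans (≤-reflexive (+-comm (timeBound I) n)) (+-monoˡ-≤ (timeBound I)
      (≤-trans (m≤n+m n 2) (≤-trans (m≤m+n (2 + n) k) (m≤m+n (2 + n + k) size))))

    timeBound≤N : 1 + timeBound I ≤ N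
    timeBound≤N = +-monoˡ-≤ (timeBound I) {1} {2 + n + k + size} (s≤s z≤n)

    2≤N : 2 ≤ N
    2≤N = s≤s (s≤s z≤n)

    n≤N : n ≤ N
    n≤N = ≤-trans (m≤n+m n (timeBound I)) timeBound+n≤N

    k<N : k < N
    k<N = ≤-trans (≤-trans (s≤s (≤-trans (m≤n+m k n) (n≤1+n _))) (m≤m+n (2 + n + k) size)) (m≤m+n _ (timeBound I))

    size≤N : size ≤ N
    size≤N = ≤-trans (m≤n+m size (2 + n + k)) (m≤m+n _ (timeBound I))

    N^≤B : ∀ i → i ≤ 5 → N ^ i ≤ B
    N^≤B i i≤5 = ^-monoʳ-≤ N i≤5

    N≤B : N ≤ B
    N≤B = ≤-trans (≤-reflexive (sym (*-identityʳ N))) (N^≤B 1 (s≤s z≤n))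

    N*N≤B : N * N ≤ B
    N*N≤B = ≤-trans (≤-reflexive (cong (N *_) (sym (*-identityʳ N)))) (N^≤B 2 (s≤s (s≤s z≤n)))

    N+N≤N*N : N + N ≤ N * N
    N+N≤N*N = ≤-trans (≤-reflexive (cong (N +_) (sym (+-identityʳ N)))) (*-monoˡ-≤ N 2≤N)

    sortRoom : n * ⌈log₂ n ⌉ + n + n ≤ B
    sortRoom = ≤-trans (+-mono-≤ (≤-trans (+-monoˡ-≤ n (m≤n+m _ (n * (k + 1) ^ distinctTimes I))) timeBound+n≤N) n≤N) (≤-trans N+N≤N*N N*N≤B)

    value≤B : n * (N + N * (n * N)) ≤ B
    value≤B = begin
      n * (N + N * (n * N))       ≤⟨ *-mono-≤ n≤N (+-mono-≤ (≤-trans (≤-reflexive (sym (*-identityʳ N))) (*-monoʳ-≤ N 1≤N*N)) (*-monoʳ-≤ N (*-monoˡ-≤ N n≤N))) ⟩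
      N * (N * (N * N) + N * (N * N)) ≤⟨ *-monoʳ-≤ N (≤-trans (≤-reflexive (cong (N * (N * N) +_) (sym (+-identityʳ _)))) (*-monoˡ-≤ (N * (N * N)) 2≤N)) ⟩
      N * (N * (N * (N * N)))     ≡⟨ cong (λ m → N * (N * (N * (N * m)))) (sym (*-identityʳ N)) ⟩
      B                           ∎
      where
      open ≤-Reasoning
      1≤N*N : 1 ≤ N * N
      1≤N*N = *-mono-≤ {1} {N} {1} {N} (<⇒≤ 2≤N) (<⇒≤ 2≤N)

    p≤N : ∀ i → padded p i ≤ N
    p≤N = padded≤ p (λ j → ≤-trans (≤-trans (≤-trans (m≤m+n (p j) (w j)) (m≤m+n _ (e j))) (term≤sum (λ j → p j + w j + e j) j)) size≤N)

    w≤N : ∀ i → padded w i ≤ N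
    w≤N = padded≤ w (λ j → ≤-trans (≤-trans (≤-trans (m≤n+m (w j) (p j)) (m≤m+n _ (e j))) (term≤sum (λ j → p j + w j + e j) j)) size≤N)

    e≤N : ∀ i → padded e i ≤ N
    e≤N = padded≤ e (λ j → ≤-trans (≤-trans (m≤n+m (e j) (p j + w j)) (term≤sum (λ j → p j + w j + e j) j)) size≤N)

  bounds : Bounds I N B
  bounds = record
    { p≤N = p≤N ; w≤N = w≤N ; e≤N = e≤N ; N≤B = N≤B ; 1≤B = ≤-trans (<⇒≤ 2≤N) N≤B
    ; n≤B = ≤-trans n≤N N≤B ; k<B = ≤-trans k<N N≤B ; steps≤B = ≤-trans timeBound≤N N≤B
    ; sortRoom = sortRoom ; load≤B = ≤-trans (*-monoˡ-≤ N n≤N) N*N≤B ; value≤B = value≤B }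

module Correctness (I : Instance) {N B : ℕ} (bounded : Bounds I N B) where

  open Instance I
  open Bounds bounded

  D K^D : ℕ
  D = distinctTimes I
  K^D = suc k ^ D

  n*K^D≤ : n * K^D ≤ timeBound I
  n*K^D≤ = ≤-trans (≤-reflexive (cong (λ b → n * b ^ D) (+-comm 1 k))) (m≤m+n _ (n * ⌈log₂ n ⌉))

  n≤timeBound : n ≤ timeBound I
  n≤timeBound = ≤-trans (≤-trans (≤-reflexive (sym (*-identityʳ n))) (*-monoʳ-≤ n (m^n>0 (suc k) D))) n*K^D≤

  n*log≤ : n * ⌈log₂ n ⌉ ≤ timeBound I
  n*log≤ = m≤n+m _ (n * (k + 1) ^ D)

  tailTime : ℕ → ℕ
  tailTime m = (5 + (n * (4 + (5 + (2 + ((m * 174 + 4) + 8)))) + 4)) + ((m * 40 + 4) + (n * 50 + 2))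

  tailTime-mono : ∀ {m m′} → m ≤ m′ → tailTime m ≤ tailTime m′
  tailTime-mono {m} {m′} h = +-mono-≤
    (+-monoʳ-≤ 5 (+-monoˡ-≤ 4 (*-monoʳ-≤ n (+-monoʳ-≤ 11 (+-monoˡ-≤ 8 (+-monoˡ-≤ 4 (*-monoˡ-≤ 174 h)))))))
    (+-monoˡ-≤ (n * 50 + 2) (+-monoˡ-≤ 4 (*-monoˡ-≤ 40 h)))

  p≤B : ∀ {b} → b < n → padded p b ≤ B
  p≤B {b} _ = ≤-trans (p≤N b) N≤B

  module Ph = Phases n k (padded p) (padded w) (padded e) B
  module Ty = Types n k (padded p) (padded w) (padded e) B D (distinct≤distinctTimes I)
    (≤-trans (powers≤timeBound I) steps≤B) n≤B p≤B

  module Final (X : ℕ → ℕ) (base : ℕ) (perm : seg X base n ↭ seg id 0 n) (ordered : Ph.Ordered (seg X base n))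
    (dist pow mu : ℕ → ℕ) (c M : ℕ) (typing : Ty.Typing n dist pow mu c M) where

    module Tab = Tabulation n k (padded p) (padded w) (padded e) B X base mu M N
    open Tab using (x; Ready; key; Faithful; rejections; restrict; cell; budget; complete; trace-sound; total)
    module Sol = Solutions I X base

    x<n : ∀ {i} → i < n → x i < n
    x<n = Sol.x<n perm

    keys : Faithful n × (∀ (d : Vec Bool n) → rejections d ≤ k → key d < M)
    keys with k ≟ 0
    -- No times are registered here, so each job serves as its own type. In base 1 all powers are 1,
    -- hence every choice of exponent fits `mu` and `M`.
    ... | yes k≡0 = faithful , λ d d≤k → subst (key d <_) M≡ (key< ≤-refl d d≤k)
      where
      one : ∀ t → suc k ^ t ≡ 1
      one t = trans (cong (λ k → suc k ^ t) k≡0) (^-zeroˡ t)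
      mu≡1 : ∀ {i} → i < n → mu (x i) ≡ suc k ^ x i
      mu≡1 {i} i<n = let t , mu≡ , _ = Ty.covered typing (x<n i<n) in trans mu≡ (trans (one t) (sym (one (x i))))
      open Tab.Digits id (padded p) n n x<n mu≡1 (λ _ → refl)
      M≡ : suc k ^ n ≡ M
      M≡ = trans (one n) (sym (trans (Ty.M≡ typing) (one c)))
    ... | no k≢0 = faithful , λ d d≤k → subst (key d <_) (sym (Ty.M≡ typing)) (key< ≤-refl d d≤k)
      where
      typed : ∃[ ty ] (∀ {b} → b < n → ty b < c × mu b ≡ suc k ^ ty b × padded p b ≡ dist (ty b))
      typed = choice (λ b<n → found (Ty.covered typing b<n))
        where
        found : ∀ {b} → ∃[ t ] (mu b ≡ suc k ^ t × (k ≡ 0 ⊎ (t < c × padded p b ≡ dist t))) →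
                ∃[ t ] (t < c × mu b ≡ suc k ^ t × padded p b ≡ dist t)
        found (t , mu≡ , inj₁ k≡0)        = contradiction k≡0 k≢0
        found (t , mu≡ , inj₂ (t<c , p≡)) = t , t<c , mu≡ , p≡
      ty = proj₁ typed
      ty-spec = proj₂ typed
      open Tab.Digits ty dist c n (λ i<n → proj₁ (ty-spec (x<n i<n)))
        (λ i<n → proj₁ (proj₂ (ty-spec (x<n i<n)))) (λ i<n → proj₂ (proj₂ (ty-spec (x<n i<n))))

    M≤K^D : M ≤ K^D
    M≤K^D = Ty.M≤K^D typing

    M≤B : M ≤ B
    M≤B = ≤-trans M≤K^D (≤-trans (powers≤timeBound I) steps≤B)

    small : ∀ {i} → i < n → padded p (x i) ≤ N × padded w (x i) ≤ N × padded e (x i) ≤ N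
    small {i} _ = p≤N (x i) , w≤N (x i) , e≤N (x i)

    open Tab.Run (≤-trans (m^n>0 (suc k) c) (≤-reflexive (sym (Ty.M≡ typing)))) n≤B
      (≤-trans (*-monoʳ-≤ n M≤K^D) (≤-trans n*K^D≤ (≤-trans (n≤1+n _) steps≤B)))
      M≤B k<B x<n small load≤B value≤B hiding (1≤B)

    none : Vec Bool n
    none = restrict (λ _ → false) n

    none-rejections : ∀ m → rejections (restrict (λ _ → false) m) ≡ 0
    none-rejections zero    = refl
    none-rejections (suc m) = none-rejections m

    none-key : ∀ m → key (restrict (λ _ → false) m) ≡ 0
    none-key zero    = refl
    none-key (suc m) = none-key m

    -- Rejecting nothing has key 0, so the scan may start with state 0 as its current best.
    reach₀ : budget (cell n 0) ≢ 0
    reach₀ = subst (λ s → budget (cell n s) ≢ 0) (none-key n)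
      (proj₁ (complete (proj₁ keys) ≤-refl none (≤-trans (≤-reflexive (none-rejections n)) z≤n)))

    optimal : ∀ {τ s₀} → budget (cell n s₀) ≢ 0 →
      (∀ {s} → s < M → budget (cell n s) ≢ 0 → Tab.value (cell n s₀) ≤ Tab.value (cell n s)) →
      Emitted (arrays τ 3) (arrays τ 4) n s₀ → Optimal I (output I τ)
    optimal {τ} {s₀} reach best em =
      Sol.feasible perm S r s r≡ s≡ start≡ rej≤k (λ a → ℕ→ℚ≥0 (arrays τ 4 a)) ,
      λ S′ feas → let
          R′ = Solution.rejected S′
          r′ = pad false (lookup R′)
          s′ = pad 0ℚ (Solution.start S′)
          r′≡ = λ j → sym (pad-toℕ false (lookup R′) j)
          s′≡ = λ j → sym (pad-toℕ 0ℚ (Solution.start S′) j)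
          d′ = restrict r′ n
          d′≤k : rejections d′ ≤ k
          d′≤k = ≤-trans (≤-reflexive (sym (Sol.∣rejected∣≡ perm S′ r′ s′ r′≡ s′≡))) (Feasible.atMostK feas)
          reach′ , val≤ = complete (proj₁ keys) ≤-refl d′ d′≤k
      -- The chain: own cost equals the value of the chosen state, which is at most the value at the
      -- key of the competitor's decisions, hence at most their total, which bounds the competitor's
      -- cost from below by Smith's rule.
      in ℚ.≤-trans (ℚ.≤-reflexive (Sol.cost≡total perm S r s r≡ s≡ start≡))
         (ℚ.≤-trans (ℕ→ℚ-mono (≤-trans (≤-reflexive total≡) (≤-trans (best (proj₂ keys d′ d′≤k) reach′) val≤)))
           (Sol.cost-lower perm S′ r′ s′ r′≡ s′≡ exchange feas))
      where
      S = output I τ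
      r = marked (arrays τ 3)
      s = ℕ→ℚ ∘ arrays τ 4
      r≡ : ∀ j → lookup (Solution.rejected S) j ≡ r (toℕ j)
      r≡ = lookup∘tabulate (λ j → r (toℕ j))
      s≡ : ∀ j → Solution.start S j ≡ s (toℕ j)
      s≡ j = refl
      snd = trace-sound n s₀ reach
      trace≡ = Emitted⇒trace {arrays τ 3} {arrays τ 4} n s₀ em
      start≡ : ∀ {i} → i < n → s (x i) ≡ ℕ→ℚ (Tab.busy (restrict r i))
      start≡ i<n = cong ℕ→ℚ (Emitted⇒start n s₀ reach em i<n)
      rej≤k : rejections (restrict r n) ≤ k
      rej≤k = subst (λ d → rejections d ≤ k) trace≡ (Tab.Sound⇒rejections≤k reach snd)
      total≡ : total (restrict r n) ≡ Tab.value (cell n s₀)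
      total≡ = trans (cong total (sym trace≡)) (sym (Tab.value≡ snd))
      exchange : ∀ {i j} → i < j → j < n → padded w (x j) * padded p (x i) ≤ padded p (x j) * padded w (x i)
      exchange i<j j<n = Ph.≲⇒exchange (AllPairs-seg X base n ordered i<j j<n)

    tail-runs : ∀ {σ} → Ready σ → regs σ 17 ≡ 0 → regs σ 18 ≡ 0 → regs σ 21 ≡ 0 → regs σ 22 ≡ 0 →
      (∀ i → arrays σ 9 i ≡ 0) → (∀ i → arrays σ 10 i ≡ 0) → (∀ i → arrays σ 11 i ≡ 0) → (∀ i → arrays σ 12 i ≡ 0) →
      Runs B (dpC ⨾ scanC ⨾ backC) σ (λ τ → Optimal I (output I τ))
        (tailTime K^D)
    tail-runs rdy z₁₇ z₁₈ z₂₁ z₂₂ z₉ z₁₀ z₁₁ z₁₂ = weaken (tailTime-mono M≤K^D) (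
      dp-runs rdy z₁₇ z₁₈ z₉ z₁₀ z₁₁ z₁₂ ⨾F λ {σ₁} f₁ (m≡ , row , tab) →
      scan-runs (Tab.frame-ready f₁ rdy) row tab (trans (keptReg f₁ 21) z₂₁) (trans (keptReg f₁ 22) z₂₂) reach₀ ⨾F
      λ {σ₂} f₂ (_ , best<M , reach , best) →
      consequence (λ {τ} _ em → optimal {τ} reach best em)
        (back-runs (Sol.x-injective perm) (regs σ₂ 22) (Tab.frame-ready f₂ (Tab.frame-ready f₁ rdy))
          (trans (keptReg f₂ 17) m≡) (trans (keptReg f₂ 18) row)
          (subst (λ (a , b , c , d) → Tab.Tables a b c d (suc n * M))
            (sym (cong₂ _,_ (keptArr f₂ 9) (cong₂ _,_ (keptArr f₂ 10) (cong₂ _,_ (keptArr f₂ 11) (keptArr f₂ 12))))) tab)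
          refl best<M))

  totalTime : ℕ → ℕ → ℕ
  totalTime l m = (n * 11 + 4) + ((2 + (l * (4 + (24 + (n * 118 + 6))) + 4)) +
    ((2 + (n * (4 + (2 + ((m * 20 + 20) + (40 + 8)))) + 4)) + tailTime m))

  -- Collecting terms gives coefficients 31, 158, 34, 118, 194 and 40 for 1, `n`, `l`, `n * l`,
  -- `n * K^D` and `K^D`. Each of these quantities is at most `1 + timeBound I`, and the
  -- coefficients add up to 575.
  totalTime≤ : totalTime ⌈log₂ n ⌉ K^D ≤ 575 * (1 + timeBound I)
  totalTime≤ = begin
    totalTime l K^D
      ≡⟨ solve 3 (λ n l K → (n :* con 11 :+ con 4) :+ ((con 2 :+ (l :* (con 4 :+ (con 24 :+ (n :* con 118 :+ con 6))) :+ con 4)) :+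
           ((con 2 :+ (n :* (con 4 :+ (con 2 :+ ((K :* con 20 :+ con 20) :+ (con 40 :+ con 8)))) :+ con 4)) :+
           ((con 5 :+ (n :* (con 4 :+ (con 5 :+ (con 2 :+ ((K :* con 174 :+ con 4) :+ con 8)))) :+ con 4)) :+ ((K :* con 40 :+ con 4) :+ (n :* con 50 :+ con 2)))))
         ∶= con 31 :+ (con 158 :* n :+ (con 34 :* l :+ (con 118 :* (n :* l) :+ (con 194 :* (n :* K) :+ con 40 :* K)))))
         refl n l K^D ⟩
    31 + (158 * n + (34 * l + (118 * (n * l) + (194 * (n * K^D) + 40 * K^D))))
      ≤⟨ +-mono-≤ (*-monoʳ-≤ 31 {1} (s≤s z≤n)) (+-mono-≤ (*-monoʳ-≤ 158 (up n≤timeBound)) (+-mono-≤ (*-monoʳ-≤ 34 (log≤timeBound I))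
         (+-mono-≤ (*-monoʳ-≤ 118 (up n*log≤)) (+-mono-≤ (*-monoʳ-≤ 194 (up n*K^D≤)) (*-monoʳ-≤ 40 (powers≤timeBound I)))))) ⟩
    31 * U + (158 * U + (34 * U + (118 * U + (194 * U + 40 * U))))
      ≡⟨ solve 1 (λ u → con 31 :* u :+ (con 158 :* u :+ (con 34 :* u :+ (con 118 :* u :+ (con 194 :* u :+ con 40 :* u)))) ∶= con 575 :* u) refl U ⟩
    575 * U ∎
    where
    open ≤-Reasoning
    open ℕ-Solver.+-*-Solver renaming (_:=_ to _∶=_)
    l = ⌈log₂ n ⌉
    U = 1 + timeBound I
    up : ∀ {a} → a ≤ timeBound I → a ≤ U
    up = m≤n⇒m≤1+n

  program-runs : Runs B program (inputState I) (λ τ → Optimal I (output I τ)) (575 * (1 + timeBound I))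
  program-runs = weaken totalTime≤ (
    Ph.identity-runs inp₀ refl (λ _ → z≤n) n≤B ⨾F λ {σ₁} f₁ (h , b) →
    Ph.sort-runs (Ph.frame-input f₁ inp₀) (keptReg f₁ 4) h b sortRoom 1≤B ⨾F λ {σ₂} f₂ (perm , ordered) →
    let inp₂ = Ph.frame-input f₂ (Ph.frame-input f₁ inp₀) in
    Ty.types-runs inp₂ (trans (keptReg f₂ 13) (keptReg f₁ 13)) (trans (keptReg f₂ 15) (keptReg f₁ 15)) 1≤B ⨾F λ {σ₃} f₃ (_ , typing) →
    Final.tail-runs (arrays σ₂ 5) (regs σ₂ 4) perm ordered _ _ _ _ _ typing
      (record { input = Ph.frame-input f₃ inp₂ ; base≡ = keptReg f₃ 4 ; M≡ = refl ; X≡ = keptArr f₃ 5 ; mu≡ = refl })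
      (trans (keptReg f₃ 17) (trans (keptReg f₂ 17) (keptReg f₁ 17)))
      (trans (keptReg f₃ 18) (trans (keptReg f₂ 18) (keptReg f₁ 18)))
      (trans (keptReg f₃ 21) (trans (keptReg f₂ 21) (keptReg f₁ 21)))
      (trans (keptReg f₃ 22) (trans (keptReg f₂ 22) (keptReg f₁ 22)))
      (λ i → cong (λ a → a i) (trans (keptArr f₃ 9) (trans (keptArr f₂ 9) (keptArr f₁ 9))))
      (λ i → cong (λ a → a i) (trans (keptArr f₃ 10) (trans (keptArr f₂ 10) (keptArr f₁ 10))))
      (λ i → cong (λ a → a i) (trans (keptArr f₃ 11) (trans (keptArr f₂ 11) (keptArr f₁ 11))))
      (λ i → cong (λ a → a i) (trans (keptArr f₃ 12) (trans (keptArr f₂ 12) (keptArr f₁ 12)))))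
    where
    inp₀ : Ph.Input (inputState I)
    inp₀ = record { n≡ = refl ; k≡ = refl ; p≡ = refl ; w≡ = refl ; e≡ = refl }

mainTheorem4 : ∃[ prog ] ∃[ c ] ∃[ d ] ((I : Instance) →
    ∃[ τ ] ∃[ t ]
    (wordBound d I ⊢ prog , inputState I ⇓ τ [ t ]) ×
    t ≤ c * (1 + timeBound I) ×
    Optimal I (output I τ))
mainTheorem4 = program , 575 , 5 , λ I →
  let runs ex t≤ opt = Correctness.program-runs I (bounds I) in _ , _ , ex , t≤ , opt
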